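{- If $y\in\mathcal{I}_\mathbb{Z}$ is I-Grassmannian, then $\hat F_y=P_{\mu(y)}$.
   Context: $S_\mathbb{Z}$ is the group of finitely supported permutations of $\mathbb{Z}$, $s_i=(i,i+1)$, $\mathcal R(w)$ the set of reduced words of $w$. For a reduced word $(s_{a_1},\dots,s_{a_\ell})$, $f_{\mathbf a}=\sum x_{i_1}\cdots x_{i_\ell}$ over positive integers $i_1\le\dots\le i_\ell$ with $i_j<i_{j+1}$ whenever $a_j<a_{j+1}$, and $F_w=\sum_{\mathbf a\in\mathcal R(w)}f_{\mathbf a}$. The Demazure product $\circ$ is the associative product on $S_\mathbb{Z}$ with $u\circ v=uv$ if lengths add and $s_i\circ s_i=s_i$. $\mathcal I_\mathbb{Z}$ is the set of involutions in $S_\mathbb{Z}$; $\mathcal A(y)$ is the set of minimal-length $w$ with $w^{ -1}\circ w=y$, and $\hat F_y=\sum_{w\in\mathcal A(y)}F_w$. An integer $i$ is a visible descent of $y$ if $y(i+1)\le\min\{i,y(i)\}$; $y$ is I-Grassmannian if it has at most one visible descent. Every I-Grassmannian $y\neq1$ can be written as $y=(\phi_1,n+1)(\phi_2,n+2)\cdots(\phi_r,n+r)$ with integers $r\ge1$, $\phi_1<\dots<\phi_r\le n$; its shape is the strict partition $\mu(y)=(n+1-\phi_1,\dots,n+1-\phi_r)$, and $\mu(1)=\emptyset$. $P_\mu$ denotes the Schur $P$-function of the strict partition $\mu$ (generating function $\sum_T x^T$ of semistandard marked shifted tableaux of shifted shape $\mu$, with no primes on the diagonal), and $P_\emptyset=1$.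 -}

module Defs where

open import Data.Bool using (Bool; true; false; if_then_else_)
open import Data.Nat using (ℕ; zero; suc; _≤_; _<_; ⌊_/2⌋)
open import Data.Integer using (ℤ; +_; ∣_∣)
import Data.Integer as ℤ
open import Data.List using (List; []; _∷_; _++_; reverse; length; map; foldr; sum)
open import Data.List.Relation.Unary.Unique.Propositional using (Unique)
open import Data.List.Membership.Propositional using (_∈_)
open import Data.Maybe using (Maybe; just; nothing)
open import Data.Product using (Σ; _×_; _,_)
open import Data.Sum using (_⊎_)
open import Data.Unit using (⊤)
open import Data.Empty using (⊥)
open import Relation.Nullary using (does; ¬_)
open import Relation.Binary.PropositionalEquality using (_≡_)

HasSize : {A : Set} → (A → Set) → ℕ → Set
HasSize {A} P N =
  Σ (List A) λ L → Unique L × ((x : A) → (x ∈ L → P x) × (P x → x ∈ L)) × length L ≡ N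

_≗ℤ_ : (ℤ → ℤ) → (ℤ → ℤ) → Set
f ≗ℤ g = (j : ℤ) → f j ≡ g j

sw : ℤ → ℤ → ℤ
sw i j = if does (j ℤ.≟ i) then i ℤ.+ ℤ.1ℤ
         else (if does (j ℤ.≟ (i ℤ.+ ℤ.1ℤ)) then i else j)

permOf : List ℤ → ℤ → ℤ
permOf [] j = j
permOf (a ∷ as) j = sw a (permOf as j)

Reduced : List ℤ → Set
Reduced a = (b : List ℤ) → permOf b ≗ℤ permOf a → length a ≤ length b

-- Demazure product s_{a₁} ∘ s_{a₂} ∘ ⋯ ∘ s_{aₗ}, computed left to right:
-- u ∘ s_i = u s_i if ℓ(u s_i) > ℓ(u) (i.e. u(i) < u(i+1)), and u otherwise
demAcc : (ℤ → ℤ) → List ℤ → ℤ → ℤ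
demAcc u [] = u
demAcc u (i ∷ is) =
  demAcc (if does (u i ℤ.<? u (i ℤ.+ ℤ.1ℤ)) then (λ j → u (sw i j)) else u) is

dem : List ℤ → ℤ → ℤ
dem = demAcc (λ j → j)

-- For a reduced word a of w, (reverse a) is a reduced word of w⁻¹, and
-- w⁻¹ ∘ w = dem (reverse a ++ a).
-- a is a reduced word of some atom w ∈ 𝒜(y):
IsAtomWord : (ℤ → ℤ) → List ℤ → Set
IsAtomWord y a =
  Reduced a ×
  (dem (reverse a ++ a) ≗ℤ y) ×
  ((b : List ℤ) → Reduced b → dem (reverse b ++ b) ≗ℤ y → length a ≤ length b)

Compatible : List ℤ → List ℕ → Set
Compatible [] [] = ⊤
Compatible (a ∷ []) (i ∷ []) = 1 ≤ i
Compatible (a ∷ a′ ∷ as) (i ∷ i′ ∷ is) =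
  1 ≤ i × i ≤ i′ × (a ℤ.< a′ → i < i′) × Compatible (a′ ∷ as) (i′ ∷ is)
Compatible _ _ = ⊥

-- exponent vector: α = (α₁, α₂, …, αₘ) means the monomial x₁^α₁ ⋯ xₘ^αₘ;
-- expo α k = exponent of x_{k+1} (0 beyond the list)
expo : List ℕ → ℕ → ℕ
expo [] k = 0
expo (e ∷ es) zero = e
expo (e ∷ es) (suc k) = expo es k

countℕ : ℕ → List ℕ → ℕ
countℕ k [] = 0
countℕ k (x ∷ xs) = if does (Data.Nat._≟_ x k) then suc (countℕ k xs) else countℕ k xs

-- the monomial x_{i₁} ⋯ x_{iₗ} equals x^α
HasContent : List ℕ → List ℕ → Set
HasContent is α = (k : ℕ) → countℕ (suc k) is ≡ expo α k

-- terms of F̂_y = Σ_{w ∈ 𝒜(y)} Σ_{a ∈ ℛ(w)} f_a contributing to x^α: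
-- pairs (a , i) with a a reduced word of an atom of y and i compatible with a
AtomTerm : (ℤ → ℤ) → List ℕ → (List ℤ × List ℕ) → Set
AtomTerm y α (a , is) = IsAtomWord y a × Compatible a is × HasContent is α

-- Entries are coded by positive naturals: 1 ↦ 1', 2 ↦ 1, 3 ↦ 2', 4 ↦ 2, …
-- (so the order 1' < 1 < 2' < 2 < ⋯ is the order on codes);
-- odd codes are primed, and the letter of code c is ⌊(c+1)/2⌋.
letter : ℕ → ℕ
letter c = ⌊ suc c /2⌋

Primed : ℕ → Set
Primed c = Data.Nat._%_ c 2 ≡ 1

Unprimed : ℕ → Set
Unprimed c = Data.Nat._%_ c 2 ≡ 0

nth : {A : Set} → List A → ℕ → Maybe A
nth [] n = nothing
nth (x ∷ xs) zero = just x
nth (x ∷ xs) (suc n) = nth xs n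

-- A tableau of shifted shape μ = (μ₁ > ⋯ > μ_r) is a list of rows; row i
-- (0-indexed) has μ_{i+1} entries; entry p of row i sits in column i + p,
-- so entry 0 of each row is on the main diagonal.
cell : List (List ℕ) → ℕ → ℕ → Maybe ℕ
cell T i p with nth T i
... | nothing = nothing
... | just row = nth row p

IsMarkedShiftedTableauP : List ℕ → List (List ℕ) → Set
IsMarkedShiftedTableauP μ T =
  map length T ≡ μ ×
  ((i p c : ℕ) → cell T i p ≡ just c → 1 ≤ c) ×
  ((i p c c′ : ℕ) → cell T i p ≡ just c → cell T i (suc p) ≡ just c′ →
     c ≤ c′ × (Primed c → c < c′)) ×
  -- columns weakly increase; an unprimed letter occurs at most once per column
  -- (cell (i,p) of T is in the same column as cell (i+1, p-1))
  ((i p c c′ : ℕ) → cell T i (suc p) ≡ just c → cell T (suc i) p ≡ just c′ →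
     c ≤ c′ × (Unprimed c → c < c′)) ×
  ((i c : ℕ) → cell T i 0 ≡ just c → Unprimed c)

lettersOf : List (List ℕ) → List ℕ
lettersOf T = map letter (foldr _++_ [] T)

PTableau : List ℕ → List ℕ → List (List ℕ) → Set
PTableau μ α T = IsMarkedShiftedTableauP μ T × HasContent (lettersOf T) α

IsFinInvolution : (ℤ → ℤ) → Set
IsFinInvolution y =
  ((j : ℤ) → y (y j) ≡ j) ×
  Σ ℕ (λ B → (j : ℤ) → B < ∣ j ∣ → y j ≡ j)

VisibleDescent : (ℤ → ℤ) → ℤ → Set
VisibleDescent y i = y (i ℤ.+ ℤ.1ℤ) ℤ.≤ i × y (i ℤ.+ ℤ.1ℤ) ℤ.≤ y i

IGrassmannian : (ℤ → ℤ) → Set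
IGrassmannian y = (i j : ℤ) → VisibleDescent y i → VisibleDescent y j → i ≡ j

transp : ℤ → ℤ → ℤ → ℤ
transp a b j = if does (j ℤ.≟ a) then b else (if does (j ℤ.≟ b) then a else j)

prodTransp : ℤ → ℕ → List ℤ → ℤ → ℤ
prodTransp n k [] j = j
prodTransp n k (φ ∷ φs) j = transp φ (n ℤ.+ + k) (prodTransp n (suc k) φs j)

StrictlyIncreasing : List ℤ → Set
StrictlyIncreasing [] = ⊤
StrictlyIncreasing (a ∷ []) = ⊤
StrictlyIncreasing (a ∷ b ∷ as) = a ℤ.< b × StrictlyIncreasing (b ∷ as)

AllLE : List ℤ → ℤ → Set
AllLE [] n = ⊤
AllLE (a ∷ as) n = a ℤ.≤ n × AllLE as n

ShapeOf : (ℤ → ℤ) → List ℕ → Set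
ShapeOf y μ =
  ((y ≗ℤ (λ j → j)) × μ ≡ []) ⊎
  Σ ℤ (λ n → Σ (List ℤ) λ φ →
     ¬ (φ ≡ []) × StrictlyIncreasing φ × AllLE φ n ×
     (y ≗ℤ prodTransp n 1 φ) ×
     μ ≡ map (λ f → ∣ n ℤ.+ ℤ.1ℤ ℤ.- f ∣) φ)

{-# OPTIONS --safe #-}
-- The involutions below y in weak order have no nested arcs, so each is a word in the letters
-- op (left end of an arc), cl (right end) and dot (fixed point), the ends being matched first in,
-- first out.  Removing the last letter i of an involution word acts on positions i, i+1 by
-- op dot → dot op, dot cl → cl dot, and op cl → cl op (or dot dot if both ends belong to one arc);
-- these moves u_i satisfy the nilCoxeter relations.  With h_i(x) = 1 + x u_i, peeling off one
-- variable of F̂ is T(x) = h_0(x) h_1(x) ⋯, and Fomin–Kirillov's argument gives T(x)T(y) = T(y)T(x);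
-- moreover T may be replaced by the reversed product T̃, with T(x) T̃(-x) = 1.
--
-- The word of y is u cl^r, with u a word of length n in op and dot.  The letters < n only move the
-- ops of u: T(x) removes a horizontal strip (unprimed entries), while the reversed product removes
-- a vertical strip (primed entries).  Let a(q) be the product of the h_i(q), i ≥ n, and V(q) the
-- removal of a vertical strip, diagonal boxes included.  The theorem follows by induction on the
-- number of variables once a(q) F̂ = V(q) F̂ on the words u cl^r.  Both sides are polynomials in q of
-- degree ≤ r with the same leading term; they agree at q = 0, and at q = -x for each variable x,
-- where a(-x) T̃(x) and V(-x) T(x) V(x) collapse to the reversed product of the letters < n.  These
-- roots suffice unless there are fewer than r - 1 variables, and then both sides vanish because one
-- variable lowers the maximal nesting depth by at most one.
--
-- The identity is proved for the values of the generating functions at distinct positive integers;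
-- coefficients are then compared as coefficients of polynomials with infinitely many common values.
module Submission where

open import Defs
open import Algebra.Properties.AbelianGroup using (∙-cancelˡ; ∙-cancelʳ)
open import Data.Bool using (true; false; if_then_else_)
open import Data.Empty using (⊥; ⊥-elim)
open import Data.Integer as ℤ using (ℤ; +_; 0ℤ; 1ℤ)
import Data.Integer.Properties as ℤ
open import Data.Integer.Tactic.RingSolver using (solve-∀)
open import Data.List as List using (List; []; _∷_; _++_; _∷ʳ_; length; replicate; reverse; take; drop; zipWith)
open import Data.List.Membership.Propositional using (_∈_)
import Data.List.Membership.Propositional.Properties as ∈
import Data.List.Properties as List
open import Data.List.Relation.Binary.Pointwise as PW using (Pointwise; []; _∷_)
open import Data.List.Relation.Unary.All as All using (All; []; _∷_)
import Data.List.Relation.Unary.All.Properties as All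
open import Data.List.Relation.Unary.AllPairs as AllPairs using ([]; _∷_)
import Data.List.Relation.Unary.AllPairs.Properties as AllPairs
open import Data.List.Relation.Unary.Any using (here; there; _─_)
open import Data.List.Relation.Unary.Unique.Propositional using (Unique)
import Data.List.Relation.Unary.Unique.Propositional.Properties as Unique
open import Data.Maybe as Maybe using (Maybe; just; nothing; _>>=_)
import Data.Maybe.Properties as Maybe
open import Data.Nat as ℕ using (ℕ; zero; suc; s≤s; z≤n)
import Data.Nat.DivMod as ℕ
import Data.Nat.Properties as ℕ
open import Data.Product using (Σ; _×_; _,_; proj₁; proj₂)
open import Data.Product.Properties using (≡-dec)
open import Data.Sum using (_⊎_; inj₁; inj₂)
open import Data.Unit using (⊤; tt)
open import Relation.Binary.Definitions using (tri<; tri≈; tri>)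
open import Relation.Binary.PropositionalEquality
open import Relation.Nullary using (Dec; yes; no; ¬_; does; _×-dec_)
open import Relation.Nullary.Decidable using (dec-true; dec-false)

-- A letter at or beyond the end of `u` drags a dot or an opener into the closers, so the words in
-- between no longer have the form `u cl^r` and carry no shape; they cannot be matched with boxes
-- letter by letter. Only the sum over all such words, as a polynomial in `q`, is compared, hence
-- the interpolation. It has r unknown coefficients below the top one, and 0 together with the -x
-- supplies one node more than there are variables; the variables are positive and distinct so that
-- these nodes are distinct. To use the node -x, the variable x must come first. On the side of `F̂`
-- this is the commutation of the T's. The symmetry of the tableau side is not known beforehand: it
-- is borrowed from the induction hypothesis, which equates both sides for all lists of at most as
-- many variables. Functions from words to integers take the place of formal series, so that 1 + q
-- u_i is an ordinary map between functions.

module Moves where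

  -- Partial moves and the operators 1 + q ρ.

  open import Data.Integer using (_+_; _*_)

  Move : Set → Set
  Move X = X → Maybe X

  at : {X : Set} → (X → ℤ) → Maybe X → ℤ
  at f nothing = 0ℤ
  at f (just x) = f x

  hop : {X : Set} → Move X → ℤ → (X → ℤ) → X → ℤ
  hop ρ q f w = f w + q * at f (ρ w)

  -- Moves act on words, operators on functions of words by precomposition; the head of the list is
  -- therefore the first move that a word meets.
  hops : {X : Set} → List (Move X) → ℤ → (X → ℤ) → X → ℤ
  hops [] q f = f
  hops (ρ ∷ ρs) q f = hop ρ q (hops ρs q f)

  at-cong : {X : Set} {f g : X → ℤ} → f ≗ g → (m : Maybe X) → at f m ≡ at g m
  at-cong e nothing = refl
  at-cong e (just x) = e x

  hop-cong : {X : Set} (ρ : Move X) (q : ℤ) {f g : X → ℤ} → f ≗ g → hop ρ q f ≗ hop ρ q g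
  hop-cong ρ q e w = cong₂ (λ a b → a + q * b) (e w) (at-cong e (ρ w))

  hops-cong : {X : Set} (ρs : List (Move X)) (q : ℤ) {f g : X → ℤ} → f ≗ g → hops ρs q f ≗ hops ρs q g
  hops-cong [] q e = e
  hops-cong (ρ ∷ ρs) q e = hop-cong ρ q (hops-cong ρs q e)

  hops-++ : {X : Set} (ρs σs : List (Move X)) (q : ℤ) (f : X → ℤ) →
    hops (ρs ++ σs) q f ≡ hops ρs q (hops σs q f)
  hops-++ [] σs q f = refl
  hops-++ (ρ ∷ ρs) σs q f = cong (hop ρ q) (hops-++ ρs σs q f)

  at-hop : {X : Set} (ρ : Move X) (q : ℤ) (f : X → ℤ) (m : Maybe X) →
    at (hop ρ q f) m ≡ at f m + q * at f (m >>= ρ)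
  at-hop ρ q f nothing = sym (trans (ℤ.+-identityˡ _) (ℤ.*-zeroʳ q))
  at-hop ρ q f (just x) = refl

  -- `e` intertwines the moves only where the invariant `Q` holds, and `Q` must survive a move for a
  -- whole product to be carried over. With `e` the identity this also compares functions that agree
  -- on `Q` alone.
  Sim : {X Y : Set} → (X → Set) → (X → Y) → Move X → Move Y → Set
  Sim {X} Q e ρ σ = (w : X) → Q w →
    (σ (e w) ≡ Maybe.map e (ρ w)) × ((w′ : X) → ρ w ≡ just w′ → Q w′)

  hops-sim : {X Y : Set} (Q : X → Set) (e : X → Y) {ρs : List (Move X)} {σs : List (Move Y)} →
    Pointwise (Sim Q e) ρs σs → (q : ℤ) {f : Y → ℤ} {g : X → ℤ} →
    ((w : X) → Q w → f (e w) ≡ g w) → (w : X) → Q w → hops σs q f (e w) ≡ hops ρs q g w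
  hops-sim Q e [] q h w Qw = h w Qw
  hops-sim Q e {ρ ∷ ρs} {σ ∷ σs} (s ∷ ss) q {f} {g} h w Qw =
    cong₂ (λ a b → a + q * b) (hops-sim Q e ss q h w Qw)
      (trans (cong (at (hops σs q f)) (proj₁ (s w Qw))) (lem (ρ w) (proj₂ (s w Qw))))
    where
    lem : (m : Maybe _) → (∀ w′ → m ≡ just w′ → Q w′) →
      at (hops σs q f) (Maybe.map e m) ≡ at (hops ρs q g) m
    lem nothing _ = refl
    lem (just w′) p = hops-sim Q e ss q h w′ (p w′ refl)

  -- As ρ squares to zero, the product is 1 + (p + q) ρ.
  hop-inverse : {X : Set} (ρ : Move X) → (∀ w → (ρ w >>= ρ) ≡ nothing) → (p q : ℤ) → p + q ≡ 0ℤ →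
    (f : X → ℤ) → hop ρ p (hop ρ q f) ≗ f
  hop-inverse ρ nil p q e f w = begin
    (f w + q * at f (ρ w)) + p * at (hop ρ q f) (ρ w)
      ≡⟨ cong (λ z → (f w + q * at f (ρ w)) + p * z) (at-hop ρ q f (ρ w)) ⟩
    (f w + q * at f (ρ w)) + p * (at f (ρ w) + q * at f (ρ w >>= ρ))
      ≡⟨ cong (λ m → (f w + q * at f (ρ w)) + p * (at f (ρ w) + q * at f m)) (nil w) ⟩
    (f w + q * at f (ρ w)) + p * (at f (ρ w) + q * 0ℤ)
      ≡⟨ rng (f w) (at f (ρ w)) p q ⟩
    f w + (p + q) * at f (ρ w)
      ≡⟨ cong (λ z → f w + z * at f (ρ w)) e ⟩
    f w + 0ℤ * at f (ρ w) ≡⟨ rng′ (f w) (at f (ρ w)) ⟩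
    f w ∎
    where
    open ≡-Reasoning
    rng : ∀ a b p q → (a + q * b) + p * (b + q * 0ℤ) ≡ a + (p + q) * b
    rng = solve-∀
    rng′ : ∀ a b → a + 0ℤ * b ≡ a
    rng′ = solve-∀

  Commute : {X : Set} → Move X → Move X → Set
  Commute ρ σ = ∀ w → (ρ w >>= σ) ≡ (σ w >>= ρ)

  hop-comm : {X : Set} (ρ σ : Move X) → Commute ρ σ → (p q : ℤ) (f : X → ℤ) →
    hop ρ p (hop σ q f) ≗ hop σ q (hop ρ p f)
  hop-comm ρ σ c p q f w
    rewrite at-hop σ q f (ρ w) | at-hop ρ p f (σ w) | c w = rng (f w) _ _ _ p q
    where
    rng : ∀ a b c d p q → (a + q * b) + p * (c + q * d) ≡ (a + p * c) + q * (b + p * d)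
    rng = solve-∀

  hops-comm : {X : Set} (ρ : Move X) (σs : List (Move X)) → All (Commute ρ) σs →
    (p q : ℤ) (f : X → ℤ) → hop ρ p (hops σs q f) ≗ hops σs q (hop ρ p f)
  hops-comm ρ [] _ p q f w = refl
  hops-comm ρ (σ ∷ σs) (c All.∷ cs) p q f w =
    trans (hop-comm ρ σ c p q (hops σs q f) w) (hop-cong σ q (hops-comm ρ σs cs p q f) w)

-- Commutation of products under the nilCoxeter relations.

module NilCoxeterMoves where

  open import Data.Nat using (_≤_)
  open import Data.Integer using (_+_; _*_; -_)
  open Moves

  segment : {X : Set} → (ℕ → Move X) → ℕ → ℕ → List (Move X)
  segment ρ i zero = []
  segment ρ i (suc k) = ρ i ∷ segment ρ (suc i) k

  reversed : {X : Set} → (ℕ → Move X) → ℕ → ℕ → List (Move X)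
  reversed ρ i zero = []
  reversed ρ i (suc k) = reversed ρ (suc i) k ++ ρ i ∷ []

  >>=-square : {X : Set} (a : Move X) → (∀ w → (a w >>= a) ≡ nothing) → (m : Maybe X) → ((m >>= a) >>= a) ≡ nothing
  >>=-square a sq nothing = refl
  >>=-square a sq (just x) = sq x

  -- The right-hand side is symmetric in x and y: a form of the Yang-Baxter equation.
  exchange : {X : Set} (a b : Move X) → (∀ w → (a w >>= a) ≡ nothing) → (∀ w → (b w >>= b) ≡ nothing) →
    (∀ w → ((a w >>= b) >>= a) ≡ ((b w >>= a) >>= b)) → (x y : ℤ) (f : X → ℤ) (w : X) →
    hop a x (hop b x (hop a y (hop b (- x) f))) w ≡
    f w + (x + y) * at f (a w) + x * y * (at f (b w >>= a) + - at f (a w >>= b))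
  exchange a b sa sb br x y f w
    rewrite at-hop b x (hop a y (hop b (- x) f)) (a w)
          | at-hop a y (hop b (- x) f) (b w)
          | at-hop a y (hop b (- x) f) (a w) | at-hop a y (hop b (- x) f) (a w >>= b)
          | at-hop b (- x) f (a w) | at-hop b (- x) f (b w) | at-hop b (- x) f (b w >>= a)
          | at-hop b (- x) f (a w >>= b)
          | at-hop b (- x) f (a w >>= a) | at-hop b (- x) f ((a w >>= b) >>= a)
          | sa w | sb w | >>=-square b sb (a w) | br w
          | >>=-square b sb (b w >>= a)
    = rng (f w) (at f (a w)) (at f (b w)) (at f (a w >>= b)) (at f (b w >>= a))
        (at f ((b w >>= a) >>= b)) x y
    where
    rng : ∀ f0 fa fb fab fba fbab x y →
      (((f0 + (- x) * fb) + y * (fa + (- x) * fab)) + x * ((fb + (- x) * 0ℤ) + y * (fba + (- x) * fbab)))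
        + x * (((fa + (- x) * fab) + y * (0ℤ + (- x) * 0ℤ)) + x * ((fab + (- x) * 0ℤ) + y * (fbab + (- x) * 0ℤ)))
      ≡ f0 + (x + y) * fa + x * y * (fba + - fab)
    rng = solve-∀

  exchange-sym : {X : Set} (a b : Move X) → (∀ w → (a w >>= a) ≡ nothing) → (∀ w → (b w >>= b) ≡ nothing) →
    (∀ w → ((a w >>= b) >>= a) ≡ ((b w >>= a) >>= b)) → (x y : ℤ) (f : X → ℤ) →
    hop a x (hop b x (hop a y (hop b (- x) f))) ≗ hop a y (hop b y (hop a x (hop b (- y) f)))
  exchange-sym a b sa sb br x y f w = trans (exchange a b sa sb br x y f w)
    (trans (rng (f w) (at f (a w)) (at f (b w >>= a) + - at f (a w >>= b)) x y) (sym (exchange a b sa sb br y x f w)))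
    where
    rng : ∀ p r s x y → p + (x + y) * r + x * y * s ≡ p + (y + x) * r + y * x * s
    rng = solve-∀

  record NilCoxeter {X : Set} (ρ : ℕ → Move X) : Set where
    field
      square : ∀ i w → (ρ i w >>= ρ i) ≡ nothing
      far : ∀ i j → suc (suc i) ≤ j → Commute (ρ i) (ρ j)
      braid : ∀ i w → ((ρ i w >>= ρ (suc i)) >>= ρ i) ≡ ((ρ (suc i) w >>= ρ i) >>= ρ (suc i))

  module _ {X : Set} {ρ : ℕ → Move X} (nc : NilCoxeter ρ) where
    open NilCoxeter nc

    segment-hops : ℕ → ℕ → ℤ → (X → ℤ) → X → ℤ
    segment-hops i k = hops (segment ρ i k)

    reversed-hops : ℕ → ℕ → ℤ → (X → ℤ) → X → ℤ
    reversed-hops i k = hops (reversed ρ i k)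

    reversed-suc : ∀ i k q f → reversed-hops i (suc k) q f ≡ reversed-hops (suc i) k q (hop (ρ i) q f)
    reversed-suc i k q f = hops-++ (reversed ρ (suc i) k) (ρ i ∷ []) q f

    segment-reversed : ∀ i k p q → p + q ≡ 0ℤ → ∀ f → segment-hops i k p (reversed-hops i k q f) ≗ f
    segment-reversed i zero p q e f w = refl
    segment-reversed i (suc k) p q e f w = trans
      (hop-cong (ρ i) p (λ v → trans (cong (λ g → segment-hops (suc i) k p g v) (reversed-suc i k q f))
        (segment-reversed (suc i) k p q e (hop (ρ i) q f) v)) w)
      (hop-inverse (ρ i) (square i) p q e f w)

    reversed-segment : ∀ i k p q → p + q ≡ 0ℤ → ∀ f → reversed-hops i k p (segment-hops i k q f) ≗ f
    reversed-segment i zero p q e f w = refl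
    reversed-segment i (suc k) p q e f w = trans
      (cong (λ g → g w) (reversed-suc i k p (segment-hops i (suc k) q f)))
      (trans (hops-cong (reversed ρ (suc i) k) p (hop-inverse (ρ i) (square i) p q e _) w)
        (reversed-segment (suc i) k p q e f w))

    far-segment : ∀ i j k → suc (suc i) ≤ j → All (Commute (ρ i)) (segment ρ j k)
    far-segment i j zero l = []
    far-segment i j (suc k) l = far i j l ∷ far-segment i (suc j) k (ℕ.m≤n⇒m≤1+n l)

    far-reversed : ∀ i j k → suc (suc i) ≤ j → All (Commute (ρ i)) (reversed ρ j k)
    far-reversed i j zero l = []
    far-reversed i j (suc k) l = All.++⁺ (far-reversed i (suc j) k (ℕ.m≤n⇒m≤1+n l)) (far i j l ∷ [])


    -- Write A_i(x) for the product h_i(x) h_(i+1)(x) ⋯. Moving h_i(y) to the left past A_(i+2)(x)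
    -- and inserting h_(i+1)(-x) h_(i+1)(x) = 1 turns A_i(x) A_i(y) into h_i(x) h_(i+1)(x) h_i(y)
    -- h_(i+1)(-x) A_(i+1)(x) A_(i+1)(y). Induction swaps the last two factors, and the four in
    -- front are symmetric in x and y by `exchange-sym`.
    segment-comm : ∀ i k x y f →
      segment-hops i k x (segment-hops i k y f) ≗ segment-hops i k y (segment-hops i k x f)
    segment-comm i zero x y f w = refl
    segment-comm i (suc zero) x y f w rewrite at-hop (ρ i) y f (ρ i w) | at-hop (ρ i) x f (ρ i w) =
      rng (f w) _ _ x y
      where
      rng : ∀ a b c x y → (a + y * b) + x * (b + y * c) ≡ (a + x * b) + y * (b + x * c)
      rng = solve-∀
    segment-comm i (suc (suc k)) x y f w = begin
      A₀ x (A₀ y f) w ≡⟨ normal x y w ⟩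
      B x y (A₁ x (A₁ y f)) w ≡⟨ B-cong x y (segment-comm (suc i) (suc k) x y f) w ⟩
      B x y (A₁ y (A₁ x f)) w
        ≡⟨ exchange-sym (ρ i) (ρ (suc i)) (square i) (square (suc i)) (braid i) x y (A₁ y (A₁ x f)) w ⟩
      B y x (A₁ y (A₁ x f)) w ≡⟨ normal y x w ⟨
      A₀ y (A₀ x f) w ∎
      where
      open ≡-Reasoning
      A₀ A₁ A₂ : ℤ → (X → ℤ) → X → ℤ
      A₀ = segment-hops i (suc (suc k))
      A₁ = segment-hops (suc i) (suc k)
      A₂ = segment-hops (suc (suc i)) k
      B : ℤ → ℤ → (X → ℤ) → X → ℤ
      B x y g = hop (ρ i) x (hop (ρ (suc i)) x (hop (ρ i) y (hop (ρ (suc i)) (- x) g)))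
      B-cong : ∀ x y {g g′} → g ≗ g′ → B x y g ≗ B x y g′
      B-cong x y e = hop-cong (ρ i) x (hop-cong (ρ (suc i)) x (hop-cong (ρ i) y (hop-cong (ρ (suc i)) (- x) e)))
      normal : ∀ x y → A₀ x (A₀ y f) ≗ B x y (A₁ x (A₁ y f))
      normal x y = hop-cong (ρ i) x (hop-cong (ρ (suc i)) x λ v → trans
        (sym (hops-comm (ρ i) (segment ρ (suc (suc i)) k) (far-segment i _ k ℕ.≤-refl) y x (A₁ y f) v))
        (hop-cong (ρ i) y (λ v′ → sym (hop-inverse (ρ (suc i)) (square (suc i)) (- x) x (ℤ.+-inverseˡ x) (A₂ x (A₁ y f)) v′)) v))

    module _ {f₀ : X → ℤ} (vac : ∀ i w → at f₀ (ρ i w >>= ρ (suc i)) ≡ at f₀ (ρ (suc i) w >>= ρ i)) where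

      -- h_i passes all later letters except h_(i+1), and these two end up next to the vacuum
      -- function, where `vac` lets them trade places.
      vacuum-reverse : ∀ i k x → segment-hops i k x f₀ ≗ reversed-hops i k x f₀
      vacuum-reverse i zero x w = refl
      vacuum-reverse i (suc zero) x w = refl
      vacuum-reverse i (suc (suc k)) x w = begin
        hop (ρ i) x (segment-hops (suc i) (suc k) x f₀) w
          ≡⟨ hop-cong (ρ i) x (vacuum-reverse (suc i) (suc k) x) w ⟩
        hop (ρ i) x (reversed-hops (suc i) (suc k) x f₀) w
          ≡⟨ cong (λ g → hop (ρ i) x g w) (reversed-suc (suc i) k x f₀) ⟩
        hop (ρ i) x (reversed-hops (suc (suc i)) k x (hop (ρ (suc i)) x f₀)) w
          ≡⟨ hops-comm (ρ i) (reversed ρ (suc (suc i)) k) (far-reversed i _ k ℕ.≤-refl) x x _ w ⟩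
        reversed-hops (suc (suc i)) k x (hop (ρ i) x (hop (ρ (suc i)) x f₀)) w
          ≡⟨ hops-cong (reversed ρ (suc (suc i)) k) x swap w ⟩
        reversed-hops (suc (suc i)) k x (hop (ρ (suc i)) x (hop (ρ i) x f₀)) w
          ≡⟨ cong (λ g → g w) (reversed-suc (suc i) k x (hop (ρ i) x f₀)) ⟨
        reversed-hops (suc i) (suc k) x (hop (ρ i) x f₀) w
          ≡⟨ cong (λ g → g w) (reversed-suc i (suc k) x f₀) ⟨
        reversed-hops i (suc (suc k)) x f₀ w ∎
        where
        open ≡-Reasoning
        swap : hop (ρ i) x (hop (ρ (suc i)) x f₀) ≗ hop (ρ (suc i)) x (hop (ρ i) x f₀)
        swap v rewrite at-hop (ρ (suc i)) x f₀ (ρ i v) | at-hop (ρ i) x f₀ (ρ (suc i) v) | vac i v = rng (f₀ v) _ _ _ x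
          where
          rng : ∀ a b c d x → (a + x * b) + x * (c + x * d) ≡ (a + x * c) + x * (b + x * d)
          rng = solve-∀

      module _ (L : ℕ) where

        stanley : List ℤ → X → ℤ
        stanley [] = f₀
        stanley (x ∷ xs) = segment-hops 0 L x (stanley xs)

        stanley-swap : ∀ x y xs → stanley (x ∷ y ∷ xs) ≗ stanley (y ∷ x ∷ xs)
        stanley-swap x y xs = segment-comm 0 L x y (stanley xs)

        -- T̃(x) is the inverse of T(-x), so it commutes with whatever T(-x) commutes with.
        reversed-segment-comm : ∀ x y f →
          reversed-hops 0 L x (segment-hops 0 L y f) ≗ segment-hops 0 L y (reversed-hops 0 L x f)
        reversed-segment-comm x y f w = begin
          R x (S y f) w
            ≡⟨ hops-cong (reversed ρ 0 L) x (hops-cong (segment ρ 0 L) y λ v → sym (segment-reversed 0 L (- x) x (ℤ.+-inverseˡ x) f v)) w ⟩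
          R x (S y (S (- x) (R x f))) w
            ≡⟨ hops-cong (reversed ρ 0 L) x (segment-comm 0 L y (- x) (R x f)) w ⟩
          R x (S (- x) (S y (R x f))) w
            ≡⟨ reversed-segment 0 L x (- x) (ℤ.+-inverseʳ x) (S y (R x f)) w ⟩
          S y (R x f) w ∎
          where
          open ≡-Reasoning
          R S : ℤ → (X → ℤ) → X → ℤ
          R = reversed-hops 0 L
          S = segment-hops 0 L

        -- Reversal is known only next to the vacuum: the variable is moved there by commutation,
        -- reversed, and moved back.
        stanley-reverse : ∀ x xs → stanley (x ∷ xs) ≗ reversed-hops 0 L x (stanley xs)
        stanley-reverse x [] = vacuum-reverse 0 L x
        stanley-reverse x (y ∷ xs) w = trans (stanley-swap x y xs w)
          (trans (hops-cong (segment ρ 0 L) y (stanley-reverse x xs) w)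
            (sym (reversed-segment-comm x y (stanley xs) w)))

-- Arc words and the removal of one letter.

module ArcWords where

  open import Data.Nat using (_≤_)
  open Moves
  open NilCoxeterMoves

  data Sym : Set where
    op cl dot : Sym

  depth : Sym → ℕ → ℕ
  depth op d = suc d
  depth cl d = ℕ.pred d
  depth dot d = d

  -- `d` counts the arcs open before the two sites. Since arcs close in the order in which they
  -- open, adjacent ends `op cl` belong to one arc exactly when `d` is zero; likewise `dot cl` needs
  -- an arc opened earlier.
  local : Sym → Sym → ℕ → Maybe (Sym × Sym)
  local op dot d = just (dot , op)
  local op cl zero = just (dot , dot)
  local op cl (suc d) = just (cl , op)
  local dot cl (suc d) = just (cl , dot)
  local _ _ _ = nothing

  rem : ℕ → ℕ → Move (List Sym)
  rem d i [] = nothing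
  rem d zero (a ∷ []) = nothing
  rem d zero (a ∷ b ∷ w) = Maybe.map (λ (a′ , b′) → a′ ∷ b′ ∷ w) (local a b d)
  rem d (suc i) (a ∷ w) = Maybe.map (a ∷_) (rem (depth a d) i w)

  -- The symbols to the right of the two sites see the same depth before and after the move; this is
  -- what makes distant letters commute.
  local-depth : ∀ d a b {a′ b′} → local a b d ≡ just (a′ , b′) → depth b′ (depth a′ d) ≡ depth b (depth a d)
  local-depth d op dot refl = refl
  local-depth zero op cl refl = refl
  local-depth (suc d) op cl refl = refl
  local-depth (suc d) dot cl refl = refl

  map->>= : {X : Set} (e : X → X) (ρ σ : Move X) → (∀ w → σ (e w) ≡ Maybe.map e (ρ w)) →
    (m : Maybe X) → (Maybe.map e m >>= σ) ≡ Maybe.map e (m >>= ρ)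
  map->>= e ρ σ h nothing = refl
  map->>= e ρ σ h (just x) = h x

  private
    tail->>= : ∀ a d i j w → (rem d (suc i) (a ∷ w) >>= rem d (suc j)) ≡
      Maybe.map (a ∷_) (rem (depth a d) i w >>= rem (depth a d) j)
    tail->>= a d i j w = map->>= (a ∷_) (rem (depth a d) j) (rem d (suc j)) (λ _ → refl) (rem (depth a d) i w)

  rem-square : ∀ d i w → (rem d i w >>= rem d i) ≡ nothing
  rem-square d i [] = refl
  rem-square d zero (a ∷ []) = refl
  rem-square d zero (op ∷ op ∷ w) = refl
  rem-square zero zero (op ∷ cl ∷ w) = refl
  rem-square (suc d) zero (op ∷ cl ∷ w) = refl
  rem-square d zero (op ∷ dot ∷ w) = refl
  rem-square d zero (cl ∷ b ∷ w) = refl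
  rem-square d zero (dot ∷ op ∷ w) = refl
  rem-square zero zero (dot ∷ cl ∷ w) = refl
  rem-square (suc d) zero (dot ∷ cl ∷ w) = refl
  rem-square d zero (dot ∷ dot ∷ w) = refl
  rem-square d (suc i) (a ∷ w) = trans (tail->>= a d i i w) (cong (Maybe.map (a ∷_)) (rem-square (depth a d) i w))

  rem-far : ∀ d i j → suc (suc i) ≤ j → Commute (rem d i) (rem d j)
  rem-far d i (suc zero) (s≤s ())
  rem-far d i (suc (suc j)) l [] = refl
  rem-far d zero (suc (suc j)) l (a ∷ []) = refl
  rem-far d zero (suc (suc j)) l (a ∷ b ∷ w) = lem (local a b d) refl
    where
    move : Maybe (Sym × Sym) → List Sym → Maybe (List Sym)
    move m v = Maybe.map (λ (a′ , b′) → a′ ∷ b′ ∷ v) m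
    lem : (m : Maybe (Sym × Sym)) → local a b d ≡ m →
      (move m w >>= rem d (suc (suc j))) ≡ (rem d (suc (suc j)) (a ∷ b ∷ w) >>= rem d zero)
    lem nothing e with rem (depth b (depth a d)) j w
    ... | nothing = refl
    ... | just v rewrite e = refl
    lem (just (a′ , b′)) e rewrite local-depth d a b e with rem (depth b (depth a d)) j w
    ... | nothing = refl
    ... | just v rewrite e = refl
  rem-far d (suc i) (suc (suc j)) (s≤s l) (a ∷ w) = trans (tail->>= a d i (suc j) w)
    (trans (cong (Maybe.map (a ∷_)) (rem-far (depth a d) i (suc j) l w)) (sym (tail->>= a d (suc j) i w)))

  -- A local move asks only whether the depth is zero, and three symbols shift it by so little that
  -- the depths 0, 1 and at least 2 exhaust the cases.
  rem-braid : ∀ d i w → ((rem d i w >>= rem d (suc i)) >>= rem d i) ≡ ((rem d (suc i) w >>= rem d i) >>= rem d (suc i))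
  rem-braid d i [] = refl
  rem-braid d zero (a ∷ []) = refl
  rem-braid d zero (a ∷ b ∷ []) with local a b d
  ... | nothing = refl
  ... | just _ = refl
  rem-braid d zero (op ∷ op ∷ op ∷ w) = refl
  rem-braid zero zero (op ∷ op ∷ cl ∷ w) = refl
  rem-braid (suc d) zero (op ∷ op ∷ cl ∷ w) = refl
  rem-braid d zero (op ∷ op ∷ dot ∷ w) = refl
  rem-braid zero zero (op ∷ cl ∷ op ∷ w) = refl
  rem-braid zero zero (op ∷ cl ∷ cl ∷ w) = refl
  rem-braid zero zero (op ∷ cl ∷ dot ∷ w) = refl
  rem-braid (suc d) zero (op ∷ cl ∷ op ∷ w) = refl
  rem-braid (suc zero) zero (op ∷ cl ∷ cl ∷ w) = refl
  rem-braid (suc (suc d)) zero (op ∷ cl ∷ cl ∷ w) = refl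
  rem-braid (suc d) zero (op ∷ cl ∷ dot ∷ w) = refl
  rem-braid d zero (op ∷ dot ∷ op ∷ w) = refl
  rem-braid zero zero (op ∷ dot ∷ cl ∷ w) = refl
  rem-braid (suc d) zero (op ∷ dot ∷ cl ∷ w) = refl
  rem-braid d zero (op ∷ dot ∷ dot ∷ w) = refl
  rem-braid d zero (cl ∷ op ∷ op ∷ w) = refl
  rem-braid zero zero (cl ∷ op ∷ cl ∷ w) = refl
  rem-braid (suc zero) zero (cl ∷ op ∷ cl ∷ w) = refl
  rem-braid (suc (suc d)) zero (cl ∷ op ∷ cl ∷ w) = refl
  rem-braid d zero (cl ∷ op ∷ dot ∷ w) = refl
  rem-braid d zero (cl ∷ cl ∷ c ∷ w) = refl
  rem-braid d zero (cl ∷ dot ∷ op ∷ w) = refl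
  rem-braid zero zero (cl ∷ dot ∷ cl ∷ w) = refl
  rem-braid (suc zero) zero (cl ∷ dot ∷ cl ∷ w) = refl
  rem-braid (suc (suc d)) zero (cl ∷ dot ∷ cl ∷ w) = refl
  rem-braid d zero (cl ∷ dot ∷ dot ∷ w) = refl
  rem-braid d zero (dot ∷ op ∷ op ∷ w) = refl
  rem-braid zero zero (dot ∷ op ∷ cl ∷ w) = refl
  rem-braid (suc d) zero (dot ∷ op ∷ cl ∷ w) = refl
  rem-braid d zero (dot ∷ op ∷ dot ∷ w) = refl
  rem-braid zero zero (dot ∷ cl ∷ c ∷ w) = refl
  rem-braid (suc d) zero (dot ∷ cl ∷ op ∷ w) = refl
  rem-braid (suc zero) zero (dot ∷ cl ∷ cl ∷ w) = refl
  rem-braid (suc (suc d)) zero (dot ∷ cl ∷ cl ∷ w) = refl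
  rem-braid (suc d) zero (dot ∷ cl ∷ dot ∷ w) = refl
  rem-braid d zero (dot ∷ dot ∷ op ∷ w) = refl
  rem-braid zero zero (dot ∷ dot ∷ cl ∷ w) = refl
  rem-braid (suc d) zero (dot ∷ dot ∷ cl ∷ w) = refl
  rem-braid d zero (dot ∷ dot ∷ dot ∷ w) = refl
  rem-braid d (suc i) (a ∷ w) = begin
    ((rem d (suc i) (a ∷ w) >>= rem d (suc (suc i))) >>= rem d (suc i))
      ≡⟨ cong (_>>= rem d (suc i)) (tail->>= a d i (suc i) w) ⟩
    (Maybe.map (a ∷_) (rem e i w >>= rem e (suc i)) >>= rem d (suc i))
      ≡⟨ map->>= (a ∷_) (rem e i) (rem d (suc i)) (λ _ → refl) (rem e i w >>= rem e (suc i)) ⟩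
    Maybe.map (a ∷_) ((rem e i w >>= rem e (suc i)) >>= rem e i)
      ≡⟨ cong (Maybe.map (a ∷_)) (rem-braid e i w) ⟩
    Maybe.map (a ∷_) ((rem e (suc i) w >>= rem e i) >>= rem e (suc i))
      ≡⟨ map->>= (a ∷_) (rem e (suc i)) (rem d (suc (suc i))) (λ _ → refl) (rem e (suc i) w >>= rem e i) ⟨
    (Maybe.map (a ∷_) (rem e (suc i) w >>= rem e i) >>= rem d (suc (suc i)))
      ≡⟨ cong (_>>= rem d (suc (suc i))) (tail->>= a d (suc i) i w) ⟨
    ((rem d (suc (suc i)) (a ∷ w) >>= rem d (suc i)) >>= rem d (suc (suc i))) ∎
    where
    open ≡-Reasoning
    e : ℕ
    e = depth a d

  rem-nilCoxeter : ∀ d → NilCoxeter (rem d)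
  rem-nilCoxeter d = record { square = rem-square d ; far = rem-far d ; braid = rem-braid d }

  -- The generating function in no variables: only the identity, spelled by dots alone, contributes.
  vacuum : List Sym → ℤ
  vacuum [] = 1ℤ
  vacuum (dot ∷ w) = vacuum w
  vacuum (op ∷ w) = 0ℤ
  vacuum (cl ∷ w) = 0ℤ

  at-map : {X Y : Set} (f : Y → ℤ) (e : X → Y) (m : Maybe X) → at f (Maybe.map e m) ≡ at (λ x → f (e x)) m
  at-map f e nothing = refl
  at-map f e (just x) = refl

  at-zero : {X : Set} (m : Maybe X) → at (λ _ → 0ℤ) m ≡ 0ℤ
  at-zero nothing = refl
  at-zero (just x) = refl

  -- Of the words on the three sites involved, only `op dot cl`, the transposition of the outer two,
  -- is brought to dots by two such moves, and both orders do it.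
  vacuum-relation : ∀ i w → at vacuum (rem 0 i w >>= rem 0 (suc i)) ≡ at vacuum (rem 0 (suc i) w >>= rem 0 i)
  vacuum-relation i [] = refl
  vacuum-relation zero (a ∷ []) = refl
  vacuum-relation zero (a ∷ b ∷ []) with local a b 0
  ... | nothing = refl
  ... | just _ = refl
  vacuum-relation zero (op ∷ op ∷ op ∷ w) = refl
  vacuum-relation zero (op ∷ op ∷ cl ∷ w) = refl
  vacuum-relation zero (op ∷ op ∷ dot ∷ w) = refl
  vacuum-relation zero (op ∷ cl ∷ op ∷ w) = refl
  vacuum-relation zero (op ∷ cl ∷ cl ∷ w) = refl
  vacuum-relation zero (op ∷ cl ∷ dot ∷ w) = refl
  vacuum-relation zero (op ∷ dot ∷ op ∷ w) = refl
  vacuum-relation zero (op ∷ dot ∷ cl ∷ w) = refl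
  vacuum-relation zero (op ∷ dot ∷ dot ∷ w) = refl
  vacuum-relation zero (cl ∷ op ∷ op ∷ w) = refl
  vacuum-relation zero (cl ∷ op ∷ cl ∷ w) = refl
  vacuum-relation zero (cl ∷ op ∷ dot ∷ w) = refl
  vacuum-relation zero (cl ∷ cl ∷ c ∷ w) = refl
  vacuum-relation zero (cl ∷ dot ∷ op ∷ w) = refl
  vacuum-relation zero (cl ∷ dot ∷ cl ∷ w) = refl
  vacuum-relation zero (cl ∷ dot ∷ dot ∷ w) = refl
  vacuum-relation zero (dot ∷ op ∷ op ∷ w) = refl
  vacuum-relation zero (dot ∷ op ∷ cl ∷ w) = refl
  vacuum-relation zero (dot ∷ op ∷ dot ∷ w) = refl
  vacuum-relation zero (dot ∷ cl ∷ c ∷ w) = refl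
  vacuum-relation zero (dot ∷ dot ∷ op ∷ w) = refl
  vacuum-relation zero (dot ∷ dot ∷ cl ∷ w) = refl
  vacuum-relation zero (dot ∷ dot ∷ dot ∷ w) = refl
  vacuum-relation (suc i) (a ∷ w)
    rewrite tail->>= a 0 i (suc i) w | tail->>= a 0 (suc i) i w
          | at-map vacuum (a ∷_) (rem (depth a 0) i w >>= rem (depth a 0) (suc i))
          | at-map vacuum (a ∷_) (rem (depth a 0) (suc i) w >>= rem (depth a 0) i) = lem a
    where
    lem : ∀ a → at (λ v → vacuum (a ∷ v)) (rem (depth a 0) i w >>= rem (depth a 0) (suc i)) ≡
      at (λ v → vacuum (a ∷ v)) (rem (depth a 0) (suc i) w >>= rem (depth a 0) i)
    lem dot = vacuum-relation i w
    lem op = trans (at-zero (rem 1 i w >>= rem 1 (suc i))) (sym (at-zero (rem 1 (suc i) w >>= rem 1 i)))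
    lem cl = trans (at-zero (rem 0 i w >>= rem 0 (suc i))) (sym (at-zero (rem 0 (suc i) w >>= rem 0 i)))

-- Stability, balance and depth of arc words.

module ArcWordProperties where

  open import Data.Nat using (_≤_)
  open import Data.Integer using (_+_; _*_)
  open Moves
  open NilCoxeterMoves
  open ArcWords

  segment-pointwise : {X Y : Set} {R : Move X → Move Y → Set} {ρ : ℕ → Move X} {σ : ℕ → Move Y} →
    ∀ i j k → (∀ m → m ℕ.< k → R (ρ (i ℕ.+ m)) (σ (j ℕ.+ m))) → Pointwise R (segment ρ i k) (segment σ j k)
  segment-pointwise i j zero h = []
  segment-pointwise {R = R} {ρ} {σ} i j (suc k) h =
    subst₂ (λ a b → R (ρ a) (σ b)) (ℕ.+-identityʳ i) (ℕ.+-identityʳ j) (h 0 (s≤s z≤n)) ∷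
    segment-pointwise (suc i) (suc j) k
      (λ m l → subst₂ (λ a b → R (ρ a) (σ b)) (ℕ.+-suc i m) (ℕ.+-suc j m) (h (suc m) (s≤s l)))

  reversed-pointwise : {X Y : Set} {R : Move X → Move Y → Set} {ρ : ℕ → Move X} {σ : ℕ → Move Y} →
    ∀ i j k → (∀ m → m ℕ.< k → R (ρ (i ℕ.+ m)) (σ (j ℕ.+ m))) → Pointwise R (reversed ρ i k) (reversed σ j k)
  reversed-pointwise i j zero h = []
  reversed-pointwise {R = R} {ρ} {σ} i j (suc k) h = PW.++⁺
    (reversed-pointwise (suc i) (suc j) k
      (λ m l → subst₂ (λ a b → R (ρ a) (σ b)) (ℕ.+-suc i m) (ℕ.+-suc j m) (h (suc m) (s≤s l))))
    (subst₂ (λ a b → R (ρ a) (σ b)) (ℕ.+-identityʳ i) (ℕ.+-identityʳ j) (h 0 (s≤s z≤n)) ∷ [])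

  segment-++ : {X : Set} (ρ : ℕ → Move X) → ∀ i k l → segment ρ i (k ℕ.+ l) ≡ segment ρ i k ++ segment ρ (i ℕ.+ k) l
  segment-++ ρ i zero l = cong (λ j → segment ρ j l) (sym (ℕ.+-identityʳ i))
  segment-++ ρ i (suc k) l = cong (ρ i ∷_) (trans (segment-++ ρ (suc i) k l)
    (cong (λ j → segment ρ (suc i) k ++ segment ρ j l) (sym (ℕ.+-suc i k))))

  reversed-++ : {X : Set} (ρ : ℕ → Move X) → ∀ i k l → reversed ρ i (k ℕ.+ l) ≡ reversed ρ (i ℕ.+ k) l ++ reversed ρ i k
  reversed-++ ρ i zero l = trans (cong (λ j → reversed ρ j l) (sym (ℕ.+-identityʳ i))) (sym (List.++-identityʳ _))
  reversed-++ ρ i (suc k) l = trans (cong (_++ ρ i ∷ []) (trans (reversed-++ ρ (suc i) k l)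
    (cong (λ j → reversed ρ j l ++ reversed ρ (suc i) k) (sym (ℕ.+-suc i k)))))
    (List.++-assoc (reversed ρ (i ℕ.+ suc k) l) (reversed ρ (suc i) k) (ρ i ∷ []))

  hops-zero : {X : Set} (ρs : List (Move X)) (q : ℤ) {f : X → ℤ} → (∀ w → f w ≡ 0ℤ) → ∀ w → hops ρs q f w ≡ 0ℤ
  hops-zero [] q z = z
  hops-zero (ρ ∷ ρs) q {f} z w rewrite hops-zero ρs q z w = lem (ρ w)
    where
    lem : ∀ m → 0ℤ + q * at (hops ρs q f) m ≡ 0ℤ
    lem nothing = trans (ℤ.+-identityˡ _) (ℤ.*-zeroʳ q)
    lem (just v) rewrite hops-zero ρs q z v = trans (ℤ.+-identityˡ _) (ℤ.*-zeroʳ q)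

  cons-segment : ∀ d a i k q f w →
    hops (segment (rem d) (suc i) k) q f (a ∷ w) ≡ hops (segment (rem (depth a d)) i k) q (λ v → f (a ∷ v)) w
  cons-segment d a i k q f w = hops-sim (λ _ → ⊤) (a ∷_)
    (segment-pointwise i (suc i) k (λ m _ v _ → refl , λ _ _ → tt)) q (λ _ _ → refl) w tt

  map-just : {X Y : Set} (e : X → Y) (m : Maybe X) {y : Y} → Maybe.map e m ≡ just y → Σ X λ x → m ≡ just x × y ≡ e x
  map-just e (just x) refl = x , refl , refl

  rem-length : ∀ d i w {w′} → rem d i w ≡ just w′ → length w′ ≡ length w
  rem-length d zero (a ∷ b ∷ w) e with map-just _ (local a b d) e
  ... | _ , _ , refl = refl
  rem-length d (suc i) (a ∷ w) e with map-just _ (rem (depth a d) i w) e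
  ... | _ , e′ , refl = cong suc (rem-length (depth a d) i w e′)

  rem-inert : ∀ d i w → length w ≤ suc i → rem d i w ≡ nothing
  rem-inert d i [] l = refl
  rem-inert d zero (a ∷ []) l = refl
  rem-inert d zero (a ∷ b ∷ w) (s≤s ())
  rem-inert d (suc i) (a ∷ w) (s≤s l) rewrite rem-inert (depth a d) i w l = refl

  rem-++ : ∀ d i w s → suc (suc i) ≤ length w → rem d i (w ++ s) ≡ Maybe.map (_++ s) (rem d i w)
  rem-++ d zero (a ∷ []) s (s≤s ())
  rem-++ d zero (a ∷ b ∷ w) s l = Maybe.map-∘ (local a b d)
  rem-++ d (suc i) (a ∷ w) s (s≤s l) =
    trans (cong (Maybe.map (a ∷_)) (rem-++ (depth a d) i w s l))
      (trans (sym (Maybe.map-∘ (rem (depth a d) i w))) (Maybe.map-∘ (rem (depth a d) i w)))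

  hop-nothing : {X : Set} (ρ : Move X) (q : ℤ) (f : X → ℤ) (w : X) → ρ w ≡ nothing → hop ρ q f w ≡ f w
  hop-nothing ρ q f w e rewrite e | ℤ.*-zeroʳ q = ℤ.+-identityʳ (f w)

  segment-inert : ∀ d i k q f w → length w ≤ suc i → hops (segment (rem d) i k) q f w ≡ f w
  segment-inert d i zero q f w l = refl
  segment-inert d i (suc k) q f w l =
    trans (hop-nothing (rem d i) q (hops (segment (rem d) (suc i) k) q f) w (rem-inert d i w l))
      (segment-inert d (suc i) k q f w (ℕ.m≤n⇒m≤1+n l))

  hops-on : {X : Set} (Q : X → Set) (ρ : ℕ → Move X) → (∀ i w → Q w → ∀ w′ → ρ i w ≡ just w′ → Q w′) →
    ∀ i k q {f g : X → ℤ} → (∀ w → Q w → f w ≡ g w) → ∀ w → Q w →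
    hops (segment ρ i k) q f w ≡ hops (segment ρ i k) q g w
  hops-on Q ρ st i k q h = hops-sim Q (λ w → w)
    (segment-pointwise i i k (λ m _ w Qw → sym (Maybe.map-id (ρ (i ℕ.+ m) w)) , st (i ℕ.+ m) w Qw)) q h

  data Balanced : ℕ → List Sym → Set where
    done : Balanced 0 []
    open′ : ∀ {d w} → Balanced (suc d) w → Balanced d (op ∷ w)
    close : ∀ {d w} → Balanced d w → Balanced (suc d) (cl ∷ w)
    stay : ∀ {d w} → Balanced d w → Balanced d (dot ∷ w)

  rem-balanced : ∀ d i w → Balanced d w → ∀ w′ → rem d i w ≡ just w′ → Balanced d w′
  rem-balanced d zero (op ∷ dot ∷ w) (open′ (stay b)) _ refl = stay (open′ b)
  rem-balanced zero zero (op ∷ cl ∷ w) (open′ (close b)) _ refl = stay (stay b)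
  rem-balanced (suc d) zero (op ∷ cl ∷ w) (open′ (close b)) _ refl = close (open′ b)
  rem-balanced (suc d) zero (dot ∷ cl ∷ w) (stay (close b)) _ refl = close (stay b)
  rem-balanced d (suc i) (op ∷ w) (open′ b) w′ e with map-just _ (rem (suc d) i w) e
  ... | v , e′ , refl = open′ (rem-balanced (suc d) i w b v e′)
  rem-balanced (suc d) (suc i) (cl ∷ w) (close b) w′ e with map-just _ (rem d i w) e
  ... | v , e′ , refl = close (rem-balanced d i w b v e′)
  rem-balanced d (suc i) (dot ∷ w) (stay b) w′ e with map-just _ (rem d i w) e
  ... | v , e′ , refl = stay (rem-balanced d i w b v e′)

  -- A balanced word does not end in `op`, so nothing can hop onto the appended dot.
  rem-snoc-dot : ∀ d i w → Balanced d w → rem d i (w ++ dot ∷ []) ≡ Maybe.map (_++ dot ∷ []) (rem d i w)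
  rem-snoc-dot d zero [] b = refl
  rem-snoc-dot d (suc i) [] b = refl
  rem-snoc-dot d zero (op ∷ []) (open′ ())
  rem-snoc-dot d zero (cl ∷ []) b = refl
  rem-snoc-dot d zero (dot ∷ []) b = refl
  rem-snoc-dot d zero (a ∷ b ∷ w) _ = Maybe.map-∘ (local a b d)
  rem-snoc-dot d (suc i) (a ∷ w) b = trans (cong (Maybe.map (a ∷_)) (rem-snoc-dot (depth a d) i w (tail b)))
      (trans (sym (Maybe.map-∘ (rem (depth a d) i w))) (Maybe.map-∘ (rem (depth a d) i w)))
    where
    tail : ∀ {a d w} → Balanced d (a ∷ w) → Balanced (depth a d) w
    tail (open′ b) = b
    tail (close b) = b
    tail (stay b) = b

  -- `L` is the number of letters kept in T. Letters reaching past the end of the word are inert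
  -- (`rem-inert`), so finitely many suffice.
  F̂ : ℕ → List ℤ → List Sym → ℤ
  F̂ L = stanley (rem-nilCoxeter 0) {vacuum} vacuum-relation L

  F-snoc-dot : ∀ L xs w → Balanced 0 w → F̂ L xs (w ++ dot ∷ []) ≡ F̂ L xs w
  F-snoc-dot L [] w b = lem w b
    where
    lem : ∀ w {d} → Balanced d w → vacuum (w ++ dot ∷ []) ≡ vacuum w
    lem [] b = refl
    lem (op ∷ w) b = refl
    lem (cl ∷ w) b = refl
    lem (dot ∷ w) (stay b) = lem w b
  F-snoc-dot L (x ∷ xs) w b = hops-sim (Balanced 0) (_++ dot ∷ [])
    (segment-pointwise 0 0 L (λ m _ v bv → rem-snoc-dot 0 m v bv , rem-balanced 0 m v bv)) x
    (F-snoc-dot L xs) w b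

  -- A leading dot has no arc open before it and never moves. Of the letters 0, ..., L - 1, those
  -- from 1 on act on `dot ∷ w` as 0, ..., L - 2 act on `w`, and the letter L - 1 is inert on `w` by
  -- the length bound.
  F-cons-dot : ∀ L xs w → length w ≤ L → F̂ L xs (dot ∷ w) ≡ F̂ L xs w
  F-cons-dot L [] w l = refl
  F-cons-dot zero (x ∷ xs) [] l = F-cons-dot zero xs [] l
  F-cons-dot (suc L) (x ∷ xs) w l = begin
    hop (rem 0 0) x (hops (segment (rem 0) 1 L) x (F̂ (suc L) xs)) (dot ∷ w)
      ≡⟨ hop-nothing (rem 0 0) x (hops (segment (rem 0) 1 L) x (F̂ (suc L) xs)) (dot ∷ w) (first w) ⟩
    hops (segment (rem 0) 1 L) x (F̂ (suc L) xs) (dot ∷ w) ≡⟨ cons-segment 0 dot 0 L x (F̂ (suc L) xs) w ⟩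
    hops (segment (rem 0) 0 L) x (λ v → F̂ (suc L) xs (dot ∷ v)) w
      ≡⟨ hops-on Q (rem 0) inv 0 L x (λ v Qv → trans (F-cons-dot (suc L) xs v Qv)
           (sym (hop-nothing (rem 0 L) x (F̂ (suc L) xs) v (rem-inert 0 L v Qv)))) w l ⟩
    hops (segment (rem 0) 0 L) x (hop (rem 0 L) x (F̂ (suc L) xs)) w
      ≡⟨ cong (λ g → g w) (hops-++ (segment (rem 0) 0 L) (segment (rem 0) L 1) x (F̂ (suc L) xs)) ⟨
    hops (segment (rem 0) 0 L ++ segment (rem 0) L 1) x (F̂ (suc L) xs) w
      ≡⟨ cong (λ ρs → hops ρs x (F̂ (suc L) xs) w) (segment-++ (rem 0) 0 L 1) ⟨
    hops (segment (rem 0) 0 (L ℕ.+ 1)) x (F̂ (suc L) xs) w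
      ≡⟨ cong (λ k → hops (segment (rem 0) 0 k) x (F̂ (suc L) xs) w) (ℕ.+-comm L 1) ⟩
    hops (segment (rem 0) 0 (suc L)) x (F̂ (suc L) xs) w ∎
    where
    open ≡-Reasoning
    Q : List Sym → Set
    Q v = length v ≤ suc L
    inv : ∀ i v → Q v → ∀ v′ → rem 0 i v ≡ just v′ → Q v′
    inv i v Qv v′ e = subst (_≤ suc L) (sym (rem-length 0 i v e)) Qv
    first : ∀ w → rem 0 0 (dot ∷ w) ≡ nothing
    first [] = refl
    first (op ∷ w) = refl
    first (cl ∷ w) = refl
    first (dot ∷ w) = refl

  data Deep (D : ℕ) : ℕ → List Sym → Set where
    here : ∀ {d w} → D ≤ d → Deep D d w
    there : ∀ {d a w} → Deep D (depth a d) w → Deep D d (a ∷ w)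

  Deep-pred : ∀ {D d w} → Deep (suc D) d w → Deep D d w
  Deep-pred (here l) = here (ℕ.≤-trans (ℕ.n≤1+n _) l)
  Deep-pred (there p) = there (Deep-pred p)

  depth≤ : ∀ a d → depth a d ≤ suc d
  depth≤ op d = ℕ.≤-refl
  depth≤ cl d = ℕ.≤-trans (ℕ.pred[n]≤n {d}) (ℕ.n≤1+n d)
  depth≤ dot d = ℕ.n≤1+n d

  -- The letter at a pair of sites alters only the depth between the two, and by at most one, and a
  -- segment uses each letter once. So every word reached from a word of depth `suc D` still attains
  -- depth `D`, where `f` vanishes.
  segment-deep : ∀ D d k q f → (∀ w → Deep D d w → f w ≡ 0ℤ) → ∀ w → Deep (suc D) d w →
    hops (segment (rem d) 0 k) q f w ≡ 0ℤ
  segment-deep D d zero q f z w p = z w (Deep-pred p)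
  segment-deep D d (suc k) q f z [] p = trans (segment-inert d 0 (suc k) q f [] z≤n) (z [] (Deep-pred p))
  segment-deep D d (suc k) q f z (a ∷ w) p with D ℕ.≤? d
  ... | yes l = hops-zero (segment (rem d) 0 (suc k)) q (λ v → z v (here l)) (a ∷ w)
  ... | no ¬l = trans (cong₂ (λ s t → s + q * t)
        (trans (cons-segment d a 0 k q f w) (rest a w (tail p))) (moved w p))
        (trans (ℤ.+-identityˡ _) (ℤ.*-zeroʳ q))
    where
    rest : ∀ a w → Deep (suc D) (depth a d) w → hops (segment (rem (depth a d)) 0 k) q (λ v → f (a ∷ v)) w ≡ 0ℤ
    rest a w p = segment-deep D (depth a d) k q (λ v → f (a ∷ v)) (λ v pv → z (a ∷ v) (there pv)) w p
    tail : Deep (suc D) d (a ∷ w) → Deep (suc D) (depth a d) w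
    tail (here l) = ⊥-elim (¬l (ℕ.≤-trans (ℕ.n≤1+n D) l))
    tail (there p) = p
    moved : ∀ w → Deep (suc D) d (a ∷ w) → at (hops (segment (rem d) 1 k) q f) (rem d 0 (a ∷ w)) ≡ 0ℤ
    moved [] p = refl
    moved (b ∷ w) p with local a b d in e
    ... | nothing = refl
    ... | just (a′ , b′) = trans (cons-segment d a′ 0 k q f (b′ ∷ w)) (rest a′ (b′ ∷ w) (there (deep p)))
      where
      deep : Deep (suc D) d (a ∷ b ∷ w) → Deep (suc D) (depth b′ (depth a′ d)) w
      deep (here l) = ⊥-elim (¬l (ℕ.≤-trans (ℕ.n≤1+n D) l))
      deep (there (here l)) = ⊥-elim (¬l (ℕ.s≤s⁻¹ (ℕ.≤-trans l (depth≤ a d))))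
      deep (there (there p)) = subst (λ c → Deep (suc D) c w) (sym (local-depth d a b e)) p

  F-deep : ∀ L xs w → Deep (suc (length xs)) 0 w → F̂ L xs w ≡ 0ℤ
  F-deep L [] [] (here ())
  F-deep L [] (op ∷ w) p = refl
  F-deep L [] (cl ∷ w) p = refl
  F-deep L [] (dot ∷ w) (here ())
  F-deep L [] (dot ∷ w) (there p) = F-deep L [] w p
  F-deep L (x ∷ xs) w p = segment-deep (suc (length xs)) 0 L x (F̂ L xs) (F-deep L xs) w p

-- Integer polynomials as coefficient lists.

module Polynomials where

  open import Data.Nat using (_≤_)
  open import Data.Integer using (_+_; _*_; -_; _^_)

  eval : List ℤ → ℤ → ℤ
  eval [] q = 0ℤ
  eval (c ∷ cs) q = c + q * eval cs q

  -- Synthetic division by q - r; the remainder is the value at r.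
  quotient : ℤ → List ℤ → List ℤ
  quotient r [] = []
  quotient r (c ∷ []) = []
  quotient r (c ∷ cs@(_ ∷ _)) = eval cs r ∷ quotient r cs

  length-quotient : ∀ r c cs → length (quotient r (c ∷ cs)) ≡ length cs
  length-quotient r c [] = refl
  length-quotient r c (c′ ∷ cs) = cong suc (length-quotient r c′ cs)

  eval-quotient : ∀ r cs q → eval cs q ≡ eval cs r + (q + - r) * eval (quotient r cs) q
  eval-quotient r [] q = rng r q
    where
    rng : ∀ r q → 0ℤ ≡ 0ℤ + (q + - r) * 0ℤ
    rng = solve-∀
  eval-quotient r (c ∷ []) q = rng c r q
    where
    rng : ∀ c r q → c + q * 0ℤ ≡ c + r * 0ℤ + (q + - r) * 0ℤ
    rng = solve-∀
  eval-quotient r (c ∷ cs@(_ ∷ _)) q = trans (cong (λ z → c + q * z) (eval-quotient r cs q))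
    (rng c r q (eval cs r) (eval (quotient r cs) q))
    where
    rng : ∀ c r q s t → c + q * (s + (q + - r) * t) ≡ c + r * s + (q + - r) * (s + q * t)
    rng = solve-∀

  too-many-roots : ∀ cs rs → Unique rs → length cs ≤ length rs → All (λ r → eval cs r ≡ 0ℤ) rs →
    ∀ q → eval cs q ≡ 0ℤ
  too-many-roots [] rs u l z q = refl
  too-many-roots (c ∷ cs) (r ∷ rs) (r∉ ∷ u) (s≤s l) (z ∷ zs) q =
    trans (at-root q) (trans (cong ((q + - r) *_) (vanish q)) (ℤ.*-zeroʳ (q + - r)))
    where
    at-root : ∀ q → eval (c ∷ cs) q ≡ (q + - r) * eval (quotient r (c ∷ cs)) q
    at-root q = trans (eval-quotient r (c ∷ cs) q) (trans (cong (λ s → s + (q + - r) * eval (quotient r (c ∷ cs)) q) z) (ℤ.+-identityˡ _))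
    root : ∀ s → r ≢ s → eval (c ∷ cs) s ≡ 0ℤ → eval (quotient r (c ∷ cs)) s ≡ 0ℤ
    root s r≢s e with ℤ.i*j≡0⇒i≡0∨j≡0 (s + - r) (trans (sym (at-root s)) e)
    ... | inj₁ d = ⊥-elim (r≢s (sym (ℤ.i-j≡0⇒i≡j s r d)))
    ... | inj₂ d = d
    vanish : ∀ q → eval (quotient r (c ∷ cs)) q ≡ 0ℤ
    vanish = too-many-roots (quotient r (c ∷ cs)) rs u
      (ℕ.≤-trans (ℕ.≤-reflexive (length-quotient r c cs)) l) (All.zipWith (λ (p , e) → root _ p e) (r∉ , zs))

  eval-zipWith : ∀ cs ds q → length cs ≡ length ds → eval (zipWith _+_ cs ds) q ≡ eval cs q + eval ds q
  eval-zipWith [] [] q e = refl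
  eval-zipWith (c ∷ cs) (d ∷ ds) q e = trans (cong (λ z → c + d + q * z) (eval-zipWith cs ds q (ℕ.suc-injective e)))
    (rng c d q (eval cs q) (eval ds q))
    where
    rng : ∀ c d q s t → c + d + q * (s + t) ≡ c + q * s + (d + q * t)
    rng = solve-∀

  eval-neg : ∀ cs q → eval (List.map -_ cs) q ≡ - eval cs q
  eval-neg [] q = refl
  eval-neg (c ∷ cs) q = trans (cong (λ z → - c + q * z) (eval-neg cs q)) (rng c q (eval cs q))
    where
    rng : ∀ c q s → - c + q * - s ≡ - (c + q * s)
    rng = solve-∀

  eval-∷ʳ : ∀ cs t q → eval (cs ∷ʳ t) q ≡ eval cs q + q ^ length cs * t
  eval-∷ʳ [] t q = rng t q
    where
    rng : ∀ t q → t + q * 0ℤ ≡ 0ℤ + 1ℤ * t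
    rng = solve-∀
  eval-∷ʳ (c ∷ cs) t q = trans (cong (λ z → c + q * z) (eval-∷ʳ cs t q)) (rng c q t (eval cs q) (q ^ length cs))
    where
    rng : ∀ c q t s p → c + q * (s + p * t) ≡ c + q * s + q * p * t
    rng = solve-∀

  agree-on-roots : ∀ cs ds rs → Unique rs → length cs ≡ length ds → length cs ≤ length rs →
    All (λ r → eval cs r ≡ eval ds r) rs → ∀ q → eval cs q ≡ eval ds q
  agree-on-roots cs ds rs u e l z q = ℤ.i-j≡0⇒i≡j (eval cs q) (eval ds q) (trans (sym (diff q))
    (too-many-roots (zipWith _+_ cs (List.map -_ ds)) rs u
      (ℕ.≤-trans (ℕ.≤-reflexive (trans (List.length-zipWith _+_ cs (List.map -_ ds))
        (trans (cong (length cs ℕ.⊓_) (trans (List.length-map -_ ds) (sym e))) (ℕ.⊓-idem _)))) l)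
      (All.map (λ {r} p → trans (diff r) (ℤ.i≡j⇒i-j≡0 p)) z) q))
    where
    diff : ∀ r → eval (zipWith _+_ cs (List.map -_ ds)) r ≡ eval cs r ℤ.- eval ds r
    diff r = trans (eval-zipWith cs (List.map -_ ds) r (trans e (sym (List.length-map -_ ds))))
      (cong (λ z → eval cs r + z) (eval-neg ds r))

  from : ℕ → ℕ → List ℤ
  from b zero = []
  from b (suc k) = + b ∷ from (suc b) k

  from≥ : ∀ b c k → b ≤ c → All (λ x → + b ℤ.≤ x) (from c k)
  from≥ b c zero l = []
  from≥ b c (suc k) l = ℤ.+≤+ l ∷ from≥ b (suc c) k (ℕ.m≤n⇒m≤1+n l)

  from-unique : ∀ b k → Unique (from b k)
  from-unique b zero = []
  from-unique b (suc k) = All.map (λ l e → ℤ.<⇒≢ (ℤ.<-≤-trans (ℤ.+<+ (ℕ.n<1+n b)) l) e) (from≥ (suc b) (suc b) k ℕ.≤-refl)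
    ∷ from-unique (suc b) k

  length-from : ∀ b k → length (from b k) ≡ k
  length-from b zero = refl
  length-from b (suc k) = cong suc (length-from (suc b) k)

  -- Vanishing is assumed only from `b` on, because each new variable has to avoid the values
  -- already taken by the others.
  coefficients-zero : ∀ b cs → (∀ q → + b ℤ.≤ q → eval cs q ≡ 0ℤ) → All (_≡ 0ℤ) cs
  coefficients-zero b [] z = []
  coefficients-zero b (c ∷ cs) z = c≡0 ∷ coefficients-zero (suc b) cs tail
    where
    all-zero : ∀ q → eval (c ∷ cs) q ≡ 0ℤ
    all-zero = too-many-roots (c ∷ cs) (from b (suc (length cs))) (from-unique b (suc (length cs)))
      (ℕ.≤-reflexive (sym (length-from b (suc (length cs))))) (All.map (λ {x} l → z x l) (from≥ b b (suc (length cs)) ℕ.≤-refl))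
    c≡0 : c ≡ 0ℤ
    c≡0 = trans (sym (trans (cong (λ z → c + z) (ℤ.*-zeroˡ (eval cs 0ℤ))) (ℤ.+-identityʳ c))) (all-zero 0ℤ)
    -- Raising the bound to `suc b` excludes q = 0, so that the factor q can be cancelled.
    tail : ∀ q → + suc b ℤ.≤ q → eval cs q ≡ 0ℤ
    tail q l with ℤ.i*j≡0⇒i≡0∨j≡0 q (trans (sym (ℤ.+-identityˡ _)) (trans (cong (_+ q * eval cs q) (sym c≡0)) (all-zero q)))
    ... | inj₁ refl = ⊥-elim (λ0 l)
      where
      λ0 : + suc b ℤ.≤ 0ℤ → _
      λ0 (ℤ.+≤+ ())
    ... | inj₂ e = e

-- Polynomials in q from the closers and from vertical strips.

module HorizontalAndVertical where

  open import Data.Nat using (_≤_)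
  open import Data.Integer using (_+_; _*_; _^_)
  open Moves
  open NilCoxeterMoves
  open ArcWords
  open ArcWordProperties
  open Polynomials

  hops-linear : {X : Set} (ρs : List (Move X)) (q c : ℤ) (f g : X → ℤ) (w : X) →
    hops ρs q (λ v → f v + c * g v) w ≡ hops ρs q f w + c * hops ρs q g w
  hops-linear [] q c f g w = refl
  hops-linear (ρ ∷ ρs) q c f g w = trans (cong₂ (λ s t → s + q * t) (hops-linear ρs q c f g w) (at-linear (ρ w)))
    (rng (hops ρs q f w) (hops ρs q g w) (at (hops ρs q f) (ρ w)) (at (hops ρs q g) (ρ w)) q c)
    where
    at-linear : ∀ m → at (hops ρs q (λ v → f v + c * g v)) m ≡ at (hops ρs q f) m + c * at (hops ρs q g) m
    at-linear nothing = sym (trans (ℤ.+-identityˡ _) (ℤ.*-zeroʳ c))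
    at-linear (just v) = hops-linear ρs q c f g v
    rng : ∀ a b a′ b′ q c → (a + c * b) + q * (a′ + c * b′) ≡ (a + q * a′) + c * (b + q * b′)
    rng = solve-∀

  hops-at-zero : {X : Set} (ρs : List (Move X)) (f : X → ℤ) → hops ρs 0ℤ f ≗ f
  hops-at-zero [] f w = refl
  hops-at-zero (ρ ∷ ρs) f w = trans (cong₂ _+_ (hops-at-zero ρs f w) (ℤ.*-zeroˡ (at (hops ρs 0ℤ f) (ρ w))))
    (ℤ.+-identityʳ (f w))

  data NoClose : List Sym → Set where
    [] : NoClose []
    op : ∀ {w} → NoClose w → NoClose (op ∷ w)
    dot : ∀ {w} → NoClose w → NoClose (dot ∷ w)

  opens : List Sym → ℕ
  opens [] = 0
  opens (op ∷ w) = suc (opens w)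
  opens (cl ∷ w) = opens w
  opens (dot ∷ w) = opens w

  rem-noClose : ∀ d i w {w′} → NoClose w → rem d i w ≡ just w′ → NoClose w′ × opens w′ ≡ opens w
  rem-noClose d zero (op ∷ dot ∷ w) (op (dot c)) refl = dot (op c) , refl
  rem-noClose d zero (dot ∷ op ∷ w) _ ()
  rem-noClose d zero (dot ∷ dot ∷ w) _ ()
  rem-noClose d zero (dot ∷ cl ∷ w) (dot ()) _
  rem-noClose d (suc i) (op ∷ w) (op c) e with map-just _ (rem (suc d) i w) e
  ... | _ , e′ , refl = let c′ , o = rem-noClose (suc d) i w c e′ in op c′ , cong suc o
  rem-noClose d (suc i) (dot ∷ w) (dot c) e with map-just _ (rem d i w) e
  ... | _ , e′ , refl = let c′ , o = rem-noClose d i w c e′ in dot c′ , o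

  closes : ℕ → List Sym
  closes r = replicate r cl

  ι : List Sym → List Sym
  ι u = u ++ closes (opens u)

  depths : List Sym → ℕ → ℕ
  depths [] d = d
  depths (a ∷ w) d = depths w (depth a d)

  depths-noClose : ∀ w d → NoClose w → depths w d ≡ opens w ℕ.+ d
  depths-noClose [] d [] = refl
  depths-noClose (op ∷ w) d (op c) = trans (depths-noClose w (suc d) c) (ℕ.+-suc (opens w) d)
  depths-noClose (dot ∷ w) d (dot c) = depths-noClose w d c

  prefix-segment : ∀ v d k q f s →
    hops (segment (rem d) (length v) k) q f (v ++ s) ≡ hops (segment (rem (depths v d)) 0 k) q (λ t → f (v ++ t)) s
  prefix-segment [] d k q f s = refl
  prefix-segment (a ∷ v) d k q f s = trans (cons-segment d a (length v) k q f (v ++ s))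
    (prefix-segment v (depth a d) k q (λ t → f (a ∷ t)) s)

  Deep-prefix : ∀ D v d s → D ≤ depths v d → Deep D d (v ++ s)
  Deep-prefix D [] d s l = here l
  Deep-prefix D (a ∷ v) d s l = there (Deep-prefix D v (depth a d) s l)

  closes-inert : ∀ r d k q f → hops (segment (rem d) 0 k) q f (closes r) ≡ f (closes r)
  closes-inert zero d k q f = segment-inert d 0 k q f [] z≤n
  closes-inert (suc r) d zero q f = refl
  closes-inert (suc r) d (suc k) q f = trans
    (hop-nothing (rem d 0) q (hops (segment (rem d) 1 k) q f) (closes (suc r)) (first r))
    (trans (cons-segment d cl 0 k q f (closes r)) (closes-inert r (ℕ.pred d) k q (λ v → f (cl ∷ v))))
    where
    first : ∀ r → rem d 0 (closes (suc r)) ≡ nothing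
    first zero = refl
    first (suc r) = refl

  -- The entry at j is the value of `g` after the dot, or the opener, has passed j closers; the top
  -- term is kept apart in `scan-dot` and `scan-op`.
  dot-coefficients op-coefficients : ℕ → (List Sym → ℤ) → List ℤ
  dot-coefficients zero g = []
  dot-coefficients (suc r) g = g (dot ∷ closes (suc r)) ∷ dot-coefficients r (λ v → g (cl ∷ v))
  op-coefficients zero g = g (op ∷ closes 1) ∷ []
  op-coefficients (suc r) g = g (op ∷ closes (suc (suc r))) ∷ op-coefficients r (λ v → g (cl ∷ v))

  length-dot-coefficients : ∀ r g → length (dot-coefficients r g) ≡ r
  length-dot-coefficients zero g = refl
  length-dot-coefficients (suc r) g = cong suc (length-dot-coefficients r _)

  length-op-coefficients : ∀ r g → length (op-coefficients r g) ≡ suc r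
  length-op-coefficients zero g = refl
  length-op-coefficients (suc r) g = cong suc (length-op-coefficients r _)

  -- The letters come in increasing order, so the dot travels right until the first letter that is
  -- skipped; from then on only closers lie ahead and nothing moves. The terms are thus indexed by
  -- the number of steps.
  scan-dot : ∀ r d k q g → r ≤ d → r ≤ k → hops (segment (rem d) 0 k) q g (dot ∷ closes r) ≡
    eval (dot-coefficients r g) q + q ^ r * g (closes r ++ dot ∷ [])
  scan-dot zero d k q g _ _ = trans (segment-inert d 0 k q g (dot ∷ []) ℕ.≤-refl) (rng (g (dot ∷ [])))
    where
    rng : ∀ a → a ≡ 0ℤ + 1ℤ * a
    rng = solve-∀
  scan-dot (suc r) (suc d) (suc k) q g (s≤s r≤d) (s≤s r≤k) = trans
    (cong₂ (λ s t → s + q * t)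
      (trans (cons-segment (suc d) dot 0 k q g (closes (suc r))) (closes-inert (suc r) (suc d) k q (λ v → g (dot ∷ v))))
      (trans (cons-segment (suc d) cl 0 k q g (dot ∷ closes r)) (scan-dot r d k q (λ v → g (cl ∷ v)) r≤d r≤k)))
    (rng (g (dot ∷ closes (suc r))) q _ (q ^ r) _)
    where
    rng : ∀ a q b p c → a + q * (b + p * c) ≡ a + q * b + q * p * c
    rng = solve-∀

  -- The opener passes the `r` closers of the older arcs; the one after them is its own, and the
  -- last step erases the arc. This is why the top word has two dots.
  scan-op : ∀ r k q g → suc r ≤ k → hops (segment (rem r) 0 k) q g (op ∷ closes (suc r)) ≡
    eval (op-coefficients r g) q + q ^ suc r * g (closes r ++ dot ∷ dot ∷ [])
  scan-op zero (suc k) q g _ = trans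
    (cong₂ (λ s t → s + q * t)
      (trans (cons-segment 0 op 0 k q g (closes 1)) (closes-inert 1 1 k q (λ v → g (op ∷ v))))
      (trans (cons-segment 0 dot 0 k q g (dot ∷ [])) (segment-inert 0 0 k q (λ v → g (dot ∷ v)) (dot ∷ []) ℕ.≤-refl)))
    (rng (g (op ∷ closes 1)) q (g (dot ∷ dot ∷ [])))
    where
    rng : ∀ a q b → a + q * b ≡ a + q * 0ℤ + q * 1ℤ * b
    rng = solve-∀
  scan-op (suc r) (suc k) q g (s≤s l) = trans
    (cong₂ (λ s t → s + q * t)
      (trans (cons-segment (suc r) op 0 k q g (closes (suc (suc r)))) (closes-inert (suc (suc r)) (suc (suc r)) k q (λ v → g (op ∷ v))))
      (trans (cons-segment (suc r) cl 0 k q g (op ∷ closes (suc r))) (scan-op r k q (λ v → g (cl ∷ v)) l)))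
    (rng (g (op ∷ closes (suc (suc r)))) q _ (q ^ suc r) _)
    where
    rng : ∀ a q b p c → a + q * (b + p * c) ≡ a + q * b + q * p * c
    rng = solve-∀

  exit : Move (List Sym)
  exit (a ∷ b ∷ w) = Maybe.map (a ∷_) (exit (b ∷ w))
  exit (op ∷ []) = just (dot ∷ [])
  exit _ = nothing

  exit-noClose : ∀ w {w′} → NoClose w → exit w ≡ just w′ →
    NoClose w′ × suc (opens w′) ≡ opens w × length w′ ≡ length w
  exit-noClose (op ∷ []) (op []) refl = dot [] , refl , refl
  exit-noClose (op ∷ w@(_ ∷ _)) (op c) e with map-just _ (exit w) e
  ... | _ , e′ , refl = let c′ , o , l = exit-noClose w c e′ in op c′ , cong suc o , cong suc l
  exit-noClose (dot ∷ w@(_ ∷ _)) (dot c) e with map-just _ (exit w) e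
  ... | _ , e′ , refl = let c′ , o , l = exit-noClose w c e′ in dot c′ , o , cong suc l

  exit-square : ∀ w → (exit w >>= exit) ≡ nothing
  exit-square [] = refl
  exit-square (op ∷ []) = refl
  exit-square (cl ∷ []) = refl
  exit-square (dot ∷ []) = refl
  exit-square (a ∷ b ∷ w) with exit (b ∷ w) | exit-nonempty b w | exit-square (b ∷ w)
    where
    exit-nonempty : ∀ b w {v} → exit (b ∷ w) ≡ just v → Σ Sym λ c → Σ (List Sym) λ v′ → v ≡ c ∷ v′
    exit-nonempty op [] refl = dot , [] , refl
    exit-nonempty b (c ∷ w) e with map-just _ (exit (c ∷ w)) e
    ... | v , _ , refl = b , v , refl
  ... | nothing | _ | _ = refl
  ... | just v | ne | ih with ne refl
  ... | c , v′ , refl rewrite ih = refl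

  -- V q f u = Σ q^|S| f (u with the openers in S moved one site to the right),
  -- where an opener moved out of the last site disappears.
  V : ℕ → ℕ → ℤ → (List Sym → ℤ) → List Sym → ℤ
  V d n = hops (exit ∷ reversed (rem d) 0 n)

  -- The letter 0 comes last in the reversed product and is absorbed into the function; the rest
  -- sees the symbol `a` only through the depth.
  V-cons : ∀ d a n q f w → length w ≡ suc n →
    V d (suc n) q f (a ∷ w) ≡ V (depth a d) n q (λ v → f (a ∷ v) + q * at f (rem d 0 (a ∷ v))) w
  V-cons d a n q f w l = trans
    (cong (λ g → g (a ∷ w)) (hops-++ (exit ∷ reversed (rem d) 1 n) (rem d 0 ∷ []) q f))
    (hops-sim (λ v → length v ≡ suc n) (a ∷_)
      {ρs = exit ∷ reversed (rem (depth a d)) 0 n} {σs = exit ∷ reversed (rem d) 1 n}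
      (exit-sim ∷ reversed-pointwise 0 1 n (λ m _ v lv → refl , λ v′ e → trans (rem-length (depth a d) m v e) lv))
      q (λ _ _ → refl) w l)
    where
    exit-length : ∀ w {w′} → exit w ≡ just w′ → length w′ ≡ length w
    exit-length (op ∷ []) refl = refl
    exit-length (a ∷ w@(_ ∷ _)) e with map-just _ (exit w) e
    ... | _ , e′ , refl = cong suc (exit-length w e′)
    exit-sim : Sim (λ v → length v ≡ suc n) (a ∷_) exit exit
    exit-sim (b ∷ v) lv = refl , λ v′ e → trans (exit-length (b ∷ v) e) lv

  V-cong : ∀ d n q {f g : List Sym → ℤ} → (∀ w → NoClose w → f w ≡ g w) → ∀ w → NoClose w → V d n q f w ≡ V d n q g w
  V-cong d n q h = hops-sim NoClose (λ w → w)
    ((λ w c → sym (Maybe.map-id (exit w)) , λ w′ e → proj₁ (exit-noClose w c e)) ∷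
     reversed-pointwise 0 0 n (λ m _ w c → sym (Maybe.map-id (rem d m w)) , λ w′ e → proj₁ (rem-noClose d m w c e))) q h

  NoClose-init : ∀ v {c} → NoClose (v ∷ʳ c) → NoClose v
  NoClose-init [] c = []
  NoClose-init (op ∷ v) (op c) = op (NoClose-init v c)
  NoClose-init (dot ∷ v) (dot c) = dot (NoClose-init v c)

  -- The top term comes from moving every opener: the whole word shifts by one site, and `v ∷ʳ c`
  -- becomes `dot ∷ v`.
  V-polynomial : ∀ v c d f → NoClose (v ∷ʳ c) → Σ (List ℤ) λ cs → length cs ≡ opens (v ∷ʳ c) ×
    (∀ q → V d (length v) q f (v ∷ʳ c) ≡ eval cs q + q ^ opens (v ∷ʳ c) * f (dot ∷ v))
  V-polynomial [] op d f _ = f (op ∷ []) ∷ [] , refl , λ q → rng (f (op ∷ [])) q (f (dot ∷ []))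
    where
    rng : ∀ a q b → a + q * b ≡ a + q * 0ℤ + q * 1ℤ * b
    rng = solve-∀
  V-polynomial [] dot d f _ = [] , refl , λ q → rng (f (dot ∷ [])) q
    where
    rng : ∀ a q → a + q * 0ℤ ≡ 0ℤ + 1ℤ * a
    rng = solve-∀
  V-polynomial (dot ∷ v) c d f (dot nc) =
    let cs , l , e = V-polynomial v c d (λ w → f (dot ∷ w)) nc in
    cs , l , λ q → trans (V-cons d dot (length v) q f (v ∷ʳ c) (List.length-++-comm v (c ∷ [])))
      (trans (V-cong d (length v) q (λ w ncw → trans (cong (λ m → f (dot ∷ w) + q * at f m) (blocked w ncw))
        (trans (cong (λ z → f (dot ∷ w) + z) (ℤ.*-zeroʳ q)) (ℤ.+-identityʳ _))) (v ∷ʳ c) nc) (e q))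
    where
    blocked : ∀ w → NoClose w → rem d 0 (dot ∷ w) ≡ nothing
    blocked [] _ = refl
    blocked (op ∷ w) _ = refl
    blocked (dot ∷ w) _ = refl
  -- The first opener stays (`cs₁`, whose top term `t₁` becomes a lower coefficient) or moves
  -- (`cs₂`, shifted by one power of q).
  V-polynomial (op ∷ v) c d f (op nc) =
    let cs₁ , l₁ , e₁ = V-polynomial v c (suc d) (λ w → f (op ∷ w)) nc
        cs₂ , l₂ , e₂ = V-polynomial v c (suc d) (λ w → at f (rem d 0 (op ∷ w))) nc
        r = opens (v ∷ʳ c)
        t₁ = f (op ∷ dot ∷ v)
        len = trans (List.length-++-comm cs₁ (t₁ ∷ [])) (cong suc (trans l₁ (sym l₂)))
    in
    List.zipWith _+_ (cs₁ ∷ʳ t₁) (0ℤ ∷ cs₂) ,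
    trans (List.length-zipWith _+_ (cs₁ ∷ʳ t₁) (0ℤ ∷ cs₂))
      (trans (cong (λ m → m ℕ.⊓ suc (length cs₂)) len) (trans (ℕ.⊓-idem (suc (length cs₂))) (cong suc l₂))) ,
    λ q → begin
      V d (suc (length v)) q f (op ∷ v ∷ʳ c)
        ≡⟨ V-cons d op (length v) q f (v ∷ʳ c) (List.length-++-comm v (c ∷ [])) ⟩
      V (suc d) (length v) q (λ w → f (op ∷ w) + q * at f (rem d 0 (op ∷ w))) (v ∷ʳ c)
        ≡⟨ hops-linear (exit ∷ reversed (rem (suc d)) 0 (length v)) q q (λ w → f (op ∷ w)) (λ w → at f (rem d 0 (op ∷ w))) (v ∷ʳ c) ⟩
      V (suc d) (length v) q (λ w → f (op ∷ w)) (v ∷ʳ c) + q * V (suc d) (length v) q (λ w → at f (rem d 0 (op ∷ w))) (v ∷ʳ c)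
        ≡⟨ cong₂ (λ s t → s + q * t) (e₁ q) (e₂ q) ⟩
      (eval cs₁ q + q ^ r * t₁) + q * (eval cs₂ q + q ^ r * f (dot ∷ op ∷ v))
        ≡⟨ rng (eval cs₁ q) (q ^ r * t₁) (eval cs₂ q) q (q ^ r) (f (dot ∷ op ∷ v)) ⟩
      ((eval cs₁ q + q ^ r * t₁) + (0ℤ + q * eval cs₂ q)) + q * q ^ r * f (dot ∷ op ∷ v)
        ≡⟨ cong (λ m → ((eval cs₁ q + q ^ m * t₁) + (0ℤ + q * eval cs₂ q)) + q * q ^ r * f (dot ∷ op ∷ v)) l₁ ⟨
      ((eval cs₁ q + q ^ length cs₁ * t₁) + (0ℤ + q * eval cs₂ q)) + q * q ^ r * f (dot ∷ op ∷ v)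
        ≡⟨ cong (λ z → (z + (0ℤ + q * eval cs₂ q)) + q * q ^ r * f (dot ∷ op ∷ v)) (eval-∷ʳ cs₁ t₁ q) ⟨
      (eval (cs₁ ∷ʳ t₁) q + eval (0ℤ ∷ cs₂) q) + q * q ^ r * f (dot ∷ op ∷ v)
        ≡⟨ cong (λ z → z + q * q ^ r * f (dot ∷ op ∷ v)) (eval-zipWith (cs₁ ∷ʳ t₁) (0ℤ ∷ cs₂) q len) ⟨
      eval (List.zipWith _+_ (cs₁ ∷ʳ t₁) (0ℤ ∷ cs₂)) q + q ^ suc r * f (dot ∷ op ∷ v) ∎
    where
    open ≡-Reasoning
    rng : ∀ a b c q p t → (a + b) + q * (c + p * t) ≡ ((a + b) + (0ℤ + q * c)) + q * p * t
    rng = solve-∀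

-- Equality of the values at distinct positive integers.

module Evaluations where

  open import Data.Nat using (_≤_)
  open import Data.Integer using (_+_; _*_; -_; _^_)
  open Moves
  open NilCoxeterMoves
  open ArcWords
  open ArcWordProperties
  open Polynomials
  open HorizontalAndVertical

  map-congJust : {X Y : Set} {e e′ : X → Y} (m : Maybe X) → (∀ x → m ≡ just x → e x ≡ e′ x) →
    Maybe.map e m ≡ Maybe.map e′ m
  map-congJust nothing h = refl
  map-congJust (just x) h = cong just (h x refl)

  -- There are `suc n` sites, numbered from 0: the letters below `n` act inside `w`, and the letter
  -- `n` on its last site and the first closer of `ι w`. An opener at site s stands for a row of n +
  -- 1 - s boxes.
  Word : ℕ → List Sym → Set
  Word n w = length w ≡ suc n × NoClose w

  -- Makes 0 and the negatives of the variables distinct interpolation nodes.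
  Admissible : List ℤ → Set
  Admissible xs = Unique xs × All (0ℤ ℤ.<_) xs

  -- The variable at the head belongs to the largest entry: the word first meets the letters below
  -- `n`, which strip its unprimed copies, and then `V`, which strips the primed ones.
  P̂ : ℕ → List ℤ → List Sym → ℤ
  P̂ n [] = vacuum
  P̂ n (x ∷ xs) = hops (segment (rem 0) 0 n) x (V 0 n x (P̂ n xs))

  ι-sim : ∀ n m → m ℕ.< n → Sim (Word n) ι (rem 0 m) (rem 0 m)
  ι-sim n m l w (e , c) =
    trans (rem-++ 0 m w (closes (opens w)) (subst (suc (suc m) ≤_) (sym e) (s≤s l)))
      (map-congJust (rem 0 m w) λ v ev → cong (λ r → v ++ closes r) (sym (proj₂ (rem-noClose 0 m w c ev)))) ,
    λ v ev → trans (rem-length 0 m w ev) e , proj₁ (rem-noClose 0 m w c ev)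

  segment-ι : ∀ n q {f g} → (∀ w → Word n w → f (ι w) ≡ g w) → ∀ w → Word n w →
    hops (segment (rem 0) 0 n) q f (ι w) ≡ hops (segment (rem 0) 0 n) q g w
  segment-ι n q = hops-sim (Word n) ι (segment-pointwise 0 0 n (ι-sim n)) q

  reversed-ι : ∀ n q {f g} → (∀ w → Word n w → f (ι w) ≡ g w) → ∀ w → Word n w →
    hops (reversed (rem 0) 0 n) q f (ι w) ≡ hops (reversed (rem 0) 0 n) q g w
  reversed-ι n q = hops-sim (Word n) ι (reversed-pointwise 0 0 n (ι-sim n)) q

  Word-sim : ∀ n m → Sim (Word n) (λ w → w) (rem 0 m) (rem 0 m)
  Word-sim n m w (e , c) = sym (Maybe.map-id (rem 0 m w)) ,
    λ v ev → trans (rem-length 0 m w ev) e , proj₁ (rem-noClose 0 m w c ev)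

  exit-sim : ∀ n → Sim (Word n) (λ w → w) exit exit
  exit-sim n w (e , c) = sym (Maybe.map-id (exit w)) ,
    λ v ev → let c′ , _ , l = exit-noClose w c ev in trans l e , c′

  V-on : ∀ n q {f g} → (∀ w → Word n w → f w ≡ g w) → ∀ w → Word n w → V 0 n q f w ≡ V 0 n q g w
  V-on n q = hops-sim (Word n) (λ w → w) (exit-sim n ∷ reversed-pointwise 0 0 n (λ m _ → Word-sim n m)) q

  closes-balanced : ∀ d → Balanced d (closes d)
  closes-balanced zero = done
  closes-balanced (suc d) = close (closes-balanced d)

  ι-balanced : ∀ v d → NoClose v → Balanced d (v ++ closes (opens v ℕ.+ d))
  ι-balanced [] d [] = closes-balanced d
  ι-balanced (op ∷ v) d (op c) = open′ (subst (λ r → Balanced (suc d) (v ++ closes r)) (ℕ.+-suc (opens v) d) (ι-balanced v (suc d) c))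
  ι-balanced (dot ∷ v) d (dot c) = stay (ι-balanced v d c)

  opens≤ : ∀ v → opens v ≤ length v
  opens≤ [] = z≤n
  opens≤ (op ∷ v) = s≤s (opens≤ v)
  opens≤ (cl ∷ v) = ℕ.m≤n⇒m≤1+n (opens≤ v)
  opens≤ (dot ∷ v) = ℕ.m≤n⇒m≤1+n (opens≤ v)

  opens-∷ʳ-op : ∀ v → opens (v ∷ʳ op) ≡ suc (opens v)
  opens-∷ʳ-op [] = refl
  opens-∷ʳ-op (op ∷ v) = cong suc (opens-∷ʳ-op v)
  opens-∷ʳ-op (cl ∷ v) = opens-∷ʳ-op v
  opens-∷ʳ-op (dot ∷ v) = opens-∷ʳ-op v

  opens-∷ʳ-dot : ∀ v → opens (v ∷ʳ dot) ≡ opens v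
  opens-∷ʳ-dot [] = refl
  opens-∷ʳ-dot (op ∷ v) = cong suc (opens-∷ʳ-dot v)
  opens-∷ʳ-dot (cl ∷ v) = opens-∷ʳ-dot v
  opens-∷ʳ-dot (dot ∷ v) = opens-∷ʳ-dot v

  module _ (n : ℕ) where
    private
      k : ℕ
      k = suc (suc n)

    -- `ι w` has at most 2n + 2 sites. Splitting the letters as `n + k` separates those inside `w`
    -- from those that reach the closers; `k` leaves room for an opener at the last site to pass all
    -- older closers and meet its own, and for the dot added in `shift`.
    L : ℕ
    L = n ℕ.+ k

    private
      shift : ∀ xs v → length v ≡ n → NoClose v → F̂ L xs (ι v) ≡ F̂ L xs (ι (dot ∷ v))
      shift xs v l c = sym (F-cons-dot L xs (ι v) (subst (_≤ L) (sym (List.length-++ v))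
        (subst₂ _≤_ (cong (length v ℕ.+_) (sym (List.length-replicate (opens v)))) refl
          (ℕ.+-mono-≤ (ℕ.≤-reflexive l) (ℕ.≤-trans (opens≤ v) (ℕ.≤-trans (ℕ.≤-reflexive l) (ℕ.m≤n+m n 2)))))))

      ι-balanced₀ : ∀ v → NoClose v → Balanced 0 (ι v)
      ι-balanced₀ v c = subst (λ r → Balanced 0 (v ++ closes r)) (ℕ.+-identityʳ (opens v)) (ι-balanced v 0 c)

      opens<k : ∀ v → length v ≡ n → suc (opens v) ≤ k
      opens<k v l = s≤s (ℕ.≤-trans (opens≤ v) (ℕ.≤-trans (ℕ.≤-reflexive l) (ℕ.n≤1+n n)))

      snoc-balanced : ∀ {w d} → Balanced d w → Balanced d (w ++ dot ∷ [])
      snoc-balanced done = stay done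
      snoc-balanced (open′ b) = open′ (snoc-balanced b)
      snoc-balanced (close b) = close (snoc-balanced b)
      snoc-balanced (stay b) = stay (snoc-balanced b)

    -- The top word is `ι v` followed by one or two dots. Trailing dots are dropped and a leading
    -- dot is added, so that the top coefficient becomes a value at `dot ∷ v`, which again has
    -- `suc n` sites: it is the word of `V-polynomial` and within reach of the induction hypothesis.
    F-polynomial : ∀ xs v c → length v ≡ n → NoClose (v ∷ʳ c) → Σ (List ℤ) λ cs → length cs ≡ opens (v ∷ʳ c) ×
      (∀ q → hops (segment (rem 0) n k) q (F̂ L xs) (ι (v ∷ʳ c)) ≡ eval cs q + q ^ opens (v ∷ʳ c) * F̂ L xs (ι (dot ∷ v)))
    F-polynomial xs v dot refl nc = dot-coefficients r g , trans (length-dot-coefficients r g) (sym (opens-∷ʳ-dot v)) ,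
      λ q → begin
        hops (segment (rem 0) n k) q (F̂ L xs) ((v ∷ʳ dot) ++ closes (opens (v ∷ʳ dot)))
          ≡⟨ cong (hops (segment (rem 0) n k) q (F̂ L xs)) (trans (cong (λ s → (v ∷ʳ dot) ++ closes s) (opens-∷ʳ-dot v)) (List.++-assoc v (dot ∷ []) (closes r))) ⟩
        hops (segment (rem 0) n k) q (F̂ L xs) (v ++ dot ∷ closes r) ≡⟨ prefix-segment v 0 k q (F̂ L xs) (dot ∷ closes r) ⟩
        hops (segment (rem (depths v 0)) 0 k) q g (dot ∷ closes r)
          ≡⟨ scan-dot r (depths v 0) k q g (ℕ.≤-trans (ℕ.m≤m+n r 0) (ℕ.≤-reflexive (sym (depths-noClose v 0 (NoClose-init v nc))))) (ℕ.≤-trans (ℕ.n≤1+n r) (opens<k v refl)) ⟩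
        eval (dot-coefficients r g) q + q ^ r * F̂ L xs (v ++ (closes r ++ dot ∷ []))
          ≡⟨ cong₂ (λ s z → eval (dot-coefficients r g) q + q ^ s * z) (sym (opens-∷ʳ-dot v))
               (trans (cong (F̂ L xs) (sym (List.++-assoc v (closes r) (dot ∷ []))))
                 (trans (F-snoc-dot L xs (ι v) (ι-balanced₀ v (NoClose-init v nc))) (shift xs v refl (NoClose-init v nc)))) ⟩
        eval (dot-coefficients r g) q + q ^ opens (v ∷ʳ dot) * F̂ L xs (ι (dot ∷ v)) ∎
      where
      open ≡-Reasoning
      r : ℕ
      r = opens v
      g : List Sym → ℤ
      g t = F̂ L xs (v ++ t)
    F-polynomial xs v op refl nc = op-coefficients r g , trans (length-op-coefficients r g) (sym (opens-∷ʳ-op v)) ,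
      λ q → begin
        hops (segment (rem 0) n k) q (F̂ L xs) ((v ∷ʳ op) ++ closes (opens (v ∷ʳ op)))
          ≡⟨ cong (hops (segment (rem 0) n k) q (F̂ L xs)) (trans (cong (λ s → (v ∷ʳ op) ++ closes s) (opens-∷ʳ-op v)) (List.++-assoc v (op ∷ []) (closes (suc r)))) ⟩
        hops (segment (rem 0) n k) q (F̂ L xs) (v ++ op ∷ closes (suc r)) ≡⟨ prefix-segment v 0 k q (F̂ L xs) (op ∷ closes (suc r)) ⟩
        hops (segment (rem (depths v 0)) 0 k) q g (op ∷ closes (suc r))
          ≡⟨ cong (λ d → hops (segment (rem d) 0 k) q g (op ∷ closes (suc r))) (trans (depths-noClose v 0 (NoClose-init v nc)) (ℕ.+-identityʳ r)) ⟩
        hops (segment (rem r) 0 k) q g (op ∷ closes (suc r)) ≡⟨ scan-op r k q g (opens<k v refl) ⟩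
        eval (op-coefficients r g) q + q ^ suc r * F̂ L xs (v ++ (closes r ++ dot ∷ dot ∷ []))
          ≡⟨ cong₂ (λ s z → eval (op-coefficients r g) q + q ^ s * z) (sym (opens-∷ʳ-op v)) (trailing (NoClose-init v nc)) ⟩
        eval (op-coefficients r g) q + q ^ opens (v ∷ʳ op) * F̂ L xs (ι (dot ∷ v)) ∎
      where
      open ≡-Reasoning
      r : ℕ
      r = opens v
      g : List Sym → ℤ
      g t = F̂ L xs (v ++ t)
      trailing : NoClose v → F̂ L xs (v ++ (closes r ++ dot ∷ dot ∷ [])) ≡ F̂ L xs (ι (dot ∷ v))
      trailing c = begin
        F̂ L xs (v ++ (closes r ++ dot ∷ dot ∷ [])) ≡⟨ cong (F̂ L xs) (List.++-assoc v (closes r) (dot ∷ dot ∷ [])) ⟨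
        F̂ L xs (ι v ++ dot ∷ dot ∷ []) ≡⟨ cong (F̂ L xs) (List.++-assoc (ι v) (dot ∷ []) (dot ∷ [])) ⟨
        F̂ L xs ((ι v ++ dot ∷ []) ++ dot ∷ []) ≡⟨ F-snoc-dot L xs (ι v ++ dot ∷ []) (snoc-balanced (ι-balanced₀ v c)) ⟩
        F̂ L xs (ι v ++ dot ∷ []) ≡⟨ F-snoc-dot L xs (ι v) (ι-balanced₀ v c) ⟩
        F̂ L xs (ι v) ≡⟨ shift xs v refl c ⟩
        F̂ L xs (ι (dot ∷ v)) ∎

    F-polynomial xs v cl l nc = ⊥-elim (no-cl v nc)
      where
      no-cl : ∀ v → ¬ NoClose (v ∷ʳ cl)
      no-cl (op ∷ v) (op c) = no-cl v c
      no-cl (dot ∷ v) (dot c) = no-cl v c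

    F-front : ∀ {x xs} (p : x ∈ xs) → F̂ L xs ≗ F̂ L (x ∷ (xs ─ p))
    F-front (here refl) w = refl
    F-front {x} {y ∷ xs} (there p) w = trans (hops-cong (segment (rem 0) 0 L) y (F-front p) w)
      (stanley-swap (rem-nilCoxeter 0) vacuum-relation L y x (xs ─ p) w)

    ─-all : ∀ {A : Set} {R : A → Set} {x xs} (p : x ∈ xs) → All R xs → All R (xs ─ p)
    ─-all (here refl) (_ ∷ rs) = rs
    ─-all (there p) (r ∷ rs) = r ∷ ─-all p rs

    ─-good : ∀ {x xs} (p : x ∈ xs) → Admissible xs → Admissible (x ∷ (xs ─ p))
    ─-good p (u , a) = front-unique p u , All.lookup a p ∷ ─-all p a
      where
      front-unique : ∀ {x xs} (p : x ∈ xs) → Unique xs → Unique (x ∷ (xs ─ p))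
      front-unique (here refl) u = u
      front-unique (there p) (y∉ ∷ u) with front-unique p u
      ... | x∉ ∷ u′ = ((λ e → All.lookup y∉ p (sym e)) ∷ x∉) ∷ (─-all p y∉ ∷ u′)

    ─-length : ∀ {x : ℤ} {xs} (p : x ∈ xs) → suc (length (xs ─ p)) ≡ length xs
    ─-length (here refl) = refl
    ─-length (there p) = cong suc (─-length p)

    Agree : ℕ → Set
    Agree m = ∀ ys → length ys ≤ m → Admissible ys → ∀ u → Word n u → F̂ L ys (ι u) ≡ P̂ n ys u

    at-root-left : ∀ x xs u → hops (segment (rem 0) n k) (- x) (F̂ L (x ∷ xs)) u ≡ hops (reversed (rem 0) 0 n) x (F̂ L xs) u
    at-root-left x xs u = trans
      (hops-cong (segment (rem 0) n k) (- x) (λ w → trans (stanley-reverse (rem-nilCoxeter 0) vacuum-relation L x xs w)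
        (trans (cong (λ ρs → hops ρs x (F̂ L xs) w) (reversed-++ (rem 0) 0 n k))
          (cong (λ g → g w) (hops-++ (reversed (rem 0) n k) (reversed (rem 0) 0 n) x (F̂ L xs))))) u)
      (segment-reversed (rem-nilCoxeter 0) n k (- x) x (ℤ.+-inverseˡ x) (hops (reversed (rem 0) 0 n) x (F̂ L xs)) u)

    at-root-right : ∀ x f u → V 0 n (- x) (hops (segment (rem 0) 0 n) x (V 0 n x f)) u ≡ hops (reversed (rem 0) 0 n) x f u
    at-root-right x f u = trans
      (hop-cong exit (- x) (reversed-segment (rem-nilCoxeter 0) 0 n (- x) x (ℤ.+-inverseˡ x) (V 0 n x f)) u)
      (hop-inverse exit exit-square (- x) x (ℤ.+-inverseˡ x) (hops (reversed (rem 0) 0 n) x f) u)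

    -- Both sides are polynomials in q with the same leading term, and they agree
    -- at q = 0 and at q = - x for every x in xs.
    key : ∀ m → Agree m → ∀ xs → length xs ≤ m → Admissible xs → ∀ v c → length v ≡ n → NoClose (v ∷ʳ c) → ∀ q →
      hops (segment (rem 0) n k) q (F̂ L xs) (ι (v ∷ʳ c)) ≡ V 0 n q (P̂ n xs) (v ∷ʳ c)
    key m IH xs lm good v c lv nc q with opens (v ∷ʳ c) ℕ.≤? suc (length xs)
    -- Here `v` alone opens more arcs than there are variables, so every word on the left is too
    -- deep; on the right a vertical strip loses at most one opener, which still leaves too many.
    ... | no many = trans left-zero (sym right-zero)
      where
      u : List Sym
      u = v ∷ʳ c
      opens-v : suc (length xs) ≤ opens v
      opens-v = ℕ.s≤s⁻¹ (ℕ.≤-trans (ℕ.≰⇒> many) (opens-∷ʳ v c))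
        where
        opens-∷ʳ : ∀ v c → opens (v ∷ʳ c) ≤ suc (opens v)
        opens-∷ʳ v op = ℕ.≤-reflexive (opens-∷ʳ-op v)
        opens-∷ʳ v dot = ℕ.≤-trans (ℕ.≤-reflexive (opens-∷ʳ-dot v)) (ℕ.n≤1+n _)
        opens-∷ʳ [] cl = z≤n
        opens-∷ʳ (op ∷ v) cl = s≤s (opens-∷ʳ v cl)
        opens-∷ʳ (cl ∷ v) cl = opens-∷ʳ v cl
        opens-∷ʳ (dot ∷ v) cl = opens-∷ʳ v cl
      prefix-zero : ∀ w t → NoClose w → suc (length xs) ≤ opens w → F̂ L xs (w ++ t) ≡ 0ℤ
      prefix-zero w t cw l = F-deep L xs (w ++ t) (Deep-prefix _ w 0 t
        (ℕ.≤-trans l (ℕ.≤-trans (ℕ.m≤m+n (opens w) 0) (ℕ.≤-reflexive (sym (depths-noClose w 0 cw))))))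
      left-zero : hops (segment (rem 0) n k) q (F̂ L xs) (ι u) ≡ 0ℤ
      left-zero = trans (cong₂ (λ i w → hops (segment (rem 0) i k) q (F̂ L xs) w) (sym lv) (List.++-assoc v (c ∷ []) (closes (opens u))))
        (trans (prefix-segment v 0 k q (F̂ L xs) (c ∷ closes (opens u)))
          (hops-zero (segment (rem (depths v 0)) 0 k) q (λ t → prefix-zero v t (NoClose-init v nc) opens-v) _))
      Q : List Sym → Set
      Q w = Word n w × suc (length xs) ≤ opens w
      reversed-zero : ∀ w → Q w → hops (reversed (rem 0) 0 n) q (P̂ n xs) w ≡ 0ℤ
      reversed-zero w Qw = trans (hops-sim Q (λ w → w)
        (reversed-pointwise 0 0 n (λ i _ w (Ww , o) → proj₁ (Word-sim n i w Ww) ,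
          λ w′ e → proj₂ (Word-sim n i w Ww) w′ e , subst (_ ≤_) (sym (proj₂ (rem-noClose 0 i w (proj₂ Ww) e))) o))
        q (λ w (Ww , o) → trans (sym (IH xs lm good w Ww)) (prefix-zero w _ (proj₂ Ww) o)) w Qw)
        (hops-zero (reversed (rem 0) 0 n) q (λ _ → refl) w)
      Wu : Word n u
      Wu = trans (List.length-++-comm v (c ∷ [])) (cong suc lv) , nc
      right-zero : V 0 n q (P̂ n xs) u ≡ 0ℤ
      right-zero = trans (cong₂ (λ s t → s + q * t) (reversed-zero u (Wu , ℕ.≤-trans (ℕ.n≤1+n _) (ℕ.≰⇒> many)))
        (moved (exit u) refl)) (trans (ℤ.+-identityˡ _) (ℤ.*-zeroʳ q))
        where
        moved : ∀ m′ → exit u ≡ m′ → at (hops (reversed (rem 0) 0 n) q (P̂ n xs)) m′ ≡ 0ℤ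
        moved nothing e = refl
        moved (just w) e = reversed-zero w (proj₂ (exit-sim n u Wu) w e ,
          ℕ.s≤s⁻¹ (ℕ.≤-trans (ℕ.≰⇒> many) (ℕ.≤-reflexive (sym (proj₁ (proj₂ (exit-noClose u nc e)))))))
    -- The lower coefficients number `opens u`, which is at most the number of nodes.
    ... | yes few = trans (e₁ q) (trans (cong₂ (λ s t → s + q ^ opens u * t) (coincide q) top) (sym (e₂ q)))
      where
      u : List Sym
      u = v ∷ʳ c
      Wu : Word n u
      Wu = trans (List.length-++-comm v (c ∷ [])) (cong suc lv) , nc
      Wdot : Word n (dot ∷ v)
      Wdot = cong suc lv , dot (NoClose-init v nc)
      left = F-polynomial xs v c lv nc
      right = V-polynomial v c 0 (P̂ n xs) nc
      cs ds : List ℤ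
      cs = proj₁ left
      ds = proj₁ right
      e₁ : ∀ q → hops (segment (rem 0) n k) q (F̂ L xs) (ι u) ≡ eval cs q + q ^ opens u * F̂ L xs (ι (dot ∷ v))
      e₁ = proj₂ (proj₂ left)
      e₂ : ∀ q → V 0 n q (P̂ n xs) u ≡ eval ds q + q ^ opens u * P̂ n xs (dot ∷ v)
      e₂ q = trans (cong (λ i → V 0 i q (P̂ n xs) u) (sym lv)) (proj₂ (proj₂ right) q)
      top : F̂ L xs (ι (dot ∷ v)) ≡ P̂ n xs (dot ∷ v)
      top = IH xs lm good (dot ∷ v) Wdot
      -- The top terms agree by `top` and cancel, which leaves the lower coefficients to be
      -- compared.
      agree-at : ∀ r → hops (segment (rem 0) n k) r (F̂ L xs) (ι u) ≡ V 0 n r (P̂ n xs) u → eval cs r ≡ eval ds r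
      agree-at r e = ∙-cancelʳ ℤ.+-0-abelianGroup (r ^ opens u * F̂ L xs (ι (dot ∷ v))) (eval cs r) (eval ds r) (trans (sym (e₁ r)) (trans e (trans (e₂ r)
        (cong (λ t → eval ds r + r ^ opens u * t) (sym top)))))
      at-0 : eval cs 0ℤ ≡ eval ds 0ℤ
      at-0 = agree-at 0ℤ (trans (hops-at-zero (segment (rem 0) n k) (F̂ L xs) (ι u))
        (trans (IH xs lm good u Wu) (sym (hops-at-zero (exit ∷ reversed (rem 0) 0 n) (P̂ n xs) u))))
      at-x : ∀ {x} → x ∈ xs → eval cs (- x) ≡ eval ds (- x)
      at-x {x} p = agree-at (- x) (begin
        hops (segment (rem 0) n k) (- x) (F̂ L xs) (ι u) ≡⟨ hops-cong (segment (rem 0) n k) (- x) (F-front p) (ι u) ⟩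
        hops (segment (rem 0) n k) (- x) (F̂ L (x ∷ xs′)) (ι u) ≡⟨ at-root-left x xs′ (ι u) ⟩
        hops (reversed (rem 0) 0 n) x (F̂ L xs′) (ι u)
          ≡⟨ reversed-ι n x (λ w Ww → IH xs′ (ℕ.≤-trans (ℕ.n≤1+n _) lm′) (tail (─-good p good)) w Ww) u Wu ⟩
        hops (reversed (rem 0) 0 n) x (P̂ n xs′) u ≡⟨ at-root-right x (P̂ n xs′) u ⟨
        V 0 n (- x) (P̂ n (x ∷ xs′)) u
          -- That `P̂` allows `x` to be brought to the front is read off from `F̂` through the
          -- induction hypothesis.
          ≡⟨ V-on n (- x) (λ w Ww → trans (sym (IH (x ∷ xs′) lm′ (─-good p good) w Ww))
               (trans (sym (F-front p (ι w))) (IH xs lm good w Ww))) u Wu ⟩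
        V 0 n (- x) (P̂ n xs) u ∎)
        where
        open ≡-Reasoning
        xs′ : List ℤ
        xs′ = xs ─ p
        lm′ : suc (length xs′) ≤ m
        lm′ = subst (_≤ m) (sym (─-length p)) lm
        tail : ∀ {y ys} → Admissible (y ∷ ys) → Admissible ys
        tail (_ ∷ us , _ ∷ ps) = us , ps
      coincide : ∀ q → eval cs q ≡ eval ds q
      coincide = agree-on-roots cs ds (0ℤ ∷ List.map -_ xs)
        (All.map⁺ (All.map (λ 0<x e → ℤ.<⇒≢ 0<x (ℤ.neg-injective e)) (proj₂ good))
          ∷ Unique.map⁺ ℤ.neg-injective (proj₁ good))
        (trans (proj₁ (proj₂ left)) (sym (proj₁ (proj₂ right))))
        (subst₂ _≤_ (sym (proj₁ (proj₂ left))) (cong suc (sym (List.length-map -_ xs))) few)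
        (at-0 ∷ All.map⁺ (All.tabulate at-x))

    -- A bound on the number of variables, rather than the list itself, drives the induction,
    -- because `key` needs the claim for rearranged and shortened lists.
    F≡P : ∀ m → Agree m
    F≡P m [] l good u Wu = vacuum-ι u (proj₂ Wu)
      where
      vacuum-ι : ∀ u → NoClose u → vacuum (ι u) ≡ vacuum u
      vacuum-ι [] [] = refl
      vacuum-ι (op ∷ u) _ = refl
      vacuum-ι (dot ∷ u) (dot c) = vacuum-ι u c
    F≡P (suc m) (x ∷ xs) (s≤s l) (_ ∷ uq , _ ∷ pos) u Wu = begin
      hops (segment (rem 0) 0 L) x (F̂ L xs) (ι u)
        ≡⟨ cong (λ ρs → hops ρs x (F̂ L xs) (ι u)) (segment-++ (rem 0) 0 n k) ⟩
      hops (segment (rem 0) 0 n ++ segment (rem 0) n k) x (F̂ L xs) (ι u)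
        ≡⟨ cong (λ g → g (ι u)) (hops-++ (segment (rem 0) 0 n) (segment (rem 0) n k) x (F̂ L xs)) ⟩
      hops (segment (rem 0) 0 n) x (hops (segment (rem 0) n k) x (F̂ L xs)) (ι u)
        ≡⟨ segment-ι n x last u Wu ⟩
      hops (segment (rem 0) 0 n) x (V 0 n x (P̂ n xs)) u ∎
      where
      open ≡-Reasoning
      last : ∀ w → Word n w → hops (segment (rem 0) n k) x (F̂ L xs) (ι w) ≡ V 0 n x (P̂ n xs) w
      last w Ww with List.initLast w
      last .[] () | []
      last .(v ∷ʳ c) (lw , cw) | v List.∷ʳ′ c = key m (F≡P m) xs l (uq , pos) v c
        (ℕ.suc-injective (trans (sym (List.length-++-comm v (c ∷ []))) lw)) cw x

-- From values to coefficients, and from coefficients to counts.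

module Coefficients where

  open import Data.Nat using (_≤_)
  open import Data.Integer using (_+_; _*_; -_)
  open Moves
  open NilCoxeterMoves
  open ArcWords
  open ArcWordProperties
  open Polynomials
  open HorizontalAndVertical
  open Evaluations

  tab : ℕ → (ℕ → ℤ) → List ℤ
  tab zero g = []
  tab (suc K) g = g 0 ∷ tab K (λ e → g (suc e))

  -- The coefficient of q^e in `hops ρs q f w`, as `hops-coef` confirms.
  coef : {X : Set} → List (Move X) → ℕ → (X → ℤ) → X → ℤ
  coef [] zero f w = f w
  coef [] (suc e) f w = 0ℤ
  coef (ρ ∷ ρs) zero f w = coef ρs zero f w
  coef (ρ ∷ ρs) (suc e) f w = coef ρs (suc e) f w + at (coef ρs e f) (ρ w)

  eval-tab-cong : ∀ K {g h : ℕ → ℤ} → g ≗ h → ∀ x → eval (tab K g) x ≡ eval (tab K h) x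
  eval-tab-cong zero e x = refl
  eval-tab-cong (suc K) e x = cong₂ (λ a b → a + x * b) (e 0) (eval-tab-cong K (λ i → e (suc i)) x)

  eval-tab-zero : ∀ K x → eval (tab K (λ _ → 0ℤ)) x ≡ 0ℤ
  eval-tab-zero zero x = refl
  eval-tab-zero (suc K) x = trans (cong (λ b → 0ℤ + x * b) (eval-tab-zero K x)) (trans (ℤ.+-identityˡ _) (ℤ.*-zeroʳ x))

  eval-tab-linear : ∀ K c (g h : ℕ → ℤ) x → eval (tab K (λ e → g e + c * h e)) x ≡ eval (tab K g) x + c * eval (tab K h) x
  eval-tab-linear zero c g h x = sym (trans (ℤ.+-identityˡ _) (ℤ.*-zeroʳ c))
  eval-tab-linear (suc K) c g h x = trans
    (cong (λ b → g 0 + c * h 0 + x * b) (eval-tab-linear K c (λ e → g (suc e)) (λ e → h (suc e)) x))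
    (rng (g 0) (h 0) c x (eval (tab K (λ e → g (suc e))) x) (eval (tab K (λ e → h (suc e))) x))
    where
    rng : ∀ a b c x s t → a + c * b + x * (s + c * t) ≡ a + x * s + c * (b + x * t)
    rng = solve-∀

  hops-coef : {X : Set} (ρs : List (Move X)) → ∀ K → suc (length ρs) ≤ K → (x : ℤ) (f : X → ℤ) (w : X) →
    hops ρs x f w ≡ eval (tab K (λ e → coef ρs e f w)) x
  hops-coef [] (suc K) l x f w = sym (trans (cong (λ b → f w + x * b) (eval-tab-zero K x))
    (trans (cong (λ z → f w + z) (ℤ.*-zeroʳ x)) (ℤ.+-identityʳ (f w))))
  hops-coef (ρ ∷ ρs) (suc K) (s≤s l) x f w = begin
    hops ρs x f w + x * at (hops ρs x f) (ρ w)
      ≡⟨ cong₂ (λ a b → a + x * b) (hops-coef ρs (suc K) (ℕ.m≤n⇒m≤1+n l) x f w) (at-coef (ρ w)) ⟩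
    (coef ρs 0 f w + x * eval (tab K (λ e → coef ρs (suc e) f w)) x) + x * eval (tab K (λ e → at (coef ρs e f) (ρ w))) x
      ≡⟨ rng (coef ρs 0 f w) x (eval (tab K (λ e → coef ρs (suc e) f w)) x) (eval (tab K (λ e → at (coef ρs e f) (ρ w))) x) ⟩
    coef ρs 0 f w + x * (eval (tab K (λ e → coef ρs (suc e) f w)) x + 1ℤ * eval (tab K (λ e → at (coef ρs e f) (ρ w))) x)
      ≡⟨ cong (λ b → coef ρs 0 f w + x * b) (eval-tab-linear K 1ℤ (λ e → coef ρs (suc e) f w) (λ e → at (coef ρs e f) (ρ w)) x) ⟨
    coef ρs 0 f w + x * eval (tab K (λ e → coef ρs (suc e) f w + 1ℤ * at (coef ρs e f) (ρ w))) x
      ≡⟨ cong (λ b → coef ρs 0 f w + x * b) (eval-tab-cong K (λ e → cong (λ z → coef ρs (suc e) f w + z) (ℤ.*-identityˡ _)) x) ⟩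
    coef ρs 0 f w + x * eval (tab K (λ e → coef ρs (suc e) f w + at (coef ρs e f) (ρ w))) x ∎
    where
    open ≡-Reasoning
    at-coef : ∀ m → at (hops ρs x f) m ≡ eval (tab K (λ e → at (coef ρs e f) m)) x
    at-coef nothing = sym (eval-tab-zero K x)
    at-coef (just v) = hops-coef ρs K l x f v
    rng : ∀ a x b c → (a + x * b) + x * c ≡ a + x * (b + 1ℤ * c)
    rng = solve-∀

  coef-linear : {X : Set} (ρs : List (Move X)) (e : ℕ) (c : ℤ) (f g : X → ℤ) (w : X) →
    coef ρs e (λ v → f v + c * g v) w ≡ coef ρs e f w + c * coef ρs e g w
  coef-linear [] zero c f g w = refl
  coef-linear [] (suc e) c f g w = sym (trans (ℤ.+-identityˡ _) (ℤ.*-zeroʳ c))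
  coef-linear (ρ ∷ ρs) zero c f g w = coef-linear ρs zero c f g w
  coef-linear (ρ ∷ ρs) (suc e) c f g w = trans (cong₂ _+_ (coef-linear ρs (suc e) c f g w) (at-linear (ρ w)))
    (rng (coef ρs (suc e) f w) c (coef ρs (suc e) g w) (at (coef ρs e f) (ρ w)) (at (coef ρs e g) (ρ w)))
    where
    at-linear : ∀ m → at (coef ρs e (λ v → f v + c * g v)) m ≡ at (coef ρs e f) m + c * at (coef ρs e g) m
    at-linear nothing = sym (trans (ℤ.+-identityˡ _) (ℤ.*-zeroʳ c))
    at-linear (just v) = coef-linear ρs e c f g v
    rng : ∀ a c b a′ b′ → (a + c * b) + (a′ + c * b′) ≡ (a + a′) + c * (b + b′)
    rng = solve-∀

  coef-cong : {X : Set} (ρs : List (Move X)) (e : ℕ) {f g : X → ℤ} → f ≗ g → coef ρs e f ≗ coef ρs e g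
  coef-cong [] zero h w = h w
  coef-cong [] (suc e) h w = refl
  coef-cong (ρ ∷ ρs) zero h w = coef-cong ρs zero h w
  coef-cong (ρ ∷ ρs) (suc e) h w = cong₂ _+_ (coef-cong ρs (suc e) h w) (at-cong (coef-cong ρs e h) (ρ w))

  -- `Φ` stands for evaluation at a word after extracting the coefficients of the outer variables;
  -- linearity lets it pass inside a polynomial in the next variable.
  record Linear {X : Set} (Φ : (X → ℤ) → ℤ) : Set where
    field
      respects : ∀ {f g} → f ≗ g → Φ f ≡ Φ g
      linear : ∀ c f g → Φ (λ v → f v + c * g v) ≡ Φ f + c * Φ g

  module _ {X : Set} {Φ : (X → ℤ) → ℤ} (lin : Linear Φ) where
    open Linear lin

    linear-zero : Φ (λ _ → 0ℤ) ≡ 0ℤ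
    linear-zero = trans (linear (- 1ℤ) (λ _ → 0ℤ) (λ _ → 0ℤ)) (rng (Φ (λ _ → 0ℤ)))
      where
      rng : ∀ a → a + (- 1ℤ) * a ≡ 0ℤ
      rng = solve-∀

    linear-eval : ∀ K (g : ℕ → X → ℤ) x → Φ (λ w → eval (tab K (λ e → g e w)) x) ≡ eval (tab K (λ e → Φ (g e))) x
    linear-eval zero g x = linear-zero
    linear-eval (suc K) g x = trans (linear x (g 0) (λ w → eval (tab K (λ e → g (suc e) w)) x))
      (cong (λ z → Φ (g 0) + x * z) (linear-eval K (λ e → g (suc e)) x))

    linear-hops : ∀ ρs K → suc (length ρs) ≤ K → ∀ x f → Φ (hops ρs x f) ≡ eval (tab K (λ e → Φ (coef ρs e f))) x
    linear-hops ρs K l x f = trans (respects (hops-coef ρs K l x f)) (linear-eval K (λ e → coef ρs e f) x)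

    linear-coef : ∀ ρs e → Linear (λ f → Φ (coef ρs e f))
    linear-coef ρs e = record
      { respects = λ h → respects (coef-cong ρs e h)
      ; linear = λ c f g → trans (respects (coef-linear ρs e c f g)) (linear c (coef ρs e f) (coef ρs e g)) }

  iterate-hops : {X : Set} → List (Move X) → (X → ℤ) → List ℤ → X → ℤ
  iterate-hops ρs f [] = f
  iterate-hops ρs f (x ∷ xs) = hops ρs x (iterate-hops ρs f xs)

  iterate-coef : {X : Set} → List (Move X) → (X → ℤ) → List ℕ → X → ℤ
  iterate-coef ρs f [] = f
  iterate-coef ρs f (e ∷ es) = coef ρs e (iterate-coef ρs f es)

  fresh : ∀ xs → Admissible xs → Σ ℕ λ b → ∀ x → + b ℤ.≤ x → Admissible (x ∷ xs)
  fresh xs (u , p) = let b , h = bound xs in suc b , λ x l →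
    (All.map (λ l′ e → ℤ.<⇒≢ (ℤ.≤-<-trans l′ (ℤ.<-≤-trans (ℤ.+<+ (ℕ.n<1+n b)) l)) (sym e)) h ∷ u) , (ℤ.<-≤-trans (ℤ.+<+ (s≤s z≤n)) l ∷ p)
    where
    bound : ∀ xs → Σ ℕ λ b → All (ℤ._≤ + b) xs
    bound [] = 0 , []
    bound (x ∷ xs) = let b , h = bound xs in ℤ.∣ x ∣ ℕ.+ b ,
      (ℤ.≤-trans (≤abs x) (ℤ.+≤+ (ℕ.m≤m+n _ b)) ∷ All.map (λ l → ℤ.≤-trans l (ℤ.+≤+ (ℕ.m≤n+m b _))) h)
      where
      ≤abs : ∀ x → x ℤ.≤ + ℤ.∣ x ∣
      ≤abs (+ n) = ℤ.≤-refl
      ≤abs (ℤ.-[1+ n ]) = ℤ.-≤+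

  tab-lookup : ∀ {R : ℤ → Set} K g → All R (tab K g) → ∀ e → e ℕ.< K → R (g e)
  tab-lookup (suc K) g (r ∷ rs) zero l = r
  tab-lookup (suc K) g (r ∷ rs) (suc e) (s≤s l) = tab-lookup K (λ i → g (suc i)) rs e l

  -- Variables are stripped from the outside. With the inner values `xs` fixed, both sides are
  -- polynomials in the next variable that agree at all large integers, so their coefficients agree;
  -- composing `Φ` and `Ψ` with the coefficient at `e` gives linear functionals for the inner
  -- variables.
  same-coefficients : {X Y : Set} (ρs : List (Move X)) (σs : List (Move Y)) (f : X → ℤ) (g : Y → ℤ) → ∀ es
    {Φ : (X → ℤ) → ℤ} {Ψ : (Y → ℤ) → ℤ} → Linear Φ → Linear Ψ →
    (∀ xs → length xs ≡ length es → Admissible xs → Φ (iterate-hops ρs f xs) ≡ Ψ (iterate-hops σs g xs)) →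
    Φ (iterate-coef ρs f es) ≡ Ψ (iterate-coef σs g es)
  same-coefficients ρs σs f g [] lΦ lΨ h = h [] refl ([] , [])
  same-coefficients ρs σs f g (e ∷ es) {Φ} {Ψ} lΦ lΨ h =
    same-coefficients ρs σs f g es (linear-coef lΦ ρs e) (linear-coef lΨ σs e) extract
    where
    K : ℕ
    -- Large enough for both degrees and for the exponent `e` itself to lie within the tables.
    K = suc (length ρs ℕ.+ length σs ℕ.+ e)
    extract : ∀ xs → length xs ≡ length es → Admissible xs →
      Φ (coef ρs e (iterate-hops ρs f xs)) ≡ Ψ (coef σs e (iterate-hops σs g xs))
    extract xs l adm = let b , fr = fresh xs adm in
      ℤ.i-j≡0⇒i≡j (a e) (c e) (trans (cong (λ z → a e + z) (neg (c e)))
        (tab-lookup K (λ i → a i + (- 1ℤ) * c i) (coefficients-zero b (tab K (λ i → a i + (- 1ℤ) * c i)) (λ x le → begin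
          eval (tab K (λ i → a i + (- 1ℤ) * c i)) x ≡⟨ eval-tab-linear K (- 1ℤ) a c x ⟩
          eval (tab K a) x + (- 1ℤ) * eval (tab K c) x
            ≡⟨ cong₂ (λ s t → s + (- 1ℤ) * t) (sym (linear-hops lΦ ρs K Kρ x (iterate-hops ρs f xs))) (sym (linear-hops lΨ σs K Kσ x (iterate-hops σs g xs))) ⟩
          Φ (iterate-hops ρs f (x ∷ xs)) + (- 1ℤ) * Ψ (iterate-hops σs g (x ∷ xs))
            ≡⟨ cong (λ s → s + (- 1ℤ) * Ψ (iterate-hops σs g (x ∷ xs))) (h (x ∷ xs) (cong suc l) (fr x le)) ⟩
          Ψ (iterate-hops σs g (x ∷ xs)) + (- 1ℤ) * Ψ (iterate-hops σs g (x ∷ xs)) ≡⟨ rng (Ψ (iterate-hops σs g (x ∷ xs))) ⟩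
          0ℤ ∎)) e (s≤s (ℕ.m≤n+m e _))))
      where
      open ≡-Reasoning
      a c : ℕ → ℤ
      a i = Φ (coef ρs i (iterate-hops ρs f xs))
      c i = Ψ (coef σs i (iterate-hops σs g xs))
      Kρ : suc (length ρs) ≤ K
      Kρ = s≤s (ℕ.≤-trans (ℕ.m≤m+n _ _) (ℕ.m≤m+n _ e))
      Kσ : suc (length σs) ≤ K
      Kσ = s≤s (ℕ.≤-trans (ℕ.m≤n+m _ (length ρs)) (ℕ.m≤m+n _ e))
      rng : ∀ a → a + (- 1ℤ) * a ≡ 0ℤ
      rng = solve-∀
      neg : ∀ a → - a ≡ (- 1ℤ) * a
      neg = solve-∀

  atℕ : {X : Set} → (X → ℕ) → Maybe X → ℕ
  atℕ f nothing = 0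
  atℕ f (just x) = f x

  -- The recursion of `coef` in natural numbers, to be matched with sizes of finite sets.
  count : {X : Set} → List (Move X) → ℕ → (X → ℕ) → X → ℕ
  count [] zero f w = f w
  count [] (suc e) f w = 0
  count (ρ ∷ ρs) zero f w = count ρs zero f w
  count (ρ ∷ ρs) (suc e) f w = count ρs (suc e) f w ℕ.+ atℕ (count ρs e f) (ρ w)

  iterate-count : {X : Set} → List (Move X) → (X → ℕ) → List ℕ → X → ℕ
  iterate-count ρs f [] = f
  iterate-count ρs f (e ∷ es) = count ρs e (iterate-count ρs f es)

  coef-count : {X : Set} (ρs : List (Move X)) (e : ℕ) {f : X → ℤ} {g : X → ℕ} → (∀ w → f w ≡ + g w) →
    ∀ w → coef ρs e f w ≡ + count ρs e g w
  coef-count [] zero h w = h w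
  coef-count [] (suc e) h w = refl
  coef-count (ρ ∷ ρs) zero h w = coef-count ρs zero h w
  coef-count (ρ ∷ ρs) (suc e) {f} {g} h w = cong₂ _+_ (coef-count ρs (suc e) h w) (lem (ρ w))
    where
    lem : ∀ m → at (coef ρs e f) m ≡ + atℕ (count ρs e g) m
    lem nothing = refl
    lem (just v) = coef-count ρs e h v

  iterate-coef-count : {X : Set} (ρs : List (Move X)) {f : X → ℤ} {g : X → ℕ} → (∀ w → f w ≡ + g w) →
    ∀ es w → iterate-coef ρs f es w ≡ + iterate-count ρs g es w
  iterate-coef-count ρs h [] w = h w
  iterate-coef-count ρs h (e ∷ es) w = coef-count ρs e (iterate-coef-count ρs h es) w

  blank : List Sym → ℕ
  blank [] = 1
  blank (dot ∷ w) = blank w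
  blank (op ∷ w) = 0
  blank (cl ∷ w) = 0

  vacuum-blank : ∀ w → vacuum w ≡ + blank w
  vacuum-blank [] = refl
  vacuum-blank (dot ∷ w) = vacuum-blank w
  vacuum-blank (op ∷ w) = refl
  vacuum-blank (cl ∷ w) = refl

  unprimed-moves primed-moves : ℕ → List (Move (List Sym))
  unprimed-moves n = segment (rem 0) 0 n ++ exit ∷ []
  primed-moves n = reversed (rem 0) 0 n

  equinumerous : ∀ n u → Word n u → ∀ es →
    iterate-count (segment (rem 0) 0 (L n)) blank es (ι u) ≡ iterate-count (unprimed-moves n ++ primed-moves n) blank es u
  equinumerous n u Wu es = ℤ.+-injective (trans (sym (iterate-coef-count ρs vacuum-blank es (ι u)))
    (trans (same-coefficients ρs σs vacuum vacuum es {λ f → f (ι u)} {λ f → f u} (evaluation (ι u)) (evaluation u)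
      (λ xs l adm → trans (sym (F-iterate xs (ι u))) (trans (F≡P n (length xs) xs ℕ.≤-refl adm u Wu) (P-iterate xs u))))
    (iterate-coef-count σs vacuum-blank es u)))
    where
    ρs σs : List (Move (List Sym))
    ρs = segment (rem 0) 0 (L n)
    σs = unprimed-moves n ++ primed-moves n
    evaluation : ∀ (w : List Sym) → Linear (λ f → f w)
    evaluation w = record { respects = λ h → h w ; linear = λ c f g → refl }
    F-iterate : ∀ xs → F̂ (L n) xs ≗ iterate-hops ρs vacuum xs
    F-iterate [] w = refl
    F-iterate (x ∷ xs) w = hops-cong ρs x (F-iterate xs) w
    P-iterate : ∀ xs → P̂ n xs ≗ iterate-hops σs vacuum xs
    P-iterate [] w = refl
    P-iterate (x ∷ xs) w = trans (hops-cong (segment (rem 0) 0 n) x (hops-cong (exit ∷ primed-moves n) x (P-iterate xs)) w)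
      (trans (cong (λ g → g w) (sym (hops-++ (segment (rem 0) 0 n) (exit ∷ primed-moves n) x (iterate-hops σs vacuum xs))))
        (cong (λ τs → hops τs x (iterate-hops σs vacuum xs) w) (sym (List.++-assoc (segment (rem 0) 0 n) (exit ∷ []) (primed-moves n)))))

-- Sizes of predicates and their splitting.

module Cardinalities where

  _⇔_ : {A : Set} → (A → Set) → (A → Set) → Set
  P ⇔ Q = ∀ x → (P x → Q x) × (Q x → P x)

  HasSize-⇔ : {A : Set} {P Q : A → Set} → P ⇔ Q → ∀ {N} → HasSize P N → HasSize Q N
  HasSize-⇔ e (L , u , m , l) = L , u ,
    (λ x → (λ i → proj₁ (e x) (proj₁ (m x) i)) , λ q → proj₂ (m x) (proj₂ (e x) q)) , l

  HasSize-resize : {A : Set} {P : A → Set} → ∀ {M N} → M ≡ N → HasSize P M → HasSize P N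
  HasSize-resize refl h = h

  HasSize-empty : {A : Set} {P : A → Set} → (∀ x → ¬ P x) → HasSize P 0
  HasSize-empty n = [] , [] , (λ x → (λ ()) , λ p → ⊥-elim (n x p)) , refl

  HasSize-singleton : {A : Set} {P : A → Set} (a : A) → P a → (∀ x → P x → x ≡ a) → HasSize P 1
  HasSize-singleton a Pa h = a ∷ [] , [] ∷ [] , (λ x → (λ { (here refl) → Pa }) , λ p → here (h x p)) , refl

  -- The form of one step of `count`: `P₁` collects the objects for which a letter is skipped, the
  -- image of `P₂` those for which it is used.
  record Split {A B : Set} (P P₁ : A → Set) (P₂ : B → Set) (g : B → A) : Set where
    field
      cases : ∀ x → P x → P₁ x ⊎ Σ B λ y → P₂ y × x ≡ g y
      left : ∀ x → P₁ x → P x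
      right : ∀ y → P₂ y → P (g y)
      disjoint : ∀ y → P₂ y → ¬ P₁ (g y)
      injective : ∀ y y′ → P₂ y → P₂ y′ → g y ≡ g y′ → y ≡ y′

  map-unique : {A B : Set} (g : B → A) (L : List B) → Unique L →
    (∀ y y′ → y ∈ L → y′ ∈ L → g y ≡ g y′ → y ≡ y′) → Unique (List.map g L)
  map-unique g [] [] inj = []
  map-unique g (y ∷ L) (y∉ ∷ u) inj =
    All.map⁺ (All.tabulate λ {z} z∈ e → All.lookup y∉ z∈ (inj y z (here refl) (there z∈) e)) ∷
    map-unique g L u (λ a b a∈ b∈ → inj a b (there a∈) (there b∈))

  HasSize-split : {A B : Set} {P P₁ : A → Set} {P₂ : B → Set} {g : B → A} → Split P P₁ P₂ g →
    ∀ {M N} → HasSize P₁ M → HasSize P₂ N → HasSize P (M ℕ.+ N)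
  HasSize-split {P = P} {g = g} s (L₁ , u₁ , m₁ , refl) (L₂ , u₂ , m₂ , refl) =
    L₁ ++ List.map g L₂ ,
    AllPairs.++⁺ u₁ (map-unique g L₂ u₂ λ y y′ i i′ → injective y y′ (proj₁ (m₂ y) i) (proj₁ (m₂ y′) i′))
      (All.tabulate λ {x} x∈ → All.map⁺ (All.tabulate λ {y} y∈ e →
        disjoint y (proj₁ (m₂ y) y∈) (subst _ e (proj₁ (m₁ x) x∈)))) ,
    (λ x → sound x , complete x) ,
    trans (List.length-++ L₁) (cong (length L₁ ℕ.+_) (List.length-map g L₂))
    where
    open Split s
    sound : ∀ x → x ∈ L₁ ++ List.map g L₂ → P x
    sound x i with ∈.∈-++⁻ L₁ i
    ... | inj₁ i₁ = left x (proj₁ (m₁ x) i₁)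
    ... | inj₂ i₂ with ∈.∈-map⁻ g i₂
    ... | y , y∈ , refl = right y (proj₁ (m₂ y) y∈)
    complete : ∀ x → P x → x ∈ L₁ ++ List.map g L₂
    complete x p with cases x p
    ... | inj₁ p₁ = ∈.∈-++⁺ˡ (proj₂ (m₁ x) p₁)
    ... | inj₂ (y , p₂ , refl) = ∈.∈-++⁺ʳ L₁ (∈.∈-map⁺ g (proj₂ (m₂ y) p₂))

  HasSize-image : {A B : Set} {P : A → Set} {Q : B → Set} (g : B → A) →
    (∀ x → P x → Σ B λ y → Q y × x ≡ g y) → (∀ y → Q y → P (g y)) →
    (∀ y y′ → Q y → Q y′ → g y ≡ g y′ → y ≡ y′) → ∀ {N} → HasSize Q N → HasSize P N
  HasSize-image g c r i h = HasSize-split (record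
    { cases = λ x p → inj₂ (c x p) ; left = λ x → λ () ; right = r ; disjoint = λ _ _ () ; injective = i })
    (HasSize-empty {P = λ _ → ⊥} (λ _ ())) h

-- Removing boxes from shifted tableaux.

module BoxRemoval where

  open import Data.Nat using (_≤_; _<_)
  open ArcWords
  open ArcWordProperties
  open HorizontalAndVertical
  open Evaluations
  open Coefficients
  open Cardinalities

  RowStep ColStep : ℕ → ℕ → Set
  RowStep c c′ = c ≤ c′ × (Primed c → c < c′)
  ColStep c c′ = c ≤ c′ × (Unprimed c → c < c′)

  Increasing : List ℕ → Set
  Increasing [] = ⊤
  Increasing (a ∷ []) = ⊤
  Increasing (a ∷ b ∷ R) = RowStep a b × Increasing (b ∷ R)

  HeadUnprimed : List ℕ → Set
  HeadUnprimed [] = ⊤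
  HeadUnprimed (a ∷ R) = Unprimed a

  Columns : List ℕ → List ℕ → Set
  Columns (a ∷ as) (b ∷ bs) = ColStep a b × Columns as bs
  Columns _ _ = ⊤

  record Row (b len : ℕ) (R : List ℕ) : Set where
    constructor row
    field
      row-length : length R ≡ len
      positive : All (1 ≤_) R
      increasing : Increasing R
      headUnprimed : HeadUnprimed R
      bounded : All (_≤ b) R

  Below : List ℕ → List (List ℕ) → Set
  Below R [] = ⊤
  Below R (R′ ∷ _) = Columns (drop 1 R) R′

  -- The word is the shape: an opener with `length w` sites after it is a row with one box more. The
  -- bound on the entries depends on the site, so that partly processed tableaux can be described.
  Tab : (ℕ → ℕ) → List Sym → List (List ℕ) → Set
  Tab b [] T = T ≡ []
  Tab b (dot ∷ w) T = Tab (λ s → b (suc s)) w T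
  Tab b (cl ∷ w) T = ⊥
  Tab b (op ∷ w) [] = ⊥
  Tab b (op ∷ w) (R ∷ T) = Row (b 0) (suc (length w)) R × Below R T × Tab (λ s → b (suc s)) w T

  Row-mono : ∀ {b b′ len R} → b ≤ b′ → Row b len R → Row b′ len R
  Row-mono l (row a p i h q) = row a p i h (All.map (λ m → ℕ.≤-trans m l) q)

  Tab-mono : ∀ {b b′} w → (∀ s → s < length w → b s ≤ b′ s) → ∀ T → Tab b w T → Tab b′ w T
  Tab-mono [] h T t = t
  Tab-mono (dot ∷ w) h T t = Tab-mono w (λ s l → h (suc s) (s≤s l)) T t
  Tab-mono (op ∷ w) h (R ∷ T) (r , c , t) = Row-mono (h 0 (s≤s z≤n)) r , c , Tab-mono w (λ s l → h (suc s) (s≤s l)) T t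

  Tab-cong : ∀ {b b′} w → (∀ s → s < length w → b s ≡ b′ s) → Tab b w ⇔ Tab b′ w
  Tab-cong w h T = Tab-mono w (λ s l → ℕ.≤-reflexive (h s l)) T , Tab-mono w (λ s l → ℕ.≤-reflexive (sym (h s l))) T

  Tab-length : ∀ {b} w T → Tab b w T → length T ≡ opens w
  Tab-length [] T refl = refl
  Tab-length (dot ∷ w) T t = Tab-length w T t
  Tab-length (op ∷ w) (R ∷ T) (_ , _ , t) = cong suc (Tab-length w T t)

  Tab-head : ∀ {b} w R T → Tab b w (R ∷ T) → length R ≤ length w
  Tab-head (dot ∷ w) R T t = ℕ.m≤n⇒m≤1+n (Tab-head w R T t)
  Tab-head (op ∷ w) R T (r , _) = ℕ.≤-reflexive (Row.row-length r)

  increasing-∷ʳ⁻ : ∀ R {z} → Increasing (R ∷ʳ z) → Increasing R × All (λ a → RowStep a z) R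
  increasing-∷ʳ⁻ [] i = tt , []
  increasing-∷ʳ⁻ (a ∷ []) (s , _) = tt , (s ∷ [])
  increasing-∷ʳ⁻ (a ∷ b ∷ R) (s , i) with increasing-∷ʳ⁻ (b ∷ R) i
  ... | i′ , (sb ∷ q) = (s , i′) ,
    (ℕ.≤-trans (proj₁ s) (proj₁ sb) , (λ p → ℕ.<-≤-trans (proj₂ s p) (proj₁ sb))) ∷ sb ∷ q

  increasing-∷ʳ⁺ : ∀ R {z} → Increasing R → All (λ a → RowStep a z) R → Increasing (R ∷ʳ z)
  increasing-∷ʳ⁺ [] i q = tt
  increasing-∷ʳ⁺ (a ∷ []) i (s ∷ _) = s , tt
  increasing-∷ʳ⁺ (a ∷ b ∷ R) (s , i) (_ ∷ q) = s , increasing-∷ʳ⁺ (b ∷ R) i q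

  columns-[] : ∀ as → Columns as []
  columns-[] [] = tt
  columns-[] (a ∷ as) = tt

  columns-bottom⁺ : ∀ as bs {c} → All (λ a → ColStep a c) as → Columns as bs → Columns as (bs ∷ʳ c)
  columns-bottom⁺ [] bs q k = tt
  columns-bottom⁺ (a ∷ as) [] (s ∷ q) k = s , columns-[] as
  columns-bottom⁺ (a ∷ as) (b ∷ bs) (_ ∷ q) (s , k) = s , columns-bottom⁺ as bs q k

  columns-bottom⁻ : ∀ as bs {c} → Columns as (bs ∷ʳ c) → Columns as bs
  columns-bottom⁻ [] bs k = tt
  columns-bottom⁻ (a ∷ as) [] k = tt
  columns-bottom⁻ (a ∷ as) (b ∷ bs) (s , k) = s , columns-bottom⁻ as bs k

  columns-top⁺ : ∀ as bs {c} → length bs ≤ length as → Columns as bs → Columns (as ∷ʳ c) bs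
  columns-top⁺ [] [] l k = tt
  columns-top⁺ (a ∷ as) [] l k = tt
  columns-top⁺ (a ∷ as) (b ∷ bs) (s≤s l) (s , k) = s , columns-top⁺ as bs l k

  columns-top⁻ : ∀ as bs {c} → Columns (as ∷ʳ c) bs → Columns as bs
  columns-top⁻ [] bs k = tt
  columns-top⁻ (a ∷ as) [] k = tt
  columns-top⁻ (a ∷ as) (b ∷ bs) (s , k) = s , columns-top⁻ as bs k

  -- The bounds while the row that starts at site `i` is being processed.
  stage : ℕ → ℕ → ℕ → ℕ → ℕ → ℕ
  stage x z y zero zero = z
  stage x z y zero (suc s) = y
  stage x z y (suc i) zero = x
  stage x z y (suc i) (suc s) = stage x z y i s

  snocRow : ℕ → ℕ → List (List ℕ) → List (List ℕ)
  snocRow k c [] = []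
  snocRow zero c (R ∷ T) = (R ∷ʳ c) ∷ T
  snocRow (suc k) c (R ∷ T) = R ∷ snocRow k c T

  snocRow-injective : ∀ k c T T′ → snocRow k c T ≡ snocRow k c T′ → T ≡ T′
  snocRow-injective k c [] [] e = refl
  snocRow-injective zero c [] (_ ∷ _) ()
  snocRow-injective (suc k) c [] (_ ∷ _) ()
  snocRow-injective zero c (_ ∷ _) [] ()
  snocRow-injective (suc k) c (_ ∷ _) [] ()
  snocRow-injective zero c (R ∷ T) (R′ ∷ T′) e =
    cong₂ _∷_ (proj₁ (List.∷ʳ-injective R R′ (List.∷-injectiveˡ e))) (List.∷-injectiveʳ e)
  snocRow-injective (suc k) c (R ∷ T) (R′ ∷ T′) e =
    cong₂ _∷_ (List.∷-injectiveˡ e) (snocRow-injective k c T T′ (List.∷-injectiveʳ e))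

  -- Removing the entries equal to suc c′ one box at a time.  Rows above the box are bounded by x,
  -- rows below it by y; x = c′ and y = suc c′ if suc c′ is unprimed, and conversely if it is primed.
  record Phase (c′ x y : ℕ) : Set where
    field
      rowStep : ∀ a → a ≤ y → RowStep a (suc c′)
      rowStep⁻ : ∀ a → RowStep a (suc c′) → a ≤ y
      colStep : ∀ a → a ≤ x → ColStep a (suc c′)
      colStep⁻ : ∀ a b → ColStep a b → b ≤ y → a ≤ c′

  -- Where the move is undefined, no row at site `i` can end in `suc c′`, so its bound drops at no
  -- cost; where it is defined, the last box of that row goes precisely when it holds `suc c′`.
  Outcome : (c′ x y i : ℕ) → List Sym → Maybe (List Sym) → (List (List ℕ) → List (List ℕ)) → Set
  Outcome c′ x y i w nothing g = Tab (stage x (suc c′) y i) w ⇔ Tab (stage x c′ y i) w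
  Outcome c′ x y i w (just w′) g =
    Split (Tab (stage x (suc c′) y i) w) (Tab (stage x c′ y i) w) (Tab (stage x c′ y i) w′) g

  module _ {c′ x y : ℕ} (ph : Phase c′ x y) where
    open Phase ph
    private
      C : ℕ
      C = suc c′

    lift-dot : ∀ i w m {g} → Outcome c′ x y i w m g → Outcome c′ x y (suc i) (dot ∷ w) (Maybe.map (dot ∷_) m) g
    lift-dot i w nothing o = o
    lift-dot i w (just w′) o = record { Split o }

    lift-op : ∀ i w m {g g′} → (∀ R T → g′ (R ∷ T) ≡ R ∷ g T) →
      (∀ R T → All (λ a → ColStep a C) R → Below R T → Below R (g T)) → (∀ R T → Below R (g T) → Below R T) →
      (∀ w′ → m ≡ just w′ → length w′ ≡ length w) →
      Outcome c′ x y i w m g → Outcome c′ x y (suc i) (op ∷ w) (Maybe.map (op ∷_) m) g′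
    lift-op i w nothing gc b⁺ b⁻ len o [] = (λ ()) , λ ()
    lift-op i w nothing gc b⁺ b⁻ len o (R ∷ T) =
      (λ (r , b , t) → r , b , proj₁ (o T) t) , (λ (r , b , t) → r , b , proj₂ (o T) t)
    lift-op i w (just w′) {g} {g′} gc b⁺ b⁻ len o = record
      { cases = cases′ ; left = left′ ; right = right′ ; disjoint = disjoint′ ; injective = injective′ }
      where
      open Split o
      lw : length w′ ≡ length w
      lw = len w′ refl
      Whole Kept Moved : List (List ℕ) → Set
      Whole = Tab (stage x (suc c′) y (suc i)) (op ∷ w)
      Kept = Tab (stage x c′ y (suc i)) (op ∷ w)
      Moved = Tab (stage x c′ y (suc i)) (op ∷ w′)
      cases′ : ∀ T → Whole T → Kept T ⊎ Σ _ λ T′ → Moved T′ × T ≡ g′ T′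
      cases′ (R ∷ T) (r , b , t) with cases T t
      ... | inj₁ t₁ = inj₁ (r , b , t₁)
      ... | inj₂ (T′ , t₂ , refl) = inj₂ (R ∷ T′ , (subst (λ l → Row x (suc l) R) (sym lw) r , b⁻ R T′ b , t₂) , sym (gc R T′))
      left′ : ∀ T → Kept T → Whole T
      left′ (R ∷ T) (r , b , t) = r , b , left T t
      right′ : ∀ T → Moved T → Whole (g′ T)
      right′ (R ∷ T) (r , b , t) rewrite gc R T = subst (λ l → Row x (suc l) R) lw r ,
        b⁺ R T (All.map (λ {a} l → colStep a l) (Row.bounded r)) b , right T t
      disjoint′ : ∀ T → Moved T → ¬ Kept (g′ T)
      disjoint′ (R ∷ T) (r , b , t) rewrite gc R T = λ (_ , _ , t₁) → disjoint T t t₁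
      injective′ : ∀ T T′ → Moved T → Moved T′ → g′ T ≡ g′ T′ → T ≡ T′
      injective′ (R ∷ T) (R′ ∷ T′) (_ , _ , t) (_ , _ , t′) e rewrite gc R T | gc R′ T′ =
        cong₂ _∷_ (List.∷-injectiveˡ e) (injective T T′ t t′ (List.∷-injectiveʳ e))

    drop1-all : ∀ {Q : ℕ → Set} R → All Q R → All Q (drop 1 R)
    drop1-all [] q = q
    drop1-all (a ∷ R) (_ ∷ q) = q

    below-snocRow⁺ : ∀ k R T → All (λ a → ColStep a C) R → Below R T → Below R (snocRow k C T)
    below-snocRow⁺ k R [] q b = tt
    below-snocRow⁺ zero R (R′ ∷ T) q b = columns-bottom⁺ (drop 1 R) R′ (drop1-all R q) b
    below-snocRow⁺ (suc k) R (R′ ∷ T) q b = b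

    below-snocRow⁻ : ∀ k R T → Below R (snocRow k C T) → Below R T
    below-snocRow⁻ k R [] b = tt
    below-snocRow⁻ zero R (R′ ∷ T) b = columns-bottom⁻ (drop 1 R) R′ b
    below-snocRow⁻ (suc k) R (R′ ∷ T) b = b

    below-∷ʳ⁺ : ∀ R T → All (λ a → ColStep a C) R → Below R T → Below R (T ∷ʳ (C ∷ []))
    below-∷ʳ⁺ R [] q b = columns-bottom⁺ (drop 1 R) [] (drop1-all R q) (columns-[] (drop 1 R))
    below-∷ʳ⁺ R (R′ ∷ T) q b = b

    below-∷ʳ⁻ : ∀ R T → Below R (T ∷ʳ (C ∷ [])) → Below R T
    below-∷ʳ⁻ R [] b = tt
    below-∷ʳ⁻ R (R′ ∷ T) b = b

    private
      all≤ : ∀ R z → All (λ a → RowStep a z) R → z ≤ c′ → All (_≤ c′) (R ∷ʳ z)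
      all≤ R z q l = All.∷ʳ⁺ (All.map (λ s → ℕ.≤-trans (proj₁ s) l) q) l

    full-below : ∀ as bs → length as ≡ length bs → Columns as bs → All (_≤ y) bs → All (_≤ c′) as
    full-below [] [] e k q = []
    full-below (a ∷ as) (b ∷ bs) e (s , k) (l ∷ q) = colStep⁻ a b s l ∷ full-below as bs (ℕ.suc-injective e) k q

    -- For `op op` the row below is just one box shorter, hence ends in the same column, and its
    -- bound together with the column condition keeps `suc c′` out of the upper row. For `op dot` no
    -- box lies below the end of the row, so that box may hold `suc c′`, and removing it moves the
    -- opener one site to the right.
    split-here : ∀ d w → NoClose w → 2 ≤ length w → Outcome c′ x y 0 w (rem d 0 w) (snocRow 0 C)
    split-here d (dot ∷ op ∷ w) _ _ T = (λ t → t) , λ t → t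
    split-here d (dot ∷ dot ∷ w) _ _ T = (λ t → t) , λ t → t
    split-here d (dot ∷ cl ∷ w) (dot ()) _
    split-here d (op ∷ cl ∷ w) (op ()) _
    split-here d (dot ∷ []) _ (s≤s ())
    split-here d (op ∷ []) _ (s≤s ())
    split-here d (op ∷ op ∷ w) _ _ [] = (λ ()) , λ ()
    split-here d (op ∷ op ∷ w) _ _ (R ∷ []) = (λ ()) , λ ()
    split-here d (op ∷ op ∷ w) _ _ (R ∷ R′ ∷ T) =
      (λ (r , b , t) → tighten R r b (proj₁ t) , b , t) , (λ (r , b , t) → Row-mono (ℕ.n≤1+n c′) r , b , t)
      where
      tighten : ∀ R → Row C (2 ℕ.+ length w) R → Columns (drop 1 R) R′ → Row y (suc (length w)) R′ → Row c′ (2 ℕ.+ length w) R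
      -- The diagonal entry has no box below it; its right neighbour bounds it.
      tighten (a ∷ a′ ∷ R) (row l p i h q) k r′ =
        let small = full-below (a′ ∷ R) R′ (trans (ℕ.suc-injective l) (sym (Row.row-length r′))) k (Row.bounded r′)
        in row l p i h (ℕ.≤-trans (proj₁ (proj₁ i)) (All.head small) ∷ small)
    split-here d (op ∷ dot ∷ w) _ _ = record
      { cases = cases′ ; left = left′ ; right = right′ ; disjoint = disjoint′
      ; injective = λ T T′ _ _ → snocRow-injective 0 C T T′ }
      where
      Whole Kept Moved : List (List ℕ) → Set
      Whole = Tab (stage x C y 0) (op ∷ dot ∷ w)
      Kept = Tab (stage x c′ y 0) (op ∷ dot ∷ w)
      Moved = Tab (stage x c′ y 0) (dot ∷ op ∷ w)
      head-∷ʳ : ∀ R z → 1 ≤ length R → HeadUnprimed (R ∷ʳ z) → HeadUnprimed R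
      head-∷ʳ (a ∷ R) z _ h = h
      ∷ʳ-head : ∀ R z → 1 ≤ length R → HeadUnprimed R → HeadUnprimed (R ∷ʳ z)
      ∷ʳ-head (a ∷ R) z _ h = h
      length-∷ʳ : ∀ (R : List ℕ) z → length (R ∷ʳ z) ≡ suc (length R)
      length-∷ʳ R z = List.length-++-comm R (z ∷ [])
      below⁺ : ∀ R T → length R ≡ suc (length w) → Tab (λ _ → y) w T → Below R T → Below (R ∷ʳ C) T
      below⁺ R [] l t b = tt
      below⁺ (a ∷ R) (R′ ∷ T) l t b = columns-top⁺ R R′ (ℕ.≤-trans (Tab-head w R′ T t) (ℕ.≤-reflexive (sym (ℕ.suc-injective l)))) b
      below⁻ : ∀ R T → 1 ≤ length R → Below (R ∷ʳ C) T → Below R T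
      below⁻ R [] l b = tt
      below⁻ (a ∷ R) (R′ ∷ T) l b = columns-top⁻ R R′ b
      cases′ : ∀ T → Whole T → Kept T ⊎ Σ _ λ T′ → Moved T′ × T ≡ snocRow 0 C T′
      cases′ (R ∷ T) (r , b , t) with List.initLast R
      cases′ (.[] ∷ T) (row () _ _ _ _ , b , t) | []
      cases′ (.(R ∷ʳ z) ∷ T) (row l p i h q , b , t) | R List.∷ʳ′ z with z ℕ.≟ C
      ... | yes refl = inj₂ (R ∷ T , (row lR (proj₁ (All.∷ʳ⁻ p)) (proj₁ (increasing-∷ʳ⁻ R i)) (head-∷ʳ R C 1≤ h)
              (All.map (λ {a} s → rowStep⁻ a s) (proj₂ (increasing-∷ʳ⁻ R i))) , below⁻ R T 1≤ b , t) , refl)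
        where
        lR : length R ≡ suc (length w)
        lR = ℕ.suc-injective (trans (sym (length-∷ʳ R C)) l)
        1≤ : 1 ≤ length R
        1≤ = ℕ.≤-trans (s≤s z≤n) (ℕ.≤-reflexive (sym lR))
      ... | no z≢C = inj₁ (row l p i h (all≤ R z (proj₂ (increasing-∷ʳ⁻ R i)) (ℕ.s≤s⁻¹ (ℕ.≤∧≢⇒< (proj₂ (All.∷ʳ⁻ q)) z≢C))) , b , t)
      left′ : ∀ T → Kept T → Whole T
      left′ (R ∷ T) (r , b , t) = Row-mono (ℕ.n≤1+n c′) r , b , t
      right′ : ∀ T → Moved T → Whole (snocRow 0 C T)
      right′ (R ∷ T) (row l p i h q , b , t) =
        row (trans (length-∷ʳ R C) (cong suc l)) (All.∷ʳ⁺ p (s≤s z≤n))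
          (increasing-∷ʳ⁺ R i (All.map (λ {a} m → rowStep a m) q)) (∷ʳ-head R C (ℕ.≤-trans (s≤s z≤n) (ℕ.≤-reflexive (sym l))) h)
          (All.∷ʳ⁺ (All.map (λ {a} m → proj₁ (rowStep a m)) q) ℕ.≤-refl) ,
        below⁺ R T l t b , t
      disjoint′ : ∀ T → Moved T → ¬ Kept (snocRow 0 C T)
      disjoint′ (R ∷ T) _ (r , _ , _) = ℕ.<-irrefl refl (proj₂ (All.∷ʳ⁻ {xs = R} (Row.bounded r)))

    split-at : ∀ d i w → NoClose w → suc (suc i) ≤ length w →
      Outcome c′ x y i w (rem d i w) (snocRow (opens (take i w)) C)
    split-at d zero w c l = split-here d w c l
    split-at d (suc i) (dot ∷ w) (dot c) (s≤s l) = lift-dot i w (rem d i w) (split-at d i w c l)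
    split-at d (suc i) (op ∷ w) (op c) (s≤s l) = lift-op i w (rem (suc d) i w) (λ _ _ → refl)
      (below-snocRow⁺ (opens (take i w))) (below-snocRow⁻ (opens (take i w)))
      (λ w′ e → rem-length (suc d) i w e) (split-at (suc d) i w c l)

    -- A row at the last site is a single diagonal box, so the entry removed there has to be
    -- unprimed.
    split-exit : Unprimed C → ∀ n w → NoClose w → length w ≡ suc n →
      Outcome c′ x y n w (exit w) (_∷ʳ (C ∷ []))
    split-exit uC zero (dot ∷ []) _ _ T = (λ t → t) , λ t → t
    split-exit uC zero (op ∷ []) _ _ = record
      { cases = cases′ ; left = left′ ; right = right′ ; disjoint = disjoint′
      ; injective = λ T T′ _ _ e → proj₁ (List.∷ʳ-injective T T′ e) }
      where
      Whole Kept Moved : List (List ℕ) → Set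
      Whole = Tab (stage x C y 0) (op ∷ [])
      Kept = Tab (stage x c′ y 0) (op ∷ [])
      Moved = Tab (stage x c′ y 0) (dot ∷ [])
      cases′ : ∀ T → Whole T → Kept T ⊎ Σ _ λ T′ → Moved T′ × T ≡ T′ ∷ʳ (C ∷ [])
      cases′ ((z ∷ []) ∷ []) (row l p i h (q ∷ []) , b , refl) with z ℕ.≟ C
      ... | yes refl = inj₂ ([] , refl , refl)
      ... | no z≢C = inj₁ (row l p i h (ℕ.s≤s⁻¹ (ℕ.≤∧≢⇒< q z≢C) ∷ []) , b , refl)
      left′ : ∀ T → Kept T → Whole T
      left′ (R ∷ T) (r , b , t) = Row-mono (ℕ.n≤1+n c′) r , b , t
      right′ : ∀ T → Moved T → Whole (T ∷ʳ (C ∷ []))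
      right′ .[] refl = row refl (s≤s z≤n ∷ []) tt uC (ℕ.≤-refl ∷ []) , tt , refl
      disjoint′ : ∀ T → Moved T → ¬ Kept (T ∷ʳ (C ∷ []))
      disjoint′ .[] refl (r , _ , _) = ℕ.<-irrefl refl (All.head (Row.bounded r))
    split-exit uC (suc n) (dot ∷ w@(_ ∷ _)) (dot c) l = lift-dot n w (exit w) (split-exit uC n w c (ℕ.suc-injective l))
    split-exit uC (suc n) (op ∷ w@(_ ∷ _)) (op c) l = lift-op n w (exit w) (λ _ _ → refl) below-∷ʳ⁺ below-∷ʳ⁻
      (λ w′ e → proj₂ (proj₂ (exit-noClose w c e))) (split-exit uC n w c (ℕ.suc-injective l))

  -- A diagonal box cannot hold a primed entry, so at the last site the bound falls by itself; this
  -- is why the primed pass has no `exit`.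
  tab-last-primed : ∀ c′ n w → Primed (suc c′) → length w ≡ suc n →
    Tab (λ _ → suc c′) w ⇔ Tab (stage (suc c′) c′ c′ n) w
  tab-last-primed c′ zero (dot ∷ []) p l T = (λ t → t) , λ t → t
  tab-last-primed c′ zero (cl ∷ []) p l T = (λ ()) , λ ()
  tab-last-primed c′ zero (op ∷ []) p l [] = (λ ()) , λ ()
  tab-last-primed c′ zero (op ∷ []) p l (R ∷ T) = (λ (r , b , t) → tighten R r , b , t) ,
    λ (r , b , t) → Row-mono (ℕ.n≤1+n c′) r , b , t
    where
    tighten : ∀ R → Row (suc c′) 1 R → Row c′ 1 R
    tighten (z ∷ []) (row e q i h (m ∷ [])) = row e q i h
      (ℕ.s≤s⁻¹ (ℕ.≤∧≢⇒< m (λ { refl → case (trans (sym p) h) })) ∷ [])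
      where
      case : ¬ (1 ≡ 0)
      case ()
  tab-last-primed c′ (suc n) (dot ∷ w) p l T = tab-last-primed c′ n w p (ℕ.suc-injective l) T
  tab-last-primed c′ (suc n) (cl ∷ w) p l T = (λ ()) , λ ()
  tab-last-primed c′ (suc n) (op ∷ w) p l [] = (λ ()) , λ ()
  tab-last-primed c′ (suc n) (op ∷ w) p l (R ∷ T) =
    (λ (r , b , t) → r , b , proj₁ (tab-last-primed c′ n w p (ℕ.suc-injective l) T) t) ,
    (λ (r , b , t) → r , b , proj₂ (tab-last-primed c′ n w p (ℕ.suc-injective l) T) t)

-- Counting tableaux by content.

module TableauCounts where

  open import Data.Nat using (_≤_; _<_; ⌊_/2⌋)
  open Moves
  open NilCoxeterMoves
  open ArcWords
  open ArcWordProperties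
  open HorizontalAndVertical
  open Evaluations
  open Coefficients
  open Cardinalities
  open BoxRemoval

  countℕ-++ : ∀ j xs ys → countℕ j (xs ++ ys) ≡ countℕ j xs ℕ.+ countℕ j ys
  countℕ-++ j [] ys = refl
  countℕ-++ j (x ∷ xs) ys with does (x ℕ.≟ j)
  ... | true = cong suc (countℕ-++ j xs ys)
  ... | false = countℕ-++ j xs ys

  countℕ-≢ : ∀ x j xs → x ≢ j → countℕ j (x ∷ xs) ≡ countℕ j xs
  countℕ-≢ x j xs ne = cong (λ b → if b then suc (countℕ j xs) else countℕ j xs) (dec-false (x ℕ.≟ j) ne)

  count-rows : ∀ j R T → countℕ j (lettersOf (R ∷ T)) ≡ countℕ j (List.map letter R) ℕ.+ countℕ j (lettersOf T)
  count-rows j R T = trans (cong (countℕ j) (List.map-++ letter R (List.foldr _++_ [] T)))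
    (countℕ-++ j (List.map letter R) (lettersOf T))

  Adds : ℕ → (List (List ℕ) → List (List ℕ)) → List (List ℕ) → Set
  Adds c g T = ∀ j → countℕ j (lettersOf (g T)) ≡ countℕ j (letter c ∷ []) ℕ.+ countℕ j (lettersOf T)

  +-rotate : ∀ r s t → r ℕ.+ (s ℕ.+ t) ≡ s ℕ.+ (r ℕ.+ t)
  +-rotate r s t = trans (sym (ℕ.+-assoc r s t)) (trans (cong (ℕ._+ t) (ℕ.+-comm r s)) (ℕ.+-assoc s r t))

  adds-below : ∀ c R T T′ → (∀ j → countℕ j (lettersOf T′) ≡ countℕ j (letter c ∷ []) ℕ.+ countℕ j (lettersOf T)) →
    ∀ j → countℕ j (lettersOf (R ∷ T′)) ≡ countℕ j (letter c ∷ []) ℕ.+ countℕ j (lettersOf (R ∷ T))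
  adds-below c R T T′ h j = begin
    countℕ j (lettersOf (R ∷ T′)) ≡⟨ count-rows j R T′ ⟩
    r ℕ.+ countℕ j (lettersOf T′) ≡⟨ cong (r ℕ.+_) (h j) ⟩
    r ℕ.+ (s ℕ.+ countℕ j (lettersOf T)) ≡⟨ +-rotate r s (countℕ j (lettersOf T)) ⟩
    s ℕ.+ (r ℕ.+ countℕ j (lettersOf T)) ≡⟨ cong (s ℕ.+_) (count-rows j R T) ⟨
    s ℕ.+ countℕ j (lettersOf (R ∷ T)) ∎
    where
    open ≡-Reasoning
    r s : ℕ
    r = countℕ j (List.map letter R)
    s = countℕ j (letter c ∷ [])

  snocRow-adds : ∀ k c T → k < length T → Adds c (snocRow k c) T
  snocRow-adds zero c (R ∷ T) _ j = begin
    countℕ j (lettersOf ((R ∷ʳ c) ∷ T)) ≡⟨ count-rows j (R ∷ʳ c) T ⟩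
    countℕ j (List.map letter (R ∷ʳ c)) ℕ.+ t ≡⟨ cong (λ l → countℕ j l ℕ.+ t) (List.map-++ letter R (c ∷ [])) ⟩
    countℕ j (List.map letter R ∷ʳ letter c) ℕ.+ t ≡⟨ cong (ℕ._+ t) (countℕ-++ j (List.map letter R) (letter c ∷ [])) ⟩
    (r ℕ.+ s) ℕ.+ t ≡⟨ ℕ.+-assoc r s t ⟩
    r ℕ.+ (s ℕ.+ t) ≡⟨ +-rotate r s t ⟩
    s ℕ.+ (r ℕ.+ t) ≡⟨ cong (s ℕ.+_) (count-rows j R T) ⟨
    s ℕ.+ countℕ j (lettersOf (R ∷ T)) ∎
    where
    open ≡-Reasoning
    r s t : ℕ
    r = countℕ j (List.map letter R)
    s = countℕ j (letter c ∷ [])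
    t = countℕ j (lettersOf T)
  snocRow-adds (suc k) c (R ∷ T) (s≤s l) = adds-below c R T (snocRow k c T) (snocRow-adds k c T l)

  ∷ʳ-adds : ∀ c T → Adds c (_∷ʳ (c ∷ [])) T
  ∷ʳ-adds c [] j = sym (ℕ.+-identityʳ _)
  ∷ʳ-adds c (R ∷ T) = adds-below c R T (T ∷ʳ (c ∷ [])) (∷ʳ-adds c T)

  expo-∷ʳ-suc : ∀ α e k → expo (α ∷ʳ suc e) k ≡ countℕ (suc k) (suc (length α) ∷ []) ℕ.+ expo (α ∷ʳ e) k
  expo-∷ʳ-suc [] e zero = refl
  expo-∷ʳ-suc [] e (suc k) = refl
  expo-∷ʳ-suc (a ∷ α) e zero = refl
  expo-∷ʳ-suc (a ∷ α) e (suc k) = expo-∷ʳ-suc α e k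

  expo-∷ʳ-zero : ∀ α k → expo (α ∷ʳ 0) k ≡ expo α k
  expo-∷ʳ-zero [] zero = refl
  expo-∷ʳ-zero [] (suc k) = refl
  expo-∷ʳ-zero (a ∷ α) zero = refl
  expo-∷ʳ-zero (a ∷ α) (suc k) = expo-∷ʳ-zero α k

  expo-∷ʳ-last : ∀ α e → expo (α ∷ʳ e) (length α) ≡ e
  expo-∷ʳ-last [] e = refl
  expo-∷ʳ-last (a ∷ α) e = expo-∷ʳ-last α e

  expo-beyond : ∀ α k → length α ≤ k → expo α k ≡ 0
  expo-beyond [] k l = refl
  expo-beyond (a ∷ α) (suc k) (s≤s l) = expo-beyond α k l

  count-self : ∀ j → countℕ j (j ∷ []) ≡ 1
  count-self zero = refl
  count-self (suc j) = count-self j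

  module Sizes (α : List ℕ) where

    Content : ℕ → List (List ℕ) → Set
    Content e T = HasContent (lettersOf T) (α ∷ʳ e)

    module _ {c g T} (lc : letter c ≡ suc (length α)) (ad : Adds c g T) where

      adds : ∀ k → countℕ (suc k) (lettersOf (g T)) ≡ countℕ (suc k) (suc (length α) ∷ []) ℕ.+ countℕ (suc k) (lettersOf T)
      adds k = trans (ad (suc k)) (cong (λ l → countℕ (suc k) (l ∷ []) ℕ.+ countℕ (suc k) (lettersOf T)) lc)

      content-suc⁺ : ∀ e → Content e T → Content (suc e) (g T)
      content-suc⁺ e h k = trans (adds k) (trans (cong (_ ℕ.+_) (h k)) (sym (expo-∷ʳ-suc α e k)))

      content-suc⁻ : ∀ e → Content (suc e) (g T) → Content e T
      content-suc⁻ e h k = ℕ.+-cancelˡ-≡ (countℕ (suc k) (suc (length α) ∷ [])) _ _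
        (trans (sym (adds k)) (trans (h k) (expo-∷ʳ-suc α e k)))

      content-zero : ¬ Content 0 (g T)
      content-zero h with trans (sym (cong (ℕ._+ countℕ (suc (length α)) (lettersOf T)) (count-self (suc (length α))))) (trans (sym (adds (length α)))
        (trans (h (length α)) (expo-∷ʳ-last α 0)))
      ... | ()

    -- One box removed is one power of the current variable: `Outcome` splits the tableaux as
    -- `count` splits its sum, with the exponent lowered by one where the box goes.
    size-step : ∀ {c′ x y i w} (ρ : Move (List Sym)) (ρs : List (Move (List Sym))) (f : List Sym → ℕ) {g} →
      letter (suc c′) ≡ suc (length α) → Outcome c′ x y i w (ρ w) g →
      (∀ w′ → ρ w ≡ just w′ → ∀ T → Tab (stage x c′ y i) w′ T → Adds (suc c′) g T) →
      (∀ e → HasSize (λ T → Tab (stage x c′ y i) w T × Content e T) (count ρs e f w)) →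
      (∀ w′ e → ρ w ≡ just w′ → HasSize (λ T → Tab (stage x c′ y i) w′ T × Content e T) (count ρs e f w′)) →
      ∀ e → HasSize (λ T → Tab (stage x (suc c′) y i) w T × Content e T) (count (ρ ∷ ρs) e f w)
    size-step {w = w} ρ ρs f {g} lc o ad kept moved zero with ρ w
    ... | nothing =
      HasSize-⇔ (λ T → (λ (t , h) → proj₂ (o T) t , h) , λ (t , h) → proj₁ (o T) t , h) (kept 0)
    ... | just w′ =
      HasSize-⇔ (λ T → (λ (t , h) → left T t , h) , λ (t , h) → only T (cases T t) h , h) (kept 0)
      where
      open Split o
      only : ∀ T → _ → Content 0 T → _
      only T (inj₁ t) h = t
      only T (inj₂ (T′ , t′ , refl)) h = ⊥-elim (content-zero {g = g} lc (ad w′ refl T′ t′) h)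
    size-step {w = w} ρ ρs f {g} lc o ad kept moved (suc e) with ρ w
    ... | nothing =
      HasSize-⇔ (λ T → (λ (t , h) → proj₂ (o T) t , h) , λ (t , h) → proj₁ (o T) t , h)
        (subst (HasSize _) (sym (ℕ.+-identityʳ _)) (kept (suc e)))
    ... | just w′ = HasSize-split (record
      { cases = λ T (t , h) → cases′ T (cases T t) h
      ; left = λ T (t , h) → left T t , h
      ; right = λ T (t , h) → right T t , content-suc⁺ {g = g} lc (ad w′ refl T t) e h
      ; disjoint = λ T (t , h) (t₁ , _) → disjoint T t t₁
      ; injective = λ T T′ (t , _) (t′ , _) → injective T T′ t t′ }) (kept (suc e)) (moved w′ e refl)
      where
      open Split o
      cases′ : ∀ T → _ → Content (suc e) T → _
      cases′ T (inj₁ t) h = inj₁ (t , h)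
      cases′ T (inj₂ (T′ , t′ , refl)) h = inj₂ (T′ , (t′ , content-suc⁻ {g = g} lc (ad w′ refl T′ t′) e h) , refl)

  take-opens : ∀ d i w {w′} → NoClose w → rem d i w ≡ just w′ → opens (take i w) < opens w′
  take-opens d zero (op ∷ dot ∷ w) c refl = s≤s z≤n
  take-opens d zero (op ∷ cl ∷ w) (op ()) e
  take-opens d zero (dot ∷ op ∷ w) c ()
  take-opens d zero (dot ∷ dot ∷ w) c ()
  take-opens d zero (dot ∷ cl ∷ w) (dot ()) e
  take-opens d (suc i) (op ∷ w) (op c) e with map-just _ (rem (suc d) i w) e
  ... | _ , e′ , refl = s≤s (take-opens (suc d) i w c e′)
  take-opens d (suc i) (dot ∷ w) (dot c) e with map-just _ (rem d i w) e
  ... | _ , e′ , refl = take-opens d i w c e′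

  double : ℕ → ℕ
  double zero = 0
  double (suc m) = suc (suc (double m))

  %2 : ∀ a → suc (suc a) ℕ.% 2 ≡ a ℕ.% 2
  %2 a = trans (cong (ℕ._% 2) (ℕ.+-comm 2 a)) (ℕ.[m+n]%n≡m%n a 2)

  double-unprimed : ∀ m → Unprimed (double m)
  double-unprimed zero = refl
  double-unprimed (suc m) = trans (%2 (double m)) (double-unprimed m)

  double-primed : ∀ m → Primed (suc (double m))
  double-primed zero = refl
  double-primed (suc m) = trans (%2 (suc (double m))) (double-primed m)

  half-double : ∀ m → ⌊ double m /2⌋ ≡ m
  half-double zero = refl
  half-double (suc m) = cong suc (half-double m)

  half-suc-double : ∀ m → ⌊ suc (double m) /2⌋ ≡ m
  half-suc-double zero = refl
  half-suc-double (suc m) = cong suc (half-suc-double m)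

  letter-primed : ∀ m → letter (suc (double m)) ≡ suc m
  letter-primed m = cong suc (half-double m)

  letter-unprimed : ∀ m → letter (double (suc m)) ≡ suc m
  letter-unprimed m = cong suc (half-suc-double m)

  letter≤ : ∀ m a → a ≤ double m → letter a ≤ m
  letter≤ m a l = ℕ.≤-trans (ℕ.⌊n/2⌋-mono (s≤s l)) (ℕ.≤-reflexive (half-suc-double m))

  primed≢unprimed : ∀ {a} → Primed a → ¬ Unprimed a
  primed≢unprimed p u with trans (sym p) u
  ... | ()

  -- Unprimed entries repeat along rows but not down columns: a row may hold the entry again after
  -- losing a copy, while a box above it may not. For primed entries rows and columns trade places,
  -- which reverses the order of processing.
  unprimed-phase : ∀ m → Phase (suc (double m)) (suc (double m)) (suc (suc (double m)))
  unprimed-phase m = record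
    { rowStep = λ a l → l , λ p → ℕ.≤∧≢⇒< l λ { refl → primed≢unprimed {double (suc m)} p (double-unprimed (suc m)) }
    ; rowStep⁻ = λ a s → proj₁ s
    ; colStep = λ a l → ℕ.m≤n⇒m≤1+n l , λ _ → s≤s l
    ; colStep⁻ = λ a b s l → ℕ.s≤s⁻¹ (ℕ.≤∧≢⇒< (ℕ.≤-trans (proj₁ s) l)
        λ { refl → ℕ.<-irrefl refl (ℕ.<-≤-trans (proj₂ s (double-unprimed (suc m))) l) }) }

  primed-phase : ∀ m → Phase (double m) (suc (double m)) (double m)
  primed-phase m = record
    { rowStep = λ a l → ℕ.m≤n⇒m≤1+n l , λ _ → s≤s l
    ; rowStep⁻ = λ a s → ℕ.s≤s⁻¹ (ℕ.≤∧≢⇒< (proj₁ s) λ { refl → ℕ.<-irrefl refl (proj₂ s (double-primed m)) })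
    ; colStep = λ a l → l , λ u → ℕ.≤∧≢⇒< l λ { refl → primed≢unprimed {suc (double m)} (double-primed m) u }
    ; colStep⁻ = λ a b s l → ℕ.≤-trans (proj₁ s) l }

  -- Going down the rows, the state with site `i` finished is that of site `i + 1` about to start;
  -- `stage-down` is its counterpart for the opposite direction.
  stage-up : ∀ c D i s → stage c c D i s ≡ stage c D D (suc i) s
  stage-up c D zero zero = refl
  stage-up c D zero (suc zero) = refl
  stage-up c D zero (suc (suc s)) = refl
  stage-up c D (suc i) zero = refl
  stage-up c D (suc i) (suc s) = stage-up c D i s

  stage-top : ∀ c D n s → s < suc n → stage c c D n s ≡ c
  stage-top c D zero zero l = refl
  stage-top c D zero (suc s) (s≤s ())
  stage-top c D (suc n) zero l = refl
  stage-top c D (suc n) (suc s) (s≤s l) = stage-top c D n s l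

  stage-bottom : ∀ x c s → stage x c c 0 s ≡ c
  stage-bottom x c zero = refl
  stage-bottom x c (suc s) = refl

  stage-down : ∀ D c i s → stage D c c (suc i) s ≡ stage D D c i s
  stage-down D c zero zero = refl
  stage-down D c zero (suc s) = stage-bottom D c s
  stage-down D c (suc i) zero = refl
  stage-down D c (suc i) (suc s) = stage-down D c i s

  ×-⇔ : {A : Set} {P Q C : A → Set} → P ⇔ Q → (λ x → P x × C x) ⇔ (λ x → Q x × C x)
  ×-⇔ e x = (λ (p , c) → proj₁ (e x) p , c) , λ (q , c) → proj₂ (e x) q , c

  ⇔-sym : {A : Set} {P Q : A → Set} → P ⇔ Q → Q ⇔ P
  ⇔-sym e x = proj₂ (e x) , proj₁ (e x)

  module Level (n m : ℕ) (α : List ℕ) (lα : length α ≡ m) (f : List Sym → ℕ)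
    (next : ∀ w → Word n w → HasSize (λ T → Tab (λ _ → double m) w T × HasContent (lettersOf T) α) (f w)) where
    open Sizes α

    Tab-entries : ∀ b w T → Tab (λ _ → b) w T → ∀ j → (∀ a → a ≤ b → letter a < j) → countℕ j (lettersOf T) ≡ 0
    Tab-entries b [] T refl j h = refl
    Tab-entries b (dot ∷ w) T t j h = Tab-entries b w T t j h
    Tab-entries b (op ∷ w) (R ∷ T) (r , _ , t) j h = trans (count-rows j R T)
      (cong₂ ℕ._+_ (none R (Row.bounded r)) (Tab-entries b w T t j h))
      where
      none : ∀ R → All (_≤ b) R → countℕ j (List.map letter R) ≡ 0
      none [] q = refl
      none (a ∷ R) (l ∷ q) = trans (countℕ-≢ (letter a) j (List.map letter R) (ℕ.<⇒≢ (h a l))) (none R q)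

    primed-size : ∀ i → i ≤ n → ∀ w → Word n w → ∀ e →
      HasSize (λ T → Tab (stage (suc (double m)) (double m) (double m) i) w T × Content e T) (count (reversed (rem 0) 0 i) e f w)
    primed-size zero _ w Ww zero = HasSize-⇔
      (λ T → (λ (t , h) → proj₂ (flat T) t , λ k → trans (h k) (sym (expo-∷ʳ-zero α k))) ,
              λ (t , h) → proj₁ (flat T) t , λ k → trans (h k) (expo-∷ʳ-zero α k)) (next w Ww)
      where
      flat : Tab (stage (suc (double m)) (double m) (double m) 0) w ⇔ Tab (λ _ → double m) w
      flat = Tab-cong w (λ s _ → stage-bottom (suc (double m)) (double m) s)
    -- No entry with the new letter is left, so a positive exponent cannot be met.
    primed-size zero _ w Ww (suc e) = HasSize-empty λ T (t , h) → bad T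
      (proj₁ (Tab-cong w (λ s _ → stage-bottom (suc (double m)) (double m) s) T) t) h
      where
      bad : ∀ T → Tab (λ _ → double m) w T → ¬ Content (suc e) T
      bad T t h with trans (sym (Tab-entries (double m) w T t (suc (length α))
        (λ a l → s≤s (ℕ.≤-trans (letter≤ m a l) (ℕ.≤-reflexive (sym lα)))))) (trans (h (length α)) (expo-∷ʳ-last α (suc e)))
      ... | ()
    primed-size (suc i) i<n w Ww e = HasSize-resize (cong (λ ρs → count ρs e f w) (sym head-move))
      (HasSize-⇔ (×-⇔ (⇔-sym (Tab-cong w (λ s _ → stage-down (suc (double m)) (double m) i s))))
        (size-step (rem 0 i) (reversed (rem 0) 0 i) f (trans (letter-primed m) (cong suc (sym lα)))
          (split-at (primed-phase m) 0 i w (proj₂ Ww) (ℕ.≤-trans (s≤s i<n) (ℕ.≤-reflexive (sym (proj₁ Ww)))))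
          (λ w′ e T t → snocRow-adds _ _ T (subst (opens (take i w) <_) (sym (Tab-length w′ T t)) (take-opens 0 i w (proj₂ Ww) e)))
          (primed-size i (ℕ.≤-trans (ℕ.n≤1+n i) i<n) w Ww)
          (λ w′ e r → primed-size i (ℕ.≤-trans (ℕ.n≤1+n i) i<n) w′ (proj₂ (Word-sim n i w Ww) w′ r) e) e))
      where
      head-move : reversed (rem 0) 0 (suc i) ≡ rem 0 i ∷ reversed (rem 0) 0 i
      head-move = trans (cong (reversed (rem 0) 0) (ℕ.+-comm 1 i)) (reversed-++ (rem 0) 0 i 1)

    primed-level : ∀ w → Word n w → ∀ e →
      HasSize (λ T → Tab (λ _ → suc (double m)) w T × Content e T) (count (primed-moves n) e f w)
    primed-level w Ww e = HasSize-⇔ (×-⇔ (⇔-sym (tab-last-primed (double m) n w (double-primed m) (proj₁ Ww))))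
      (primed-size n ℕ.≤-refl w Ww e)

    unprimed-size : ∀ k i → i ℕ.+ k ≡ n → ∀ w → Word n w → ∀ e →
      HasSize (λ T → Tab (stage (suc (double m)) (double (suc m)) (double (suc m)) i) w T × Content e T)
        (count (segment (rem 0) i k ++ exit ∷ primed-moves n) e f w)
    unprimed-size zero i ik w Ww e rewrite trans (sym (ℕ.+-identityʳ i)) ik =
      size-step exit (primed-moves n) f (trans (letter-unprimed m) (cong suc (sym lα)))
        (split-exit (unprimed-phase m) (double-unprimed (suc m)) n w (proj₂ Ww) (proj₁ Ww))
        (λ w′ _ T _ → ∷ʳ-adds _ T)
        (λ e → after w Ww e) (λ w′ e r → after w′ (proj₂ (exit-sim n w Ww) w′ r) e) e
      where
      after : ∀ w → Word n w → ∀ e → HasSize (λ T → Tab (stage (suc (double m)) (suc (double m)) (double (suc m)) n) w T × Content e T)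
        (count (primed-moves n) e f w)
      after w Ww e = HasSize-⇔ (×-⇔ (⇔-sym (Tab-cong w (λ s l → stage-top _ _ n s (subst (s <_) (proj₁ Ww) l))))) (primed-level w Ww e)
    unprimed-size (suc k) i ik w Ww e =
      size-step (rem 0 i) (segment (rem 0) (suc i) k ++ exit ∷ primed-moves n) f (trans (letter-unprimed m) (cong suc (sym lα)))
        (split-at (unprimed-phase m) 0 i w (proj₂ Ww) (ℕ.≤-trans (s≤s i<n) (ℕ.≤-reflexive (sym (proj₁ Ww)))))
        (λ w′ e T t → snocRow-adds _ _ T (subst (opens (take i w) <_) (sym (Tab-length w′ T t)) (take-opens 0 i w (proj₂ Ww) e)))
        (λ e → after w Ww e) (λ w′ e r → after w′ (proj₂ (Word-sim n i w Ww) w′ r) e) e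
      where
      i<n : i < n
      i<n = subst (i <_) ik (ℕ.m<m+n i (s≤s z≤n))
      after : ∀ w → Word n w → ∀ e → HasSize (λ T → Tab (stage (suc (double m)) (suc (double m)) (double (suc m)) i) w T × Content e T)
        (count (segment (rem 0) (suc i) k ++ exit ∷ primed-moves n) e f w)
      after w Ww e = HasSize-⇔ (×-⇔ (⇔-sym (Tab-cong w (λ s _ → stage-up _ _ i s))))
        (unprimed-size k (suc i) (trans (sym (ℕ.+-suc i k)) ik) w Ww e)

    level : ∀ w → Word n w → ∀ e →
      HasSize (λ T → Tab (λ _ → double (suc m)) w T × Content e T) (count (unprimed-moves n ++ primed-moves n) e f w)
    level w Ww e = HasSize-resize (cong (λ ρs → count ρs e f w) (sym (List.++-assoc (segment (rem 0) 0 n) (exit ∷ []) (primed-moves n))))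
      (HasSize-⇔ (×-⇔ (Tab-cong w (λ s _ → stage-bottom _ _ s))) (unprimed-size n 0 refl w Ww e))

  -- Entries are removed from the largest letter down, hence the exponents are listed in reverse.
  tableaux-size : ∀ n γ w → Word n w →
    HasSize (λ T → Tab (λ _ → double (length γ)) w T × HasContent (lettersOf T) (reverse γ))
      (iterate-count (unprimed-moves n ++ primed-moves n) blank γ w)
  tableaux-size n [] w Ww = base w (proj₂ Ww)
    where
    base : ∀ w → NoClose w → HasSize (λ T → Tab (λ _ → 0) w T × HasContent (lettersOf T) []) (blank w)
    base [] _ = HasSize-singleton [] (refl , λ k → refl) (λ T (t , _) → t)
    base (dot ∷ w) (dot c) = base w c
    base (op ∷ w) _ = HasSize-empty none
      where
      none : ∀ T → ¬ (Tab (λ _ → 0) (op ∷ w) T × HasContent (lettersOf T) [])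
      none ([] ∷ T) ((row () _ _ _ _ , _) , _)
      none ((a ∷ R) ∷ T) ((row _ (1≤a ∷ _) _ _ (a≤0 ∷ _) , _) , _) with ℕ.≤-trans 1≤a a≤0
      ... | ()
  tableaux-size n (e ∷ γ) w Ww = HasSize-⇔
    (λ T → (λ (t , h) → t , subst (HasContent (lettersOf T)) (sym (List.unfold-reverse e γ)) h) ,
            λ (t , h) → t , subst (HasContent (lettersOf T)) (List.unfold-reverse e γ) h)
    (Level.level n (length γ) (reverse γ) (List.length-reverse γ) _ (tableaux-size n γ) w Ww e)

-- Tableaux given cell by cell.

module TableauCells where

  open import Data.Nat using (_≤_)
  open ArcWords
  open ArcWordProperties
  open HorizontalAndVertical
  open Evaluations
  open Coefficients
  open Cardinalities
  open BoxRemoval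
  open TableauCounts

  shape : List Sym → List ℕ
  shape [] = []
  shape (op ∷ w) = suc (length w) ∷ shape w
  shape (cl ∷ w) = shape w
  shape (dot ∷ w) = shape w

  -- The tableau conditions of `Tab` without its bound on the entries; the content restores the
  -- bound in `sound-bounded`.
  Sound : List (List ℕ) → Set
  Sound [] = ⊤
  Sound (R ∷ T) = All (1 ≤_) R × Increasing R × HeadUnprimed R × Below R T × Sound T

  nth-all⁻ : {A : Set} {Q : A → Set} (R : List A) → (∀ p c → nth R p ≡ just c → Q c) → All Q R
  nth-all⁻ [] h = []
  nth-all⁻ (a ∷ R) h = h 0 a refl ∷ nth-all⁻ R (λ p → h (suc p))

  nth-all⁺ : {A : Set} {Q : A → Set} (R : List A) → All Q R → ∀ p c → nth R p ≡ just c → Q c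
  nth-all⁺ (a ∷ R) (q ∷ _) zero .a refl = q
  nth-all⁺ (a ∷ R) (_ ∷ q) (suc p) c e = nth-all⁺ R q p c e

  nth-increasing⁻ : ∀ R → (∀ p c c′ → nth R p ≡ just c → nth R (suc p) ≡ just c′ → RowStep c c′) → Increasing R
  nth-increasing⁻ [] h = tt
  nth-increasing⁻ (a ∷ []) h = tt
  nth-increasing⁻ (a ∷ b ∷ R) h = h 0 a b refl refl , nth-increasing⁻ (b ∷ R) (λ p → h (suc p))

  nth-increasing⁺ : ∀ R → Increasing R → ∀ p c c′ → nth R p ≡ just c → nth R (suc p) ≡ just c′ → RowStep c c′
  nth-increasing⁺ (a ∷ b ∷ R) (s , i) zero .a .b refl refl = s
  nth-increasing⁺ (a ∷ b ∷ R) (s , i) (suc p) c c′ e e′ = nth-increasing⁺ (b ∷ R) i p c c′ e e′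

  nth-columns⁻ : ∀ as bs → (∀ p c c′ → nth as p ≡ just c → nth bs p ≡ just c′ → ColStep c c′) → Columns as bs
  nth-columns⁻ [] bs h = tt
  nth-columns⁻ (a ∷ as) [] h = tt
  nth-columns⁻ (a ∷ as) (b ∷ bs) h = h 0 a b refl refl , nth-columns⁻ as bs (λ p → h (suc p))

  nth-columns⁺ : ∀ as bs → Columns as bs → ∀ p c c′ → nth as p ≡ just c → nth bs p ≡ just c′ → ColStep c c′
  nth-columns⁺ (a ∷ as) (b ∷ bs) (s , k) zero .a .b refl refl = s
  nth-columns⁺ (a ∷ as) (b ∷ bs) (s , k) (suc p) c c′ e e′ = nth-columns⁺ as bs k p c c′ e e′

  nth-drop : ∀ (R : List ℕ) p → nth (drop 1 R) p ≡ nth R (suc p)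
  nth-drop [] p = refl
  nth-drop (a ∷ R) p = refl

  sound⁻ : ∀ T →
    (∀ i p c → cell T i p ≡ just c → 1 ≤ c) →
    (∀ i p c c′ → cell T i p ≡ just c → cell T i (suc p) ≡ just c′ → RowStep c c′) →
    (∀ i p c c′ → cell T i (suc p) ≡ just c → cell T (suc i) p ≡ just c′ → ColStep c c′) →
    (∀ i c → cell T i 0 ≡ just c → Unprimed c) → Sound T
  sound⁻ [] _ _ _ _ = tt
  sound⁻ (R ∷ T) pos inc col dia =
    nth-all⁻ R (pos 0) , nth-increasing⁻ R (inc 0) , head R (dia 0) , below T (col 0) ,
    sound⁻ T (λ i → pos (suc i)) (λ i → inc (suc i)) (λ i → col (suc i)) (λ i → dia (suc i))
    where
    head : ∀ R → (∀ c → nth R 0 ≡ just c → Unprimed c) → HeadUnprimed R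
    head [] h = tt
    head (a ∷ R) h = h a refl
    below : ∀ T → (∀ p c c′ → nth R (suc p) ≡ just c → cell T 0 p ≡ just c′ → ColStep c c′) → Below R T
    below [] h = tt
    below (R′ ∷ T) h = nth-columns⁻ (drop 1 R) R′ (λ p c c′ e → h p c c′ (trans (sym (nth-drop R p)) e))

  sound⁺ : ∀ T → Sound T →
    (∀ i p c → cell T i p ≡ just c → 1 ≤ c) ×
    (∀ i p c c′ → cell T i p ≡ just c → cell T i (suc p) ≡ just c′ → RowStep c c′) ×
    (∀ i p c c′ → cell T i (suc p) ≡ just c → cell T (suc i) p ≡ just c′ → ColStep c c′) ×
    (∀ i c → cell T i 0 ≡ just c → Unprimed c)
  sound⁺ [] _ = (λ i p c ()) , (λ i p c c′ ()) , (λ i p c c′ ()) , (λ i c ())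
  sound⁺ (R ∷ T) (pos , inc , hd , bel , s) =
    let pos′ , inc′ , col′ , dia′ = sound⁺ T s in
    (λ { zero → nth-all⁺ R pos ; (suc i) → pos′ i }) ,
    (λ { zero → nth-increasing⁺ R inc ; (suc i) → inc′ i }) ,
    (λ { zero → below T bel ; (suc i) → col′ i }) ,
    (λ { zero → head R hd ; (suc i) → dia′ i })
    where
    head : ∀ R → HeadUnprimed R → ∀ c → nth R 0 ≡ just c → Unprimed c
    head (a ∷ R) u .a refl = u
    below : ∀ T → Below R T → ∀ p c c′ → nth R (suc p) ≡ just c → cell T 0 p ≡ just c′ → ColStep c c′
    below (R′ ∷ T) k p c c′ e = nth-columns⁺ (drop 1 R) R′ k p c c′ (trans (nth-drop R p) e)

  Tab⁺ : ∀ b u T → NoClose u → List.map length T ≡ shape u → Sound T → All (All (_≤ b)) T → Tab (λ _ → b) u T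
  Tab⁺ b [] [] _ e s q = refl
  Tab⁺ b (dot ∷ u) T (dot c) e s q = Tab⁺ b u T c e s q
  Tab⁺ b (op ∷ u) (R ∷ T) (op c) e (pos , inc , hd , bel , s) (l ∷ q) =
    row (List.∷-injectiveˡ e) pos inc hd l , bel , Tab⁺ b u T c (List.∷-injectiveʳ e) s q

  Tab⁻ : ∀ b u T → Tab (λ _ → b) u T → List.map length T ≡ shape u × Sound T
  Tab⁻ b [] T refl = refl , tt
  Tab⁻ b (dot ∷ u) T t = Tab⁻ b u T t
  Tab⁻ b (op ∷ u) (R ∷ T) (row l pos inc hd q , bel , t) =
    let e , s = Tab⁻ b u T t in cong₂ _∷_ l e , (pos , inc , hd , bel , s)

  countℕ-∈ : ∀ {j xs} → j ∈ xs → 1 ≤ countℕ j xs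
  countℕ-∈ {j} {x ∷ xs} (here refl) =
    subst (1 ≤_) (sym (cong (λ b → if b then suc (countℕ j xs) else countℕ j xs) (dec-true (j ℕ.≟ j) refl))) (s≤s z≤n)
  countℕ-∈ {j} {x ∷ xs} (there p) with does (x ℕ.≟ j)
  ... | true = s≤s z≤n
  ... | false = countℕ-∈ p

  content-bound : ∀ js α → HasContent js α → ∀ {j} → j ∈ js → 1 ≤ j → j ≤ length α
  content-bound js α h {suc k} p _ with suc k ℕ.≤? length α
  ... | yes l = l
  ... | no l = ⊥-elim (ℕ.<-irrefl (sym (trans (h k) (expo-beyond α k (ℕ.s≤s⁻¹ (ℕ.≰⇒> l))))) (countℕ-∈ p))

  letter-bound : ∀ m a → letter a ≤ m → a ≤ double m
  letter-bound m a l with a ℕ.≤? double m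
  ... | yes l′ = l′
  ... | no l′ = ⊥-elim (ℕ.<-irrefl refl (ℕ.≤-trans (ℕ.≤-reflexive (sym (letter-primed m)))
    (ℕ.≤-trans (ℕ.⌊n/2⌋-mono (s≤s (ℕ.≰⇒> l′))) l)))

  -- The content rules out letters beyond `length α`. It says nothing about the letter 0, so the
  -- positivity of the codes enters as well.
  sound-bounded : ∀ T α → Sound T → HasContent (lettersOf T) α → All (All (_≤ double (length α))) T
  sound-bounded T α s h = go T s (All.concat⁻ {xss = T} (All.map⁻ (All.tabulate λ p → content-bound (lettersOf T) α h p)))
    where
    go : ∀ T → Sound T → All (All (λ a → 1 ≤ letter a → letter a ≤ length α)) T → All (All (_≤ double (length α))) T
    go [] _ [] = []
    go (R ∷ T) (pos , _ , _ , _ , s) (q ∷ qs) =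
      All.zipWith (λ (1≤a , f) → letter-bound (length α) _ (f (ℕ.⌊n/2⌋-mono (s≤s 1≤a)))) (pos , q) ∷ go T s qs

  PTableau-size : ∀ n u μ α → Word n u → shape u ≡ μ →
    HasSize (PTableau μ α) (iterate-count (unprimed-moves n ++ primed-moves n) blank (reverse α) u)
  PTableau-size n u .(shape u) α Wu refl = HasSize-⇔ equivalent (tableaux-size n (reverse α) u Wu)
    where
    len : length (reverse α) ≡ length α
    len = List.length-reverse α
    rev : reverse (reverse α) ≡ α
    rev = List.reverse-involutive α
    equivalent : (λ T → Tab (λ _ → double (length (reverse α))) u T × HasContent (lettersOf T) (reverse (reverse α))) ⇔ PTableau (shape u) α
    equivalent T =
      (λ (t , h) → let e , s = Tab⁻ _ u T t in (e , sound⁺ T s) , subst (HasContent (lettersOf T)) rev h) ,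
      (λ ((e , pos , inc , col , dia) , h) → let s = sound⁻ T pos inc col dia in
        Tab⁺ _ u T (proj₂ Wu) e s (subst (λ m → All (All (_≤ double m)) T) (sym len) (sound-bounded T α s h)) ,
        subst (HasContent (lettersOf T)) (sym rev) h)

-- The Demazure product one generator at a time.

module DemazureSteps where

  open import Data.Integer using (_+_; _<_; _≤_)

  next : ℤ → ℤ
  next i = i + 1ℤ

  i<next : ∀ i → i < next i
  i<next i = subst (i <_) (ℤ.+-comm 1ℤ i) (ℤ.≤∧≢⇒< (ℤ.i≤suc[i] i) ℤ.i≢suc[i])

  <⇒next≤ : ∀ {i j} → i < j → next i ≤ j
  <⇒next≤ {i} {j} l = subst (_≤ j) (ℤ.+-comm 1ℤ i) (ℤ.i<j⇒suc[i]≤j l)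

  <next⇒≤ : ∀ {i j} → j < next i → j ≤ i
  <next⇒≤ {i} {j} l with j ℤ.≤? i
  ... | yes p = p
  ... | no p = ⊥-elim (ℤ.<-irrefl refl (ℤ.<-≤-trans l (<⇒next≤ (ℤ.≰⇒> p))))

  sw-i : ∀ i → sw i i ≡ next i
  sw-i i = cong (λ b → if b then next i else (if does (i ℤ.≟ next i) then i else i)) (dec-true (i ℤ.≟ i) refl)

  sw-next : ∀ i → sw i (next i) ≡ i
  sw-next i rewrite dec-false (next i ℤ.≟ i) (λ e → ℤ.<-irrefl (sym e) (i<next i)) | dec-true (next i ℤ.≟ next i) refl = refl

  sw-other : ∀ i j → j ≢ i → j ≢ next i → sw i j ≡ j
  sw-other i j p q rewrite dec-false (j ℤ.≟ i) p | dec-false (j ℤ.≟ next i) q = refl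

  sw-cases : ∀ i j → (j ≡ i × sw i j ≡ next i) ⊎ ((j ≡ next i × sw i j ≡ i) ⊎ (j ≢ i × j ≢ next i × sw i j ≡ j))
  sw-cases i j with j ℤ.≟ i
  ... | yes refl = inj₁ (refl , refl)
  ... | no p with j ℤ.≟ next i
  ... | yes refl = inj₂ (inj₁ (refl , refl))
  ... | no q = inj₂ (inj₂ (p , q , refl))

  sw-involutive : ∀ i j → sw i (sw i j) ≡ j
  sw-involutive i j with sw-cases i j
  ... | inj₁ (refl , e) = trans (cong (sw i) e) (sw-next i)
  ... | inj₂ (inj₁ (refl , e)) = trans (cong (sw i) e) (sw-i i)
  ... | inj₂ (inj₂ (_ , _ , e)) = trans (cong (sw i) e) e

  sw-injective : ∀ i {j k} → sw i j ≡ sw i k → j ≡ k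
  sw-injective i {j} {k} e = trans (sym (sw-involutive i j)) (trans (cong (sw i) e) (sw-involutive i k))

  -- No integer lies strictly between `i` and `next i`, so only that pair can change its order.
  sw-mono : ∀ i {a b} → a < b → ¬ (a ≡ i × b ≡ next i) → sw i a < sw i b
  sw-mono i {a} {b} l n with sw-cases i a | sw-cases i b
  ... | inj₁ (refl , e) | inj₁ (refl , _) = ⊥-elim (ℤ.<-irrefl refl l)
  ... | inj₁ (refl , e) | inj₂ (inj₁ (refl , _)) = ⊥-elim (n (refl , refl))
  ... | inj₁ (refl , e) | inj₂ (inj₂ (_ , q , e′)) = subst₂ _<_ (sym e) (sym e′) (ℤ.≤∧≢⇒< (<⇒next≤ l) (λ r → q (sym r)))
  ... | inj₂ (inj₁ (refl , e)) | inj₁ (refl , _) = ⊥-elim (ℤ.<-asym l (i<next i))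
  ... | inj₂ (inj₁ (refl , e)) | inj₂ (inj₁ (refl , _)) = ⊥-elim (ℤ.<-irrefl refl l)
  ... | inj₂ (inj₁ (refl , e)) | inj₂ (inj₂ (_ , _ , e′)) = subst₂ _<_ (sym e) (sym e′) (ℤ.<-trans (i<next i) l)
  ... | inj₂ (inj₂ (_ , _ , e)) | inj₁ (refl , e′) = subst₂ _<_ (sym e) (sym e′) (ℤ.<-trans l (i<next i))
  ... | inj₂ (inj₂ (p , _ , e)) | inj₂ (inj₁ (refl , e′)) = subst₂ _<_ (sym e) (sym e′) (ℤ.≤∧≢⇒< (<next⇒≤ l) p)
  ... | inj₂ (inj₂ (_ , _ , e)) | inj₂ (inj₂ (_ , _ , e′)) = subst₂ _<_ (sym e) (sym e′) l

  rstep : ℤ → (ℤ → ℤ) → ℤ → ℤ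
  rstep i u = if does (u i ℤ.<? u (next i)) then (λ j → u (sw i j)) else u

  -- `v` is meant to be the inverse of `u`: left multiplication by s_i lengthens `u` when the
  -- inverse ascends at `i`.
  lstep : ℤ → (ℤ → ℤ) → (ℤ → ℤ) → ℤ → ℤ
  lstep i u v = if does (v i ℤ.<? v (next i)) then (λ j → sw i (u j)) else u

  rstep-asc : ∀ i u → u i < u (next i) → rstep i u ≗ (λ j → u (sw i j))
  rstep-asc i u l j = cong (λ b → (if b then (λ j → u (sw i j)) else u) j) (dec-true (u i ℤ.<? u (next i)) l)

  rstep-desc : ∀ i u → ¬ (u i < u (next i)) → rstep i u ≗ u
  rstep-desc i u l j = cong (λ b → (if b then (λ j → u (sw i j)) else u) j) (dec-false (u i ℤ.<? u (next i)) l)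

  lstep-asc : ∀ i u v → v i < v (next i) → lstep i u v ≗ (λ j → sw i (u j))
  lstep-asc i u v l j = cong (λ b → (if b then (λ j → sw i (u j)) else u) j) (dec-true (v i ℤ.<? v (next i)) l)

  lstep-desc : ∀ i u v → ¬ (v i < v (next i)) → lstep i u v ≗ u
  lstep-desc i u v l j = cong (λ b → (if b then (λ j → sw i (u j)) else u) j) (dec-false (v i ℤ.<? v (next i)) l)

  rstep-cong : ∀ i {u u′} → u ≗ u′ → rstep i u ≗ rstep i u′
  rstep-cong i {u} {u′} e j rewrite e i | e (next i) with does (u′ i ℤ.<? u′ (next i))
  ... | true = e (sw i j)
  ... | false = e j

  lstep-cong : ∀ i {u u′ v v′} → u ≗ u′ → v ≗ v′ → lstep i u v ≗ lstep i u′ v′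
  lstep-cong i {u} {u′} {v} {v′} e e′ j rewrite e′ i | e′ (next i) with does (v′ i ℤ.<? v′ (next i))
  ... | true = cong (sw i) (e j)
  ... | false = e j

  demAcc-cong : ∀ ws {u u′} → u ≗ u′ → demAcc u ws ≗ demAcc u′ ws
  demAcc-cong [] e = e
  demAcc-cong (i ∷ ws) e = demAcc-cong ws (rstep-cong i e)

  demAcc-∷ʳ : ∀ ws i u → demAcc u (ws ∷ʳ i) ≡ rstep i (demAcc u ws)
  demAcc-∷ʳ [] i u = refl
  demAcc-∷ʳ (j ∷ ws) i u = demAcc-∷ʳ ws i (rstep j u)

  Inverse : (ℤ → ℤ) → (ℤ → ℤ) → Set
  Inverse u v = (∀ j → u (v j) ≡ j) × (∀ j → v (u j) ≡ j)

  rinverse : ℤ → (ℤ → ℤ) → (ℤ → ℤ) → ℤ → ℤ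
  rinverse j u v = if does (u j ℤ.<? u (next j)) then (λ k → sw j (v k)) else v

  rinverse-Inverse : ∀ j u v → Inverse u v → Inverse (rstep j u) (rinverse j u v)
  rinverse-Inverse j u v (uv , vu) with does (u j ℤ.<? u (next j))
  ... | true = (λ k → trans (cong u (sw-involutive j (v k))) (uv k)) , λ k → trans (cong (sw j) (vu (sw j k))) (sw-involutive j k)
  ... | false = uv , vu

  rinverse-asc : ∀ j u v → u j < u (next j) → rinverse j u v ≗ (λ k → sw j (v k))
  rinverse-asc j u v l k = cong (λ b → (if b then (λ k → sw j (v k)) else v) k) (dec-true (u j ℤ.<? u (next j)) l)

  rinverse-desc : ∀ j u v → ¬ (u j < u (next j)) → rinverse j u v ≗ v
  rinverse-desc j u v l k = cong (λ b → (if b then (λ k → sw j (v k)) else v) k) (dec-false (u j ℤ.<? u (next j)) l)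

  -- Associativity of the Demazure product, one generator on each side.
  step-comm : ∀ i j u v → Inverse u v → rstep j (lstep i u v) ≗ lstep i (rstep j u) (rinverse j u v)
  step-comm i j u v (uv , vu) k = go (v i ℤ.<? v (next i)) (u j ℤ.<? u (next j)) (u j ℤ.≟ i ×-dec u (next j) ℤ.≟ next i)
    where
    open ≡-Reasoning
    su us sv : ℤ → ℤ
    su k = sw i (u k)
    us k = u (sw j k)
    sv k = sw j (v k)
    inj : ∀ {a b} → u a ≡ u b → a ≡ b
    inj {a} {b} r = trans (sym (vu a)) (trans (cong v r) (vu b))
    v-of : ∀ {a b} → u a ≡ b → v b ≡ a
    v-of {a} e = trans (cong v (sym e)) (vu a)
    u-of : ∀ {a b} → v a ≡ b → u b ≡ a
    u-of {a} e = trans (cong u (sym e)) (uv a)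
    unsw : ∀ m {a b} → sw m a ≡ b → a ≡ sw m b
    unsw m {a} e = trans (sym (sw-involutive m a)) (cong (sw m) e)
    same : u j ≡ i → u (next j) ≡ next i → su k ≡ us k
    same e e′ with sw-cases j k
    ... | inj₁ (refl , r) = trans (cong (sw i) e) (trans (sw-i i) (trans (sym e′) (cong u (sym r))))
    ... | inj₂ (inj₁ (refl , r)) = trans (cong (sw i) e′) (trans (sw-next i) (trans (sym e) (cong u (sym r))))
    ... | inj₂ (inj₂ (n₁ , n₂ , r)) = trans
      (sw-other i (u k) (λ t → n₁ (inj (trans t (sym e)))) (λ t → n₂ (inj (trans t (sym e′))))) (cong u (sym r))
    go : Dec (v i < v (next i)) → Dec (u j < u (next j)) → Dec (u j ≡ i × u (next j) ≡ next i) →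
      rstep j (lstep i u v) k ≡ lstep i (rstep j u) (rinverse j u v) k
    -- Here s_i u = u s_j: either side multiplies once and then meets a descent.
    go (yes p) (yes q) (yes (e , e′)) = begin
      rstep j (lstep i u v) k ≡⟨ rstep-cong j (lstep-asc i u v p) k ⟩
      rstep j su k ≡⟨ rstep-desc j su (λ l → ℤ.<-asym (i<next i)
        (subst₂ _<_ (trans (cong (sw i) e) (sw-i i)) (trans (cong (sw i) e′) (sw-next i)) l)) k ⟩
      su k ≡⟨ same e e′ ⟩
      us k ≡⟨ lstep-desc i us sv (λ l → ℤ.<-asym (i<next j)
        (subst₂ _<_ (trans (cong (sw j) (v-of e)) (sw-i j)) (trans (cong (sw j) (v-of e′)) (sw-next j)) l)) k ⟨
      lstep i us sv k ≡⟨ lstep-cong i (rstep-asc j u q) (rinverse-asc j u v q) k ⟨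
      lstep i (rstep j u) (rinverse j u v) k ∎
    go (yes p) (yes q) (no n) = begin
      rstep j (lstep i u v) k ≡⟨ rstep-cong j (lstep-asc i u v p) k ⟩
      rstep j su k ≡⟨ rstep-asc j su (sw-mono i q n) k ⟩
      sw i (u (sw j k)) ≡⟨ lstep-asc i us sv (sw-mono j p (λ (r , r′) → n (u-of r , u-of r′))) k ⟨
      lstep i us sv k ≡⟨ lstep-cong i (rstep-asc j u q) (rinverse-asc j u v q) k ⟨
      lstep i (rstep j u) (rinverse j u v) k ∎
    go (yes p) (no q) _ = begin
      rstep j (lstep i u v) k ≡⟨ rstep-cong j (lstep-asc i u v p) k ⟩
      rstep j su k ≡⟨ rstep-desc j su (λ l → q (subst₂ _<_ (sw-involutive i (u j)) (sw-involutive i (u (next j)))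
        (sw-mono i l λ (r , r′) → ℤ.<-asym p (subst₂ _<_
          (sym (v-of (trans (unsw i r) (sw-i i)))) (sym (v-of (trans (unsw i r′) (sw-next i)))) (i<next j))))) k ⟩
      su k ≡⟨ lstep-asc i u v p k ⟨
      lstep i u v k ≡⟨ lstep-cong i (rstep-desc j u q) (rinverse-desc j u v q) k ⟨
      lstep i (rstep j u) (rinverse j u v) k ∎
    go (no p) (yes q) _ = begin
      rstep j (lstep i u v) k ≡⟨ rstep-cong j (lstep-desc i u v p) k ⟩
      rstep j u k ≡⟨ rstep-asc j u q k ⟩
      us k ≡⟨ lstep-desc i us sv (λ l → p (subst₂ _<_ (sw-involutive j (v i)) (sw-involutive j (v (next i)))
        (sw-mono j l λ (r , r′) → ℤ.<-asym q (subst₂ _<_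
          (sym (u-of (trans (unsw j r) (sw-i j)))) (sym (u-of (trans (unsw j r′) (sw-next j)))) (i<next i))))) k ⟨
      lstep i us sv k ≡⟨ lstep-cong i (rstep-asc j u q) (rinverse-asc j u v q) k ⟨
      lstep i (rstep j u) (rinverse j u v) k ∎
    go (no p) (no q) _ = begin
      rstep j (lstep i u v) k ≡⟨ rstep-cong j (lstep-desc i u v p) k ⟩
      rstep j u k ≡⟨ rstep-desc j u q k ⟩
      u k ≡⟨ lstep-desc i u v p k ⟨
      lstep i u v k ≡⟨ lstep-cong i (rstep-desc j u q) (rinverse-desc j u v q) k ⟨
      lstep i (rstep j u) (rinverse j u v) k ∎

  -- The inverse is carried along because left ascents are read off from it.
  inverseAcc : (ℤ → ℤ) → (ℤ → ℤ) → List ℤ → ℤ → ℤ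
  inverseAcc u v [] = v
  inverseAcc u v (j ∷ ws) = inverseAcc (rstep j u) (rinverse j u v) ws

  inverseAcc-Inverse : ∀ ws u v → Inverse u v → Inverse (demAcc u ws) (inverseAcc u v ws)
  inverseAcc-Inverse [] u v h = h
  inverseAcc-Inverse (j ∷ ws) u v h = inverseAcc-Inverse ws (rstep j u) (rinverse j u v) (rinverse-Inverse j u v h)

  demAcc-lstep : ∀ i ws u v → Inverse u v → demAcc (lstep i u v) ws ≗ lstep i (demAcc u ws) (inverseAcc u v ws)
  demAcc-lstep i [] u v h k = refl
  demAcc-lstep i (j ∷ ws) u v h k = trans (demAcc-cong ws (step-comm i j u v h) k)
    (demAcc-lstep i ws (rstep j u) (rinverse j u v) (rinverse-Inverse j u v h) k)

-- Involution words and their reducedness.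

module InvolutionWords where

  open import Data.Integer using (_<_)
  open DemazureSteps

  Involutive : (ℤ → ℤ) → Set
  Involutive z = ∀ j → z (z j) ≡ j

  -- Words are stored last letter first: l stands for the word reverse l, and Z l is the
  -- involution w⁻¹ ∘ w, where w is the Demazure product of that word.
  Z : List ℤ → ℤ → ℤ
  Z l = dem (l ++ reverse l)

  -- Demazure conjugation s_i ∘ z ∘ s_i of an involution, which is its own inverse and so serves as
  -- both arguments of `lstep`.
  extend : ℤ → (ℤ → ℤ) → ℤ → ℤ
  extend i z = rstep i (lstep i z z)

  extend-cong : ∀ i {z z′} → z ≗ z′ → extend i z ≗ extend i z′
  extend-cong i e = rstep-cong i (lstep-cong i e e)

  -- The first generator is carried past the rest by `demAcc-lstep` and becomes a left factor. The
  -- inverse needed there is `Z l` itself, an involution.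
  Z-∷ : ∀ i l → Involutive (Z l) → Z (i ∷ l) ≗ extend i (Z l)
  Z-∷ i l inv k = begin
    dem ((i ∷ l) ++ reverse (i ∷ l)) k ≡⟨ cong (λ r → dem ((i ∷ l) ++ r) k) (List.unfold-reverse i l) ⟩
    dem ((i ∷ l) ++ (reverse l ∷ʳ i)) k ≡⟨ cong (λ r → dem r k) (sym (List.++-assoc (i ∷ l) (reverse l) (i ∷ []))) ⟩
    dem ((i ∷ ws) ∷ʳ i) k ≡⟨ cong (λ g → g k) (demAcc-∷ʳ (i ∷ ws) i (λ j → j)) ⟩
    rstep i (demAcc (rstep i (λ j → j)) ws) k ≡⟨ rstep-cong i (demAcc-cong ws first) k ⟩
    rstep i (demAcc (lstep i (λ j → j) (λ j → j)) ws) k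
      ≡⟨ rstep-cong i (demAcc-lstep i ws (λ j → j) (λ j → j) id-inverse) k ⟩
    rstep i (lstep i (Z l) v) k ≡⟨ rstep-cong i (lstep-cong i {Z l} (λ _ → refl) v≗Z) k ⟩
    extend i (Z l) k ∎
    where
    open ≡-Reasoning
    ws : List ℤ
    ws = l ++ reverse l
    id-inverse : Inverse (λ j → j) (λ j → j)
    id-inverse = (λ _ → refl) , (λ _ → refl)
    v : ℤ → ℤ
    v = inverseAcc (λ j → j) (λ j → j) ws
    v≗Z : v ≗ Z l
    v≗Z j = trans (cong v (sym (inv j))) (proj₂ (inverseAcc-Inverse ws (λ j → j) (λ j → j) id-inverse) (Z l j))
    first : rstep i (λ j → j) ≗ lstep i (λ j → j) (λ j → j)
    first j = trans (rstep-asc i (λ j → j) (i<next i) j) (sym (lstep-asc i (λ j → j) (λ j → j) (i<next i) j))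

  Fixes : ℤ → (ℤ → ℤ) → Set
  Fixes i z = z i ≡ i × z (next i) ≡ next i

  fixes? : ∀ i z → Dec (Fixes i z)
  fixes? i z = z i ℤ.≟ i ×-dec z (next i) ℤ.≟ next i

  fixes-comm : ∀ i z → Involutive z → Fixes i z → ∀ j → sw i (z j) ≡ z (sw i j)
  fixes-comm i z inv (e , e′) j with sw-cases i j
  ... | inj₁ (refl , r) = trans (cong (sw i) e) (trans (sw-i i) (trans (sym e′) (cong z (sym r))))
  ... | inj₂ (inj₁ (refl , r)) = trans (cong (sw i) e′) (trans (sw-next i) (trans (sym e) (cong z (sym r))))
  ... | inj₂ (inj₂ (n , n′ , r)) = trans (sw-other i (z j) (λ t → n (back t e)) (λ t → n′ (back t e′))) (cong z (sym r))
    where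
    back : ∀ {k} → z j ≡ k → z k ≡ k → j ≡ k
    back {k} t f = trans (sym (inv j)) (trans (cong z t) f)

  fixes-asc : ∀ i z → Fixes i z → z i < z (next i)
  fixes-asc i z (e , e′) = subst₂ _<_ (sym e) (sym e′) (i<next i)

  extend-fixes : ∀ i z → Fixes i z → extend i z ≗ (λ j → sw i (z j))
  extend-fixes i z f@(e , e′) j = trans (rstep-cong i (lstep-asc i z z (fixes-asc i z f)) j)
    (rstep-desc i (λ j → sw i (z j)) (λ l → ℤ.<-asym (i<next i)
      (subst₂ _<_ (trans (cong (sw i) e) (sw-i i)) (trans (cong (sw i) e′) (sw-next i)) l)) j)

  extend-asc : ∀ i z → z i < z (next i) → ¬ Fixes i z → extend i z ≗ (λ j → sw i (z (sw i j)))
  extend-asc i z l n j = trans (rstep-cong i (lstep-asc i z z l) j) (rstep-asc i (λ j → sw i (z j)) (sw-mono i l n) j)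

  extend-desc : ∀ i z → ¬ (z i < z (next i)) → extend i z ≗ z
  extend-desc i z n j = trans (rstep-cong i (lstep-desc i z z n) j) (rstep-desc i z n j)

  involutive-cong : ∀ {z z′} → z ≗ z′ → Involutive z → Involutive z′
  involutive-cong {z} {z′} e inv j = trans (sym (trans (cong z (e j)) (e (z′ j)))) (inv j)

  conj-involutive : ∀ i z → Involutive z → Involutive (λ j → sw i (z (sw i j)))
  conj-involutive i z inv j = trans (cong (λ k → sw i (z k)) (sw-involutive i (z (sw i j))))
    (trans (cong (sw i) (inv (sw i j))) (sw-involutive i j))

  extend-involutive : ∀ i z → Involutive z → Involutive (extend i z)
  extend-involutive i z inv = go (z i ℤ.<? z (next i)) (fixes? i z)
    where
    go : Dec (z i < z (next i)) → Dec (Fixes i z) → Involutive (extend i z)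
    go (no n) _ = involutive-cong (λ j → sym (extend-desc i z n j)) inv
    go (yes l) (no n) = involutive-cong (λ j → sym (extend-asc i z l n j)) (conj-involutive i z inv)
    go (yes l) (yes f) = involutive-cong (λ j → sym (extend-fixes i z f j))
      (λ j → trans (cong (sw i) (sym (fixes-comm i z inv f (z j)))) (trans (sw-involutive i (z (z j))) (inv j)))

  Z-involutive : ∀ l → Involutive (Z l)
  Z-involutive [] j = refl
  Z-involutive (i ∷ l) = involutive-cong (λ j → sym (Z-∷ i l (Z-involutive l) j)) (extend-involutive i (Z l) (Z-involutive l))

  Z-cons : ∀ i l → Z (i ∷ l) ≗ extend i (Z l)
  Z-cons i l = Z-∷ i l (Z-involutive l)

  -- Undoes `extend` at a descent. If `y` exchanges `i` and `next i`, conjugation would give back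
  -- `y`, so a one-sided factor is removed instead.
  restrict : ℤ → (ℤ → ℤ) → ℤ → ℤ
  restrict i y = if does (y i ℤ.≟ next i) then (λ j → sw i (y j)) else (λ j → sw i (y (sw i j)))

  restrict-pair : ∀ i y → y i ≡ next i → restrict i y ≗ (λ j → sw i (y j))
  restrict-pair i y e j = cong (λ b → (if b then (λ j → sw i (y j)) else (λ j → sw i (y (sw i j)))) j) (dec-true (y i ℤ.≟ next i) e)

  restrict-conj : ∀ i y → y i ≢ next i → restrict i y ≗ (λ j → sw i (y (sw i j)))
  restrict-conj i y e j = cong (λ b → (if b then (λ j → sw i (y j)) else (λ j → sw i (y (sw i j)))) j) (dec-false (y i ℤ.≟ next i) e)

  extend-restrict : ∀ i y → Involutive y → y (next i) < y i →
    extend i (restrict i y) ≗ y × restrict i y i < restrict i y (next i) × Involutive (restrict i y)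
  extend-restrict i y inv l = go (y i ℤ.≟ next i)
    where
    go : Dec (y i ≡ next i) → extend i (restrict i y) ≗ y × restrict i y i < restrict i y (next i) × Involutive (restrict i y)
    go (yes e) = (λ j → trans (extend-fixes i (restrict i y) fx j) (trans (cong (sw i) (restrict-pair i y e j)) (sw-involutive i (y j)))) ,
      fixes-asc i (restrict i y) fx , involutive-cong (λ j → sym (restrict-pair i y e j)) inv′
      where
      e′ : y (next i) ≡ i
      e′ = trans (cong y (sym e)) (inv i)
      fx : Fixes i (restrict i y)
      fx = trans (restrict-pair i y e i) (trans (cong (sw i) e) (sw-next i)) ,
           trans (restrict-pair i y e (next i)) (trans (cong (sw i) e′) (sw-i i))
      inv′ : Involutive (λ j → sw i (y j))
      inv′ j with sw-cases i (y j)
      ... | inj₁ (t , r) = trans (cong (λ k → sw i (y k)) r) (trans (cong (sw i) e′) (trans (sw-i i) (trans (trans (sym e) (cong y (sym t))) (inv j))))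
      ... | inj₂ (inj₁ (t , r)) = trans (cong (λ k → sw i (y k)) r) (trans (cong (sw i) e) (trans (sw-next i) (trans (trans (sym e′) (cong y (sym t))) (inv j))))
      ... | inj₂ (inj₂ (n , n′ , r)) = trans (cong (λ k → sw i (y k)) r) (trans (cong (sw i) (inv j))
        (sw-other i j (λ t → n′ (trans (cong y t) e)) (λ t → n (trans (cong y t) e′))))
    go (no n) = (λ j → trans (extend-asc i (restrict i y) asc nf j) (trans (cong (sw i) (restrict-conj i y n (sw i j)))
        (trans (sw-involutive i (y (sw i (sw i j)))) (cong y (sw-involutive i j))))) ,
      asc , involutive-cong (λ j → sym (restrict-conj i y n j)) (conj-involutive i y inv)
      where
      at-i : restrict i y i ≡ sw i (y (next i))
      at-i = trans (restrict-conj i y n i) (cong (λ k → sw i (y k)) (sw-i i))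
      at-next : restrict i y (next i) ≡ sw i (y i)
      at-next = trans (restrict-conj i y n (next i)) (cong (λ k → sw i (y k)) (sw-next i))
      asc : restrict i y i < restrict i y (next i)
      asc = subst₂ _<_ (sym at-i) (sym at-next) (sw-mono i l (λ (_ , r) → n r))
      nf : ¬ Fixes i (restrict i y)
      nf (f , f′) = ℤ.<-asym l (subst₂ _<_ (sym (sw-injective i (trans (trans (sym at-next) f′) (sym (sw-i i)))))
        (sym (sw-injective i (trans (trans (sym at-i) f) (sym (sw-next i))))) (i<next i))

  restrict-extend : ∀ i z y → Involutive z → z i < z (next i) → extend i z ≗ y → y (next i) < y i × z ≗ restrict i y
  restrict-extend i z y inv l e = go (fixes? i z)
    where
    go : Dec (Fixes i z) → y (next i) < y i × z ≗ restrict i y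
    go (yes f@(f₁ , f₂)) = subst₂ _<_ (sym (trans (val (next i)) (trans (cong (sw i) f₂) (sw-next i)))) (sym yi) (i<next i) ,
      λ j → sym (trans (restrict-pair i y yi j) (trans (cong (sw i) (val j)) (sw-involutive i (z j))))
      where
      val : ∀ j → y j ≡ sw i (z j)
      val j = trans (sym (e j)) (extend-fixes i z f j)
      yi : y i ≡ next i
      yi = trans (val i) (trans (cong (sw i) f₁) (sw-i i))
    go (no n) = subst₂ _<_ (sym (trans (val (next i)) (cong (λ k → sw i (z k)) (sw-next i)))) (sym yi) (sw-mono i l n) ,
      λ j → sym (trans (restrict-conj i y (λ r → bad (sw-injective i (trans (trans (sym yi) r) (sym (sw-i i))))) j)
        (trans (cong (sw i) (val (sw i j))) (trans (sw-involutive i (z (sw i (sw i j)))) (cong z (sw-involutive i j)))))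
      where
      val : ∀ j → y j ≡ sw i (z (sw i j))
      val j = trans (sym (e j)) (extend-asc i z l n j)
      yi : y i ≡ sw i (z (next i))
      yi = trans (val i) (cong (λ k → sw i (z k)) (sw-i i))
      bad : z (next i) ≡ i → ⊥
      bad r = ℤ.<-asym (i<next i) (subst₂ _<_ (trans (cong z (sym r)) (inv (next i))) r l)

  perm : List ℤ → ℤ → ℤ
  perm l = permOf (reverse l)

  permOf-∷ʳ : ∀ b i j → permOf (b ∷ʳ i) j ≡ permOf b (sw i j)
  permOf-∷ʳ [] i j = refl
  permOf-∷ʳ (a ∷ b) i j = cong (sw a) (permOf-∷ʳ b i j)

  Pm-∷ : ∀ i l j → perm (i ∷ l) j ≡ perm l (sw i j)
  Pm-∷ i l j = trans (cong (λ b → permOf b j) (List.unfold-reverse i l)) (permOf-∷ʳ (reverse l) i j)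

  Chain : List ℤ → Set
  Chain [] = ⊤
  Chain (i ∷ l) = Z l i < Z l (next i) × Chain l

  -- Atoms lie below their involution in weak order.
  inversions-of-Z : ∀ l → Chain l → ∀ p q → p < q → perm l q < perm l p → Z l q < Z l p
  inversions-of-Z [] _ p q l l′ = ⊥-elim (ℤ.<-asym l l′)
  inversions-of-Z (i ∷ l) (asc , ch) p q p<q inv = go (p ℤ.≟ i ×-dec q ℤ.≟ next i)
    where
    z : ℤ → ℤ
    z = Z l
    go : Dec (p ≡ i × q ≡ next i) → Z (i ∷ l) q < Z (i ∷ l) p
    go (yes (refl , refl)) = proj₁ (restrict-extend p z (Z (p ∷ l)) (Z-involutive l) asc (λ j → sym (Z-cons p l j)))
    go (no n) = subst₂ _<_ (sym (Z-cons i l q)) (sym (Z-cons i l p)) (moved (fixes? i z))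
      where
      sp<sq : sw i p < sw i q
      sp<sq = sw-mono i p<q n
      ih : z (sw i q) < z (sw i p)
      ih = inversions-of-Z l ch (sw i p) (sw i q) sp<sq (subst₂ _<_ (Pm-∷ i l q) (Pm-∷ i l p) inv)
      moved : Dec (Fixes i z) → extend i z q < extend i z p
      moved (yes f) = subst₂ _<_ (sym (trans (extend-fixes i z f q) (fixes-comm i z (Z-involutive l) f q)))
        (sym (trans (extend-fixes i z f p) (fixes-comm i z (Z-involutive l) f p))) ih
      moved (no nf) = subst₂ _<_ (sym (extend-asc i z asc nf q)) (sym (extend-asc i z asc nf p))
        (sw-mono i ih λ (r , r′) → ℤ.<-asym asc (subst₂ _<_
          (trans (sym (Z-involutive l (sw i p))) (cong z r′)) (trans (sym (Z-involutive l (sw i q))) (cong z r)) sp<sq))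

  Inversion : (ℤ → ℤ) → ℤ × ℤ → Set
  Inversion w (p , q) = p < q × w q < w p

  swap-pair : ℤ → ℤ × ℤ → ℤ × ℤ
  swap-pair i (p , q) = sw i p , sw i q

  swap-pair-injective : ∀ i {a b} → swap-pair i a ≡ swap-pair i b → a ≡ b
  swap-pair-injective i e = cong₂ _,_ (sw-injective i (cong proj₁ e)) (sw-injective i (cong proj₂ e))

  -- A descent of the permutation at `i` would by `inversions-of-Z` be one of `Z l`, against
  -- `Chain`. So every letter creates the new inversion (i, i + 1) and carries the earlier ones
  -- along.
  chain-inversions : ∀ l → Chain l → Σ (List (ℤ × ℤ)) λ L → Unique L × All (Inversion (perm l)) L × length L ≡ length l
  chain-inversions [] _ = [] , [] , [] , refl
  chain-inversions (i ∷ l) (asc , ch) with chain-inversions l ch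
  ... | L , u , a , e = (i , next i) ∷ List.map (swap-pair i) L ,
      All.map⁺ (All.map (λ {pq} (p<q , _) r → wrong pq p<q r) a) ∷ Unique.map⁺ (swap-pair-injective i) u ,
      (i<next i , subst₂ _<_ (sym (trans (Pm-∷ i l (next i)) (cong (perm l) (sw-next i)))) (sym (trans (Pm-∷ i l i) (cong (perm l) (sw-i i)))) asc′)
        ∷ All.map⁺ (All.map keep a) ,
      cong suc (trans (List.length-map (swap-pair i) L) e)
    where
    w : ℤ → ℤ
    w = perm l
    w-injective : ∀ b {j k} → permOf b j ≡ permOf b k → j ≡ k
    w-injective [] r = r
    w-injective (a ∷ b) r = w-injective b (sw-injective a r)
    asc′ : w i < w (next i)
    asc′ with ℤ.<-cmp (w i) (w (next i))
    ... | tri< lt _ _ = lt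
    ... | tri≈ _ r _ = ⊥-elim (ℤ.<-irrefl (w-injective (reverse l) r) (i<next i))
    ... | tri> _ _ gt = ⊥-elim (ℤ.<-asym asc (inversions-of-Z l ch i (next i) (i<next i) gt))
    wrong : ∀ pq → proj₁ pq < proj₂ pq → (i , next i) ≡ swap-pair i pq → ⊥
    wrong (p , q) p<q r = ℤ.<-asym (i<next i) (subst₂ _<_
      (sw-injective i (trans (sym (cong proj₁ r)) (sym (sw-next i)))) (sw-injective i (trans (sym (cong proj₂ r)) (sym (sw-i i)))) p<q)
    keep : ∀ {pq} → Inversion w pq → Inversion (perm (i ∷ l)) (swap-pair i pq)
    keep {p , q} (p<q , iv) = sw-mono i p<q (λ { (refl , refl) → ℤ.<-asym asc′ iv }) ,
      subst₂ _<_ (sym (trans (Pm-∷ i l (sw i q)) (cong w (sw-involutive i q)))) (sym (trans (Pm-∷ i l (sw i p)) (cong w (sw-involutive i p)))) iv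

  remove : ∀ {R : ℤ × ℤ → Set} (x : ℤ × ℤ) L → Unique L → All R L →
    Σ (List (ℤ × ℤ)) λ L′ → Unique L′ × All (λ y → y ≢ x × R y) L′ × length L ℕ.≤ suc (length L′)
  remove x [] u a = [] , [] , [] , z≤n
  remove x (y ∷ L) (y∉ ∷ u) (r ∷ a) with ≡-dec ℤ._≟_ ℤ._≟_ y x
  ... | yes refl = L , u , All.zipWith (λ (n , r) → (λ e → n (sym e)) , r) (y∉ , a) , ℕ.≤-refl
  ... | no n = y ∷ L″ , (All.map (λ (_ , ne , _) → ne) others ∷ proj₁ (proj₂ rest)) ,
      ((n , r) ∷ All.map (λ (ne , _ , r) → ne , r) others) , s≤s (proj₂ (proj₂ (proj₂ rest)))
    where
    rest = remove x L u (All.zip (y∉ , a))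
    L″ : List (ℤ × ℤ)
    L″ = proj₁ rest
    others = proj₁ (proj₂ (proj₂ rest))

  -- Once the pair (i, i + 1) is discarded, the swap sends the inversions injectively to inversions
  -- of the shorter word.
  inversions-bound : ∀ l L → Unique L → All (Inversion (perm l)) L → length L ℕ.≤ length l
  inversions-bound [] [] _ _ = z≤n
  inversions-bound [] ((p , q) ∷ L) _ ((p<q , q<p) ∷ _) = ⊥-elim (ℤ.<-asym p<q q<p)
  inversions-bound (i ∷ l) L u a with remove (i , next i) L u a
  ... | L′ , u′ , a′ , le = ℕ.≤-trans le (s≤s (subst (ℕ._≤ length l) (List.length-map (swap-pair i) L′)
      (inversions-bound l (List.map (swap-pair i) L′) (Unique.map⁺ (swap-pair-injective i) u′) (All.map⁺ (All.map moved a′)))))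
    where
    moved : ∀ {pq} → pq ≢ (i , next i) × Inversion (perm (i ∷ l)) pq → Inversion (perm l) (swap-pair i pq)
    moved {p , q} (n , p<q , iv) = sw-mono i p<q (λ (e , e′) → n (cong₂ _,_ e e′)) , subst₂ _<_ (Pm-∷ i l q) (Pm-∷ i l p) iv

  -- Inversions depend on the permutation alone and bound the length of each of its words from
  -- below; a chain has as many inversions as letters.
  chain-reduced : ∀ l → Chain l → Reduced (reverse l)
  chain-reduced l ch b e with chain-inversions l ch
  ... | L , u , a , len = subst₂ ℕ._≤_ (trans len (sym (List.length-reverse l))) (List.length-reverse b)
    (inversions-bound (reverse b) L u (All.map (λ {pq} → convert {pq}) a))
    where
    same : ∀ j → perm l j ≡ perm (reverse b) j
    same j = trans (sym (e j)) (cong (λ c → permOf c j) (sym (List.reverse-involutive b)))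
    convert : ∀ {pq} → Inversion (perm l) pq → Inversion (perm (reverse b)) pq
    convert {p , q} (p<q , iv) = p<q , subst₂ _<_ (same q) (same p) iv

-- Reading an involution as an arc word.

module ArcRuns where

  open import Data.Integer using (_+_; _<_; _≤_)
  open ArcWords
  open ArcWordProperties
  open Coefficients using (blank)
  open DemazureSteps
  open InvolutionWords

  -- The absence of nesting: an opener later in the queue has a later closer.
  Times : (ℤ → ℤ) → ℤ → List ℤ → Set
  Times y p [] = ⊤
  Times y p (k ∷ Q) = p ≤ y k × Times y (next (y k)) Q

  -- Reading the word of y from left to right, Q is the queue of the open arcs: a closing
  -- position is matched with the oldest open one, since arcs are not nested.
  data Run (y : ℤ → ℤ) : ℤ → List ℤ → List Sym → Set where
    end : ∀ {p} → (∀ j → p ≤ j → y j ≡ j) → Run y p [] []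
    run-dot : ∀ {p Q w} → y p ≡ p → Run y (next p) Q w → Run y p Q (dot ∷ w)
    run-op : ∀ {p Q w} → Run y (next p) (Q ∷ʳ p) w → Run y p Q (op ∷ w)
    run-cl : ∀ {p k Q w} → y p ≡ k → y k ≡ p → Run y (next p) Q w → Run y p (k ∷ Q) (cl ∷ w)

  Queue : ℤ → List ℤ → Set
  Queue p Q = AllPairs.AllPairs _<_ Q × All (_< p) Q

  queue-next : ∀ {p Q} → Queue p Q → Queue (next p) Q
  queue-next {p} (s , a) = s , All.map (λ l → ℤ.<-trans l (i<next p)) a

  queue-op : ∀ {p Q} → Queue p Q → Queue (next p) (Q ∷ʳ p)
  queue-op {p} (s , a) = AllPairs.++⁺ s ([] ∷ []) (All.map (λ l → l ∷ []) a) , All.∷ʳ⁺ (All.map (λ l → ℤ.<-trans l (i<next p)) a) (i<next p)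

  times-weaken : ∀ {y p p′} Q → p′ ≤ p → Times y p Q → Times y p′ Q
  times-weaken [] l t = tt
  times-weaken (k ∷ Q) l (m , t) = ℤ.≤-trans l m , t

  times-init : ∀ {y p} Q {k} → Times y p (Q ∷ʳ k) → Times y p Q
  times-init [] t = tt
  times-init (a ∷ Q) (m , t) = m , times-init Q t

  times-last : ∀ {y p} Q {k} → Times y p (Q ∷ʳ k) → p ≤ y k
  times-last [] (m , _) = m
  times-last {y} {p} (a ∷ Q) (m , t) = ℤ.≤-trans m (ℤ.≤-trans (ℤ.<⇒≤ (i<next (y a))) (times-last Q t))

  times-last₂ : ∀ {y p} Q {k k′} → Times y p (Q ∷ʳ k ∷ʳ k′) → y k < y k′
  times-last₂ {y} [] {k} (_ , m , _) = ℤ.<-≤-trans (i<next (y k)) m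
  times-last₂ (a ∷ Q) (_ , t) = times-last₂ Q t

  run-times : ∀ {y p Q w} → Run y p Q w → Times y p Q
  run-times (end h) = tt
  run-times {p = p} (run-dot e r) = times-weaken _ (ℤ.<⇒≤ (i<next p)) (run-times r)
  run-times {p = p} {Q} (run-op r) = times-weaken Q (ℤ.<⇒≤ (i<next p)) (times-init Q (run-times r))
  run-times {y} {p} {k ∷ Q} (run-cl e e′ r) = ℤ.≤-reflexive (sym e′) , subst (λ q → Times y (next q) Q) (sym e′) (run-times r)

  run-balanced : ∀ {y p Q w} → Run y p Q w → Balanced (length Q) w
  run-balanced (end _) = done
  run-balanced (run-dot _ r) = stay (run-balanced r)
  run-balanced {Q = Q} {op ∷ w} (run-op {p} r) = open′ (subst (λ d → Balanced d w) (List.length-++-comm Q (p ∷ [])) (run-balanced r))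
  run-balanced (run-cl _ _ r) = close (run-balanced r)

  +-suc-next : ∀ p i → p + + suc i ≡ next p + + i
  +-suc-next p i = sym (ℤ.+-assoc p 1ℤ (+ i))

  -- Pairs on which `rem` is undefined are ascents: `op op` because older arcs close first, `cl cl`
  -- because the queue is sorted, and in the others the left value is at most its site and the right
  -- value at least its site.
  descent-found : ∀ {y p Q} w → Run y p Q w → Queue p Q → ∀ j → p ≤ j → y (next j) < y j →
    Σ ℕ λ i → j ≡ p + + i × Σ (List Sym) λ w′ → rem (length Q) i w ≡ just w′
  descent-found [] (end h) _ j l d = ⊥-elim (ℤ.<-asym (i<next j)
    (subst₂ _<_ (h (next j) (ℤ.≤-trans l (ℤ.<⇒≤ (i<next j)))) (h j l) d))
  descent-found {y} {p} {Q} (a ∷ w) r q j l d with p ℤ.≟ j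
  ... | no p≢j = later a r
    where
    l′ : next p ≤ j
    l′ = <⇒next≤ (ℤ.≤∧≢⇒< l p≢j)
    lift : ∀ a d′ → d′ ≡ depth a (length Q) → (Σ ℕ λ i → j ≡ next p + + i × Σ (List Sym) λ w′ → rem d′ i w ≡ just w′) →
      Σ ℕ λ i → j ≡ p + + i × Σ (List Sym) λ w′ → rem (length Q) i (a ∷ w) ≡ just w′
    lift a d′ e (i , ji , w′ , h) = suc i , trans ji (sym (+-suc-next p i)) , a ∷ w′ ,
      cong (Maybe.map (a ∷_)) (trans (cong (λ d → rem d i w) (sym e)) h)
    later : ∀ a → Run y p Q (a ∷ w) → Σ ℕ λ i → j ≡ p + + i × Σ (List Sym) λ w′ → rem (length Q) i (a ∷ w) ≡ just w′
    later dot (run-dot e r) = lift dot (length Q) refl (descent-found w r (queue-next q) j l′ d)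
    later op (run-op r) = lift op _ (List.length-++-comm Q (p ∷ [])) (descent-found w r (queue-op q) j l′ d)
    later cl (run-cl {k = k} {Q′} e e′ r) = lift cl (length Q′) refl (descent-found w r (queue-next (tail q)) j l′ d)
      where
      tail : Queue p (k ∷ Q′) → Queue p Q′
      tail (_ ∷ s , _ ∷ a) = s , a
  ... | yes refl = 0 , sym (ℤ.+-identityʳ p) , now a w r
    where
    high : ∀ {Q} w → Run y (next p) Q w → (∀ w′ → w ≢ cl ∷ w′) → next p ≤ y (next p)
    high [] (end h) n = ℤ.≤-reflexive (sym (h (next p) ℤ.≤-refl))
    high (dot ∷ w) (run-dot e r) n = ℤ.≤-reflexive (sym e)
    high {Q} (op ∷ w) (run-op r) n = ℤ.≤-trans (ℤ.<⇒≤ (i<next (next p))) (times-last Q (run-times r))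
    high (cl ∷ w) r n = ⊥-elim (n w refl)
    now : ∀ a w → Run y p Q (a ∷ w) → Σ (List Sym) λ w′ → rem (length Q) 0 (a ∷ w) ≡ just w′
    now dot (cl ∷ w) (run-dot e (run-cl _ _ r)) = _ , refl
    now dot [] (run-dot e r) = ⊥-elim (ℤ.<-asym (i<next p) (ℤ.≤-<-trans (high [] r (λ _ ())) (subst (y (next p) <_) e d)))
    now dot (dot ∷ w) (run-dot e r) = ⊥-elim (ℤ.<-asym (i<next p) (ℤ.≤-<-trans (high (dot ∷ w) r (λ _ ())) (subst (y (next p) <_) e d)))
    now dot (op ∷ w) (run-dot e r) = ⊥-elim (ℤ.<-asym (i<next p) (ℤ.≤-<-trans (high (op ∷ w) r (λ _ ())) (subst (y (next p) <_) e d)))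
    now op [] (run-op r) = ⊥-elim (nonempty Q r)
      where
      nonempty : ∀ Q → ¬ Run y (next p) (Q ∷ʳ p) []
      nonempty [] ()
      nonempty (_ ∷ _) ()
    now op (dot ∷ w) (run-op r) = _ , refl
    now op (op ∷ w) (run-op (run-op r)) = ⊥-elim (ℤ.<-asym d (times-last₂ Q (run-times r)))
    now op (cl ∷ w) (run-op r) with length Q
    ... | zero = _ , refl
    ... | suc _ = _ , refl
    now cl w (run-cl {k = k} {Q′} e e′ r) = ⊥-elim (absurd w r q)
      where
      absurd : ∀ w → Run y (next p) Q′ w → Queue p (k ∷ Q′) → ⊥
      absurd (cl ∷ w) (run-cl {k = k′} f f′ r) ((k<k′ ∷ _) ∷ _ , _) = ℤ.<-asym k<k′ (subst₂ _<_ f e d)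
      absurd [] r (_ , k<p ∷ _) = ℤ.<-asym (ℤ.<-trans k<p (i<next p)) (ℤ.≤-<-trans (high [] r (λ _ ())) (subst (y (next p) <_) e d))
      absurd (dot ∷ w) r (_ , k<p ∷ _) = ℤ.<-asym (ℤ.<-trans k<p (i<next p)) (ℤ.≤-<-trans (high (dot ∷ w) r (λ _ ())) (subst (y (next p) <_) e d))
      absurd (op ∷ w) r (_ , k<p ∷ _) = ℤ.<-asym (ℤ.<-trans k<p (i<next p)) (ℤ.≤-<-trans (high (op ∷ w) r (λ _ ())) (subst (y (next p) <_) e d))

  run-cong : ∀ {y y′ p Q w} → y ≗ y′ → Run y p Q w → Run y′ p Q w
  run-cong e (end h) = end (λ j l → trans (sym (e j)) (h j l))
  run-cong {p = p} e (run-dot f r) = run-dot (trans (sym (e p)) f) (run-cong e r)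
  run-cong e (run-op r) = run-op (run-cong e r)
  run-cong {p = p} e (run-cl {k = k} f f′ r) = run-cl (trans (sym (e p)) f) (trans (sym (e k)) f′) (run-cong e r)

  sw-below : ∀ p j → j < p → sw p j ≡ j
  sw-below p j l = sw-other p j (ℤ.<⇒≢ l) (ℤ.<⇒≢ (ℤ.<-trans l (i<next p)))

  sw-above : ∀ p j → next p < j → sw p j ≡ j
  sw-above p j l = sw-other p j (λ e → ℤ.<-irrefl (sym e) (ℤ.<-trans (i<next p) l)) (λ e → ℤ.<-irrefl (sym e) l)

  -- Behind the two sites, conjugation only renames `p` and `next p` in the queue.
  run-conj : ∀ p {y q Q w} → next p < q → Run y q Q w → Run (λ j → sw p (y (sw p j))) q (List.map (sw p) Q) w
  run-conj p {y} {q} l (end h) = end (λ j m → let m′ = sw-above p j (ℤ.<-≤-trans l m) in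
    trans (cong (λ k → sw p (y k)) m′) (trans (cong (sw p) (h j m)) m′))
  run-conj p {y} {q} l (run-dot e r) = run-dot (trans (cong (λ k → sw p (y k)) (sw-above p q l)) (trans (cong (sw p) e) (sw-above p q l)))
    (run-conj p (ℤ.<-trans l (i<next q)) r)
  run-conj p {y} {q} {Q} {op ∷ w} l (run-op r) = run-op (subst (λ Q′ → Run _ (next q) Q′ w)
    (trans (List.map-++ (sw p) Q (q ∷ [])) (cong (λ k → List.map (sw p) Q ∷ʳ k) (sw-above p q l))) (run-conj p (ℤ.<-trans l (i<next q)) r))
  run-conj p {y} {q} l (run-cl {k = k} e e′ r) = run-cl (trans (cong (λ k → sw p (y k)) (sw-above p q l)) (cong (sw p) e))
    (trans (cong (λ k → sw p (y k)) (sw-involutive p k)) (trans (cong (sw p) e′) (sw-above p q l))) (run-conj p (ℤ.<-trans l (i<next q)) r)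

  -- Serves the move that erases an arc: its two ends have left the queue, and `y` changes nowhere
  -- else.
  run-agree : ∀ p {y y′ q Q w} → (∀ a → a ≢ p → a ≢ next p → y′ a ≡ y a) → next p < q →
    All (λ k → k ≢ p × k ≢ next p) Q → Run y q Q w → Run y′ q Q w
  run-agree p {q = q} h l a (end f) = end (λ j m → let n , n′ = away (ℤ.<-≤-trans l m) in trans (h j n n′) (f j m))
    where
    away : ∀ {j} → next p < j → j ≢ p × j ≢ next p
    away m = (λ e → ℤ.<-irrefl (sym e) (ℤ.<-trans (i<next p) m)) , (λ e → ℤ.<-irrefl (sym e) m)
  run-agree p {q = q} h l a (run-dot e r) = run-dot (trans (h q (proj₁ far) (proj₂ far)) e) (run-agree p h (ℤ.<-trans l (i<next q)) a r)
    where
    far : q ≢ p × q ≢ next p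
    far = (λ e → ℤ.<-irrefl (sym e) (ℤ.<-trans (i<next p) l)) , (λ e → ℤ.<-irrefl (sym e) l)
  run-agree p {q = q} h l a (run-op r) = run-op (run-agree p h (ℤ.<-trans l (i<next q)) (All.∷ʳ⁺ a far) r)
    where
    far : q ≢ p × q ≢ next p
    far = (λ e → ℤ.<-irrefl (sym e) (ℤ.<-trans (i<next p) l)) , (λ e → ℤ.<-irrefl (sym e) l)
  run-agree p {q = q} h l ((n , n′) ∷ a) (run-cl {k = k} e e′ r) =
    run-cl (trans (h q (proj₁ far) (proj₂ far)) e) (trans (h k n n′) e′) (run-agree p h (ℤ.<-trans l (i<next q)) a r)
    where
    far : q ≢ p × q ≢ next p
    far = (λ e → ℤ.<-irrefl (sym e) (ℤ.<-trans (i<next p) l)) , (λ e → ℤ.<-irrefl (sym e) l)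

  map-sw-below : ∀ p Q → All (_< p) Q → List.map (sw p) Q ≡ Q
  map-sw-below p [] [] = refl
  map-sw-below p (k ∷ Q) (l ∷ a) = cong₂ _∷_ (sw-below p k l) (map-sw-below p Q a)

  restrict-below : ∀ j y {a b} → a < j → b < j → y a ≡ b → restrict j y a ≡ b
  restrict-below j y {a} {b} la lb e = go (y j ℤ.≟ next j)
    where
    go : Dec (y j ≡ next j) → restrict j y a ≡ b
    go (yes f) = trans (restrict-pair j y f a) (trans (cong (sw j) e) (sw-below j b lb))
    go (no n) = trans (restrict-conj j y n a) (trans (cong (λ k → sw j (y k)) (sw-below j a la)) (trans (cong (sw j) e) (sw-below j b lb)))

  -- Identifies `rem` on words with `restrict` on involutions. Symbols left of the pair survive
  -- because their sites and the queued openers lie below it, and an `op` does not record where its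
  -- arc closes.
  run-restrict : ∀ {y p Q} i w {w′} → Involutive y → Run y p Q w → Queue p Q → rem (length Q) i w ≡ just w′ →
    y (next (p + + i)) < y (p + + i) × Run (restrict (p + + i) y) p Q w′
  run-restrict {y} {p} {Q} zero w {w′} inv r q e rewrite ℤ.+-identityʳ p = at-front w r q e
    where
    p<nn : next p < next (next p)
    p<nn = i<next (next p)
    conj : ∀ {Q w} → y p ≢ next p → Run y (next (next p)) Q w → Run (restrict p y) (next (next p)) (List.map (sw p) Q) w
    conj n r = run-cong (λ j → sym (restrict-conj p y n j)) (run-conj p p<nn r)
    at : y p ≢ next p → ∀ {a b c d} → sw p a ≡ c → y c ≡ d → sw p d ≡ b → restrict p y a ≡ b
    at n {a} e₁ e₂ e₃ = trans (restrict-conj p y n a) (trans (cong (λ k → sw p (y k)) e₁) (trans (cong (sw p) e₂) e₃))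
    shifted : ∀ Q → All (_< p) Q → List.map (sw p) (Q ∷ʳ p) ≡ Q ∷ʳ next p
    shifted Q a = trans (List.map-++ (sw p) Q (p ∷ [])) (cong₂ (λ Q′ k → Q′ ∷ʳ k) (map-sw-below p Q a) (sw-i p))
    at-front : ∀ {Q} w {w′} → Run y p Q w → Queue p Q → rem (length Q) 0 w ≡ just w′ → y (next p) < y p × Run (restrict p y) p Q w′
    at-front {Q} (op ∷ dot ∷ w) (run-op (run-dot e r)) q refl =
      subst (_< y p) (sym e) (ℤ.<-≤-trans p<nn m) ,
      run-dot (at n (sw-i p) e (sw-next p)) (run-op (subst (λ Q′ → Run _ _ Q′ w) (shifted Q (proj₂ q)) (conj n r)))
      where
      m : next (next p) ≤ y p
      m = times-last Q (run-times r)
      n : y p ≢ next p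
      n e = ℤ.<-irrefl (sym e) (ℤ.<-≤-trans p<nn m)
    at-front {k ∷ Q} (dot ∷ cl ∷ w) (run-dot e (run-cl f f′ r)) (_ , k<p ∷ a) refl =
      subst₂ _<_ (sym f) (sym e) k<p ,
      run-cl (at n (sw-i p) f (sw-below p k k<p)) (at n (sw-below p k k<p) f′ (sw-next p))
        (run-dot (at n (sw-next p) e (sw-i p)) (subst (λ Q′ → Run _ _ Q′ w) (map-sw-below p Q a) (conj n r)))
      where
      n : y p ≢ next p
      n t = ℤ.<-irrefl (trans (sym e) t) (i<next p)
    at-front {[]} (op ∷ cl ∷ w) (run-op (run-cl f f′ r)) q refl =
      subst₂ _<_ (sym f) (sym f′) (i<next p) ,
      run-dot (trans (restrict-pair p y f′ p) (trans (cong (sw p) f′) (sw-next p)))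
        (run-dot (trans (restrict-pair p y f′ (next p)) (trans (cong (sw p) f) (sw-i p)))
          (run-agree p (λ a n n′ → trans (restrict-pair p y f′ a) (sw-other p (y a)
            (λ t → n′ (trans (sym (inv a)) (trans (cong y t) f′))) (λ t → n (trans (sym (inv a)) (trans (cong y t) f))))) p<nn [] r))
    at-front {k ∷ Q} (op ∷ cl ∷ w) (run-op (run-cl f f′ r)) (_ , k<p ∷ a) refl =
      subst (_< y p) (sym f) (ℤ.<-trans k<p (ℤ.<-≤-trans (ℤ.<-trans (i<next p) p<nn) (times-last Q (run-times r)))) ,
      run-cl (at n (sw-i p) f (sw-below p k k<p)) (at n (sw-below p k k<p) f′ (sw-next p))
        (run-op (subst (λ Q′ → Run _ _ Q′ w) (shifted Q a) (conj n r)))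
      where
      n : y p ≢ next p
      n t = ℤ.<-irrefl (trans (sym f) (trans (cong y (sym t)) (inv p))) k<p
    at-front {k ∷ Q} (dot ∷ op ∷ w) _ _ ()
    at-front {k ∷ Q} (dot ∷ dot ∷ w) _ _ ()
  run-restrict {y} {p} {Q} (suc i) (a ∷ w) inv r q e with map-just _ (rem (depth a (length Q)) i w) e
  ... | v , e′ , refl rewrite +-suc-next p i = go a r e′
    where
    j : ℤ
    j = next p + + i
    p<j : p < j
    p<j = ℤ.<-≤-trans (i<next p) (subst (_≤ j) (ℤ.+-identityʳ (next p)) (ℤ.+-monoʳ-≤ (next p) (ℤ.+≤+ z≤n)))
    go : ∀ a → Run y p Q (a ∷ w) → rem (depth a (length Q)) i w ≡ just v → y (next j) < y j × Run (restrict j y) p Q (a ∷ v)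
    go dot (run-dot f r) e = let d , r′ = run-restrict i w inv r (queue-next q) e in
      d , run-dot (restrict-below j y p<j p<j f) r′
    go op (run-op r) e = let d , r′ = run-restrict i w inv r (queue-op q) (trans (cong (λ d → rem d i w) (List.length-++-comm Q (p ∷ []))) e) in
      d , run-op r′
    go cl (run-cl {k = k} {Q′} f f′ r) e = let d , r′ = run-restrict i w inv r (queue-next (tail q)) e in
      d , run-cl (restrict-below j y p<j k<j f) (restrict-below j y k<j p<j f′) r′
      where
      tail : Queue p (k ∷ Q′) → Queue p Q′
      tail (_ ∷ s , _ ∷ a) = s , a
      k<j : k < j
      k<j = ℤ.<-trans (All.head (proj₂ q)) p<j

-- Atom words as removal sequences.

module AtomWords where

  open import Data.Integer using (_+_; _<_; _≤_)
  open ArcWords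
  open ArcWordProperties
  open Coefficients using (blank)
  open DemazureSteps
  open InvolutionWords
  open ArcRuns

  -- The length of the involution words: one for each arc, plus the number of arcs that are
  -- open at each dot and each op.
  degree : ℕ → List Sym → ℕ
  degree d [] = 0
  degree d (op ∷ w) = suc d ℕ.+ degree (suc d) w
  degree d (cl ∷ w) = degree (ℕ.pred d) w
  degree d (dot ∷ w) = d ℕ.+ degree d w

  degree-rem : ∀ d i w {w′} → rem d i w ≡ just w′ → degree d w ≡ suc (degree d w′)
  degree-rem d zero (op ∷ dot ∷ w) refl = refl
  degree-rem zero zero (op ∷ cl ∷ w) refl = refl
  degree-rem (suc d) zero (op ∷ cl ∷ w) refl = refl
  degree-rem (suc d) zero (dot ∷ cl ∷ w) refl = refl
  degree-rem d (suc i) (a ∷ w) e with map-just _ (rem (depth a d) i w) e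
  ... | v , e′ , refl = go a e′
    where
    go : ∀ a → rem (depth a d) i w ≡ just v → degree d (a ∷ w) ≡ suc (degree d (a ∷ v))
    go op e = trans (cong (suc d ℕ.+_) (degree-rem (suc d) i w e)) (ℕ.+-suc (suc d) _)
    go cl e = degree-rem (ℕ.pred d) i w e
    go dot e = trans (cong (d ℕ.+_) (degree-rem d i w e)) (ℕ.+-suc d _)

  -- The letters are listed in the order of removal, that is, from the end of the word.
  Peel : List Sym → List ℕ → Set
  Peel w [] = blank w ≡ 1
  Peel w (i ∷ l) = Σ (List Sym) λ w′ → rem 0 i w ≡ just w′ × Peel w′ l

  blank-degree : ∀ w → blank w ≡ 1 → degree 0 w ≡ 0
  blank-degree [] e = refl
  blank-degree (dot ∷ w) e = blank-degree w e

  peel-degree : ∀ w l → Peel w l → length l ≡ degree 0 w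
  peel-degree w [] e = sym (blank-degree w e)
  peel-degree w (i ∷ l) (w′ , e , p) = trans (cong suc (peel-degree w′ l p)) (sym (degree-rem 0 i w e))

  -- An arc is open after the first symbol, so a closer must come. Before the first closer stand
  -- only openers and dots; the last of them moves against the closer, unless an earlier `op dot`
  -- can be moved.
  removable : ∀ d a w → (a ≡ op × Balanced (suc d) w) ⊎ (a ≡ dot × Balanced d w × 1 ℕ.≤ d) →
    Σ ℕ λ i → Σ (List Sym) λ w′ → rem d i (a ∷ w) ≡ just w′
  removable d .op (dot ∷ w) (inj₁ (refl , _)) = 0 , _ , refl
  removable zero .op (cl ∷ w) (inj₁ (refl , _)) = 0 , _ , refl
  removable (suc d) .op (cl ∷ w) (inj₁ (refl , _)) = 0 , _ , refl
  removable d .op (op ∷ w) (inj₁ (refl , open′ b)) = let i , w′ , e = removable (suc d) op w (inj₁ (refl , b)) in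
    suc i , op ∷ w′ , cong (Maybe.map (op ∷_)) e
  removable (suc d) .dot (cl ∷ w) (inj₂ (refl , _ , _)) = 0 , _ , refl
  removable (suc d) .dot (op ∷ w) (inj₂ (refl , open′ b , _)) = let i , w′ , e = removable (suc d) op w (inj₁ (refl , b)) in
    suc i , dot ∷ w′ , cong (Maybe.map (dot ∷_)) e
  removable (suc d) .dot (dot ∷ w) (inj₂ (refl , stay b , l)) = let i , w′ , e = removable (suc d) dot w (inj₂ (refl , b , l)) in
    suc i , dot ∷ w′ , cong (Maybe.map (dot ∷_)) e

  blank-or-removable : ∀ w → Balanced 0 w → blank w ≡ 1 ⊎ Σ ℕ λ i → Σ (List Sym) λ w′ → rem 0 i w ≡ just w′
  blank-or-removable [] _ = inj₁ refl
  blank-or-removable (op ∷ w) (open′ b) = inj₂ (removable 0 op w (inj₁ (refl , b)))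
  blank-or-removable (dot ∷ w) (stay b) with blank-or-removable w b
  ... | inj₁ e = inj₁ e
  ... | inj₂ (i , w′ , e) = inj₂ (suc i , dot ∷ w′ , cong (Maybe.map (dot ∷_)) e)

  peel-exists : ∀ N w → degree 0 w ≡ N → Balanced 0 w → Σ (List ℕ) (Peel w)
  peel-exists N w e b with blank-or-removable w b
  peel-exists N w e b | inj₁ z = [] , z
  peel-exists zero w e b | inj₂ (i , w′ , r) with trans (sym e) (degree-rem 0 i w r)
  ... | ()
  peel-exists (suc N) w e b | inj₂ (i , w′ , r) =
    let l , p = peel-exists N w′ (ℕ.suc-injective (trans (sym (degree-rem 0 i w r)) e)) (rem-balanced 0 i w b w′ r) in i ∷ l , w′ , r , p

  record Represents (o : ℤ) (w : List Sym) (y : ℤ → ℤ) : Set where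
    field
      involutive : Involutive y
      before : ∀ j → j < o → y j ≡ j
      run : Run y o [] w

  represents-rem : ∀ {o w y} i {w′} → Represents o w y → rem 0 i w ≡ just w′ →
    y (next (o + + i)) < y (o + + i) × Represents o w′ (restrict (o + + i) y)
  represents-rem {o} {w} {y} i R e = d , record
    { involutive = proj₂ (proj₂ (extend-restrict (o + + i) y involutive d))
    ; before = λ j l → let l′ = ℤ.<-≤-trans l o≤ in restrict-below (o + + i) y l′ l′ (before j l)
    ; run = r }
    where
    open Represents R
    o≤ : o ≤ o + + i
    o≤ = subst (_≤ o + + i) (ℤ.+-identityʳ o) (ℤ.+-monoʳ-≤ o (ℤ.+≤+ z≤n))
    d = proj₁ (run-restrict i w involutive run ([] , []) e)
    r = proj₂ (run-restrict i w involutive run ([] , []) e)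

  -- Before the origin `y` is the identity, and at the origin it does not go down, so every descent
  -- lies inside the word.
  represents-descent : ∀ {o w y} → Represents o w y → ∀ j → y (next j) < y j →
    Σ ℕ λ i → j ≡ o + + i × Σ (List Sym) λ w′ → rem 0 i w ≡ just w′
  represents-descent {o} {w} {y} R j d with o ℤ.≤? j
  ... | yes l = descent-found w run ([] , []) j l d
    where open Represents R
  ... | no n = ⊥-elim (ℤ.<-asym (i<next j) (ℤ.≤-<-trans (high (next j ℤ.≟ o)) (subst (y (next j) <_) (before j j<o) d)))
    where
    open Represents R
    j<o : j < o
    j<o = ℤ.≰⇒> n
    start : ∀ w → Run y o [] w → o ≤ y o
    start [] (end h) = ℤ.≤-reflexive (sym (h o ℤ.≤-refl))
    start (dot ∷ w) (run-dot e _) = ℤ.≤-reflexive (sym e)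
    start (op ∷ w) (run-op r) = ℤ.≤-trans (ℤ.<⇒≤ (i<next o)) (proj₁ (run-times r))
    high : Dec (next j ≡ o) → next j ≤ y (next j)
    high (yes refl) = start w run
    high (no m) = ℤ.≤-reflexive (sym (before (next j) (ℤ.≤∧≢⇒< (<⇒next≤ j<o) m)))

  represents-blank : ∀ {o w y} → Represents o w y → (∀ j → y j ≡ j) → blank w ≡ 1
  represents-blank {w = w} {y} R id = go w (Represents.run R)
    where
    go : ∀ {p} w → Run y p [] w → blank w ≡ 1
    go [] _ = refl
    go (dot ∷ w) (run-dot _ r) = go w r
    go {p} (op ∷ w) (run-op r) = ⊥-elim (ℤ.<-irrefl (sym (id p)) (ℤ.<-≤-trans (i<next p) (proj₁ (run-times r))))

  blank-represents : ∀ {o w y} → Represents o w y → blank w ≡ 1 → ∀ j → y j ≡ j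
  blank-represents {o} {w} {y} R e j with o ℤ.≤? j
  ... | no n = Represents.before R j (ℤ.≰⇒> n)
  ... | yes l = go w (Represents.run R) e l
    where
    go : ∀ {p} w → Run y p [] w → blank w ≡ 1 → p ≤ j → y j ≡ j
    go [] (end h) _ l = h j l
    go {p} (dot ∷ w) (run-dot f r) e l with p ℤ.≟ j
    ... | yes refl = f
    ... | no n = go w r e (<⇒next≤ (ℤ.≤∧≢⇒< l n))

  letters : ℤ → List ℕ → List ℤ
  letters o l = List.map (λ i → o + + i) l

  -- A letter at which `Z l` does not ascend is wasted; one at which it ascends becomes a descent of
  -- the result, hence a move of `rem`, and accounts for one unit of `degree`. So equality forces a
  -- removal sequence.
  Z-long : ∀ {o} l w y → Represents o w y → Z l ≗ y →
    degree 0 w ℕ.≤ length l × (length l ≡ degree 0 w → Σ (List ℕ) λ l′ → l ≡ letters o l′ × Peel w l′)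
  Z-long [] w y R e = ℕ.≤-reflexive (blank-degree w b) , λ _ → [] , refl , b
    where
    b : blank w ≡ 1
    b = represents-blank R (λ j → sym (e j))
  Z-long {o} (j ∷ l) w y R e = go (Z l j ℤ.<? Z l (next j))
    where
    e′ : extend j (Z l) ≗ y
    e′ k = trans (sym (Z-cons j l k)) (e k)
    go : Dec (Z l j < Z l (next j)) →
      degree 0 w ℕ.≤ suc (length l) × (suc (length l) ≡ degree 0 w → Σ (List ℕ) λ l′ → j ∷ l ≡ letters o l′ × Peel w l′)
    go (no n) = ℕ.m≤n⇒m≤1+n le , λ eq → ⊥-elim (ℕ.<-irrefl refl (subst (ℕ._≤ length l) (sym eq) le))
      where
      le : degree 0 w ℕ.≤ length l
      le = proj₁ (Z-long l w y R (λ k → trans (sym (extend-desc j (Z l) n k)) (e′ k)))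
    go (yes asc) with restrict-extend j (Z l) y (Z-involutive l) asc e′
    ... | d , z≗ with represents-descent R j d
    ... | i , refl , w′ , r with Z-long l w′ (restrict (o + + i) y) (proj₂ (represents-rem i R r)) z≗
    ... | le , exact = subst (ℕ._≤ suc (length l)) (sym (degree-rem 0 i w r)) (s≤s le) ,
      λ eq → let l′ , q , p = exact (ℕ.suc-injective (trans eq (degree-rem 0 i w r))) in
        i ∷ l′ , cong ((o + + i) ∷_) q , w′ , r , p

  peel-chain : ∀ {o} l w y → Represents o w y → Peel w l → Z (letters o l) ≗ y × Chain (letters o l)
  peel-chain [] w y R p = (λ j → sym (blank-represents R p j)) , tt
  peel-chain {o} (i ∷ l) w y R (w′ , r , p) =
    (λ k → trans (Z-cons j (letters o l) k) (trans (extend-cong j z≗ k) (ext k))) ,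
    subst₂ _<_ (sym (z≗ j)) (sym (z≗ (next j))) asc , ch
    where
    j : ℤ
    j = o + + i
    rr = represents-rem i R r
    er = extend-restrict j y (Represents.involutive R) (proj₁ rr)
    ext = proj₁ er
    asc = proj₁ (proj₂ er)
    ih = peel-chain l w′ (restrict j y) (proj₂ rr) p
    z≗ = proj₁ ih
    ch = proj₂ ih

  -- Minimality is tested against a removal sequence, which exists and is reduced by
  -- `chain-reduced`; its length `degree 0 w` leaves only the case of equality in `Z-long`.
  atom⇒peel : ∀ {o w y} → Represents o w y → ∀ a → IsAtomWord y a → Σ (List ℕ) λ l → a ≡ reverse (letters o l) × Peel w l
  atom⇒peel {o} {w} {y} R a (red , e , min) =
    let le , exact = Z-long (reverse a) w y R e′
        l , q , p = exact (ℕ.≤-antisym (ℕ.≤-trans (ℕ.≤-reflexive (List.length-reverse a)) short) le)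
    in l , trans (sym (List.reverse-involutive a)) (cong reverse q) , p
    where
    e′ : Z (reverse a) ≗ y
    e′ j = trans (cong (λ b → dem (reverse a ++ b) j) (List.reverse-involutive a)) (e j)
    some = peel-exists (degree 0 w) w refl (run-balanced (Represents.run R))
    l₀ = letters o (proj₁ some)
    l₀-chain = peel-chain (proj₁ some) w y R (proj₂ some)
    short : length a ℕ.≤ degree 0 w
    short = ℕ.≤-trans (min (reverse l₀) (chain-reduced l₀ (proj₂ l₀-chain))
        (λ j → trans (cong (λ b → dem (b ++ reverse l₀) j) (List.reverse-involutive l₀)) (proj₁ l₀-chain j)))
      (ℕ.≤-reflexive (trans (List.length-reverse l₀) (trans (List.length-map _ (proj₁ some)) (peel-degree w (proj₁ some) (proj₂ some)))))

  peel⇒atom : ∀ {o w y} → Represents o w y → ∀ l → Peel w l → IsAtomWord y (reverse (letters o l))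
  peel⇒atom {o} {w} {y} R l p = chain-reduced (letters o l) (proj₂ ch) ,
    (λ j → trans (cong (λ b → dem (b ++ reverse (letters o l)) j) (List.reverse-involutive (letters o l))) (proj₁ ch j)) ,
    λ b _ e → ℕ.≤-trans (ℕ.≤-reflexive (trans (List.length-reverse (letters o l)) (trans (List.length-map _ l) (peel-degree w l p))))
      (ℕ.≤-trans (proj₁ (Z-long (reverse b) w y R (λ j → trans (cong (λ c → dem (reverse b ++ c) j) (List.reverse-involutive b)) (e j))))
        (ℕ.≤-reflexive (List.length-reverse b)))
    where
    ch = peel-chain l w y R p

-- Counting atom words with compatible labels.

module AtomTerms where

  open import Data.Nat using (_≤_; _<_)
  open NilCoxeterMoves
  open ArcWords
  open ArcWordProperties
  open Coefficients
  open Cardinalities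
  open TableauCounts using (countℕ-++; countℕ-≢; expo-∷ʳ-suc; expo-∷ʳ-zero; expo-∷ʳ-last; count-self)
  open TableauCells using (content-bound)
  open DemazureSteps using (next)
  open AtomWords

  -- The pairs counted letter by letter: e letters ≥ i carrying the label suc (length γ) still have
  -- to be removed, then the labels length γ, …, 1 with multiplicities γ.
  Term : ℕ → ℕ → List ℕ → List Sym → List ℕ → List ℕ → Set
  Term i zero [] w l js = l ≡ [] × js ≡ [] × blank w ≡ 1
  Term i zero (k ∷ γ) w l js = Term 0 k γ w l js
  Term i (suc e) γ w (a ∷ l) (j ∷ js) =
    i ≤ a × j ≡ suc (length γ) × Σ (List Sym) λ w′ → rem 0 a w ≡ just w′ × Term (suc a) e γ w′ l js
  Term i (suc e) γ w _ _ = ⊥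

  Terms : ℕ → ℕ → List ℕ → List Sym → List ℕ × List ℕ → Set
  Terms i e γ w (l , js) = Term i e γ w l js

  term-zero : ∀ i i′ γ w l js → Term i 0 γ w l js → Term i′ 0 γ w l js
  term-zero i i′ [] w l js t = t
  term-zero i i′ (k ∷ γ) w l js t = t

  blank-bit : ∀ w → blank w ≡ 0 ⊎ blank w ≡ 1
  blank-bit [] = inj₂ refl
  blank-bit (op ∷ w) = inj₁ refl
  blank-bit (cl ∷ w) = inj₁ refl
  blank-bit (dot ∷ w) = blank-bit w

  -- Letters sharing a label are removed in increasing order, so the next one is either `i` or
  -- larger, just as `count` runs along the segment.
  term-size : ∀ L γ e k i w → i ℕ.+ k ≡ L → length w ≤ suc L →
    HasSize (Terms i e γ w) (count (segment (rem 0) i k) e (iterate-count (segment (rem 0) 0 L) blank γ) w)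
  term-size L [] zero zero i w ik lw with blank-bit w
  ... | inj₁ z = HasSize-resize (sym z) (HasSize-empty λ (l , js) (_ , _ , b) → absurd (trans (sym z) b))
    where
    absurd : ¬ (0 ≡ 1)
    absurd ()
  ... | inj₂ b = HasSize-resize (sym b) (HasSize-singleton ([] , []) (refl , refl , b) λ { (l , js) (refl , refl , _) → refl })
  term-size L (k′ ∷ γ) zero zero i w ik lw = term-size L γ k′ L 0 w refl lw
  term-size L γ (suc e) zero i w ik lw = HasSize-empty none
    where
    none : ∀ x → ¬ Terms i (suc e) γ w x
    -- The segment is exhausted: letters from `L` on reach past the end of the word.
    none (a ∷ l , j ∷ js) (i≤a , _ , w′ , r , _) with trans (sym r) (rem-inert 0 a w (ℕ.≤-trans lw (s≤s (ℕ.≤-trans (ℕ.≤-reflexive (trans (sym ik) (ℕ.+-identityʳ i))) i≤a))))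
    ... | ()
  term-size L γ zero (suc k) i w ik lw = HasSize-⇔ (λ (l , js) → term-zero (suc i) i γ w l js , term-zero i (suc i) γ w l js)
    (term-size L γ zero k (suc i) w (trans (sym (ℕ.+-suc i k)) ik) lw)
  term-size L γ (suc e) (suc k) i w ik lw = go (rem 0 i w) refl
    where
    f : List Sym → ℕ
    f = iterate-count (segment (rem 0) 0 L) blank γ
    ρs = segment (rem 0) (suc i) k
    ik′ : suc i ℕ.+ k ≡ L
    ik′ = trans (sym (ℕ.+-suc i k)) ik
    kept : HasSize (Terms (suc i) (suc e) γ w) (count ρs (suc e) f w)
    kept = term-size L γ (suc e) k (suc i) w ik′ lw
    weaken : ∀ x → Terms (suc i) (suc e) γ w x → Terms i (suc e) γ w x
    weaken (a ∷ l , j ∷ js) (i<a , t) = ℕ.≤-trans (ℕ.n≤1+n i) i<a , t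
    go : ∀ m → rem 0 i w ≡ m → HasSize (Terms i (suc e) γ w) (count ρs (suc e) f w ℕ.+ atℕ (count ρs e f) (rem 0 i w))
    go nothing r = HasSize-resize (sym (trans (cong (λ m → count ρs (suc e) f w ℕ.+ atℕ (count ρs e f) m) r) (ℕ.+-identityʳ _)))
      (HasSize-⇔ (λ x → weaken x , strict x) kept)
      where
      strict : ∀ x → Terms i (suc e) γ w x → Terms (suc i) (suc e) γ w x
      strict (a ∷ l , j ∷ js) (i≤a , ej , w′ , r′ , t) = ℕ.≤∧≢⇒< i≤a (λ { refl → absurd (trans (sym r) r′) }) , ej , w′ , r′ , t
        where
        absurd : ∀ {v : List Sym} → ¬ (nothing ≡ just v)
        absurd ()
    go (just w₁) r = HasSize-resize (cong (λ m → count ρs (suc e) f w ℕ.+ atℕ (count ρs e f) m) (sym r))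
      (HasSize-split {g = λ (l , js) → i ∷ l , suc (length γ) ∷ js} (record
        { cases = cases
        ; left = weaken
        ; right = λ (l , js) t → ℕ.≤-refl , refl , w₁ , r , t
        ; disjoint = λ (l , js) _ (i<i , _) → ℕ.<-irrefl refl i<i
        ; injective = λ { (l , js) (.l , .js) _ _ refl → refl } })
        kept (term-size L γ e k (suc i) w₁ ik′ (subst (_≤ suc L) (sym (rem-length 0 i w r)) lw)))
      where
      cases : ∀ x → Terms i (suc e) γ w x →
        Terms (suc i) (suc e) γ w x ⊎ Σ (List ℕ × List ℕ) λ y → Terms (suc i) e γ w₁ y × x ≡ (i ∷ proj₁ y , suc (length γ) ∷ proj₂ y)
      cases (a ∷ l , j ∷ js) (i≤a , ej , w′ , r′ , t) with i ℕ.≟ a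
      ... | no n = inj₁ (ℕ.≤∧≢⇒< i≤a n , ej , w′ , r′ , t)
      cases (a ∷ l , .(suc (length γ)) ∷ js) (i≤a , refl , w′ , r′ , t) | yes refl with trans (sym r) r′
      ... | refl = inj₂ ((l , js) , t , refl)

  -- `Compatible` read backwards, in the order of removal.
  CompatibleRev : List ℕ → List ℕ → Set
  CompatibleRev [] [] = ⊤
  CompatibleRev (a ∷ []) (j ∷ []) = 1 ≤ j
  CompatibleRev (a ∷ a′ ∷ l) (j ∷ j′ ∷ js) = 1 ≤ j × j′ ≤ j × (a′ < a → j′ < j) × CompatibleRev (a′ ∷ l) (j′ ∷ js)
  CompatibleRev _ _ = ⊥

  -- The link between consecutive entries in `Term`: while the label `M` continues, the next letter
  -- must not fall below `i`.
  Head : ℕ → ℕ → List ℕ → List ℕ → Set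
  Head M i (a ∷ l) (j ∷ js) = j ≤ M × (j ≡ M → i ≤ a)
  Head M i _ _ = ⊤

  term-head : ∀ i e γ w l js → Term i e γ w l js → Head (suc (length γ)) i l js
  term-head i zero [] w .[] .[] (refl , refl , _) = tt
  term-head i zero (k ∷ γ) w l js t = raise l js (term-head 0 k γ w l js t)
    where
    raise : ∀ l js → Head (suc (length γ)) 0 l js → Head (suc (suc (length γ))) i l js
    raise [] js h = tt
    raise (a ∷ l) [] h = tt
    raise (a ∷ l) (j ∷ js) (le , _) = ℕ.m≤n⇒m≤1+n le , λ { refl → ⊥-elim (ℕ.<-irrefl refl le) }
  term-head i (suc e) γ w (a ∷ l) (j ∷ js) (i≤a , ej , _) = ℕ.≤-reflexive ej , λ _ → i≤a

  term-peel : ∀ i e γ w l js → Term i e γ w l js → Peel w l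
  term-peel i zero [] w .[] .[] (refl , refl , b) = b
  term-peel i zero (k ∷ γ) w l js t = term-peel 0 k γ w l js t
  term-peel i (suc e) γ w (a ∷ l) (j ∷ js) (_ , _ , w′ , r , t) = w′ , r , term-peel (suc a) e γ w′ l js t

  term-RC : ∀ i e γ w l js → Term i e γ w l js → CompatibleRev l js
  term-RC i zero [] w .[] .[] (refl , refl , b) = tt
  term-RC i zero (k ∷ γ) w l js t = term-RC 0 k γ w l js t
  term-RC i (suc e) γ w (a ∷ l) (j ∷ js) (_ , refl , w′ , r , t) =
    extend l js (term-RC (suc a) e γ w′ l js t) (term-head (suc a) e γ w′ l js t)
    where
    extend : ∀ l js → CompatibleRev l js → Head (suc (length γ)) (suc a) l js → CompatibleRev (a ∷ l) (suc (length γ) ∷ js)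
    extend [] [] _ _ = s≤s z≤n
    extend (a′ ∷ l) (j′ ∷ js) rc (le , h) = s≤s z≤n , le , (λ lt → ℕ.≤∧≢⇒< le (λ e → ℕ.<-asym lt (h e))) , rc
    extend [] (_ ∷ _) () _
    extend (_ ∷ []) [] () _
    extend (_ ∷ _ ∷ _) [] () _

  term-content : ∀ i e γ w l js → Term i e γ w l js → HasContent js (reverse γ ∷ʳ e)
  term-content i zero [] w .[] .[] (refl , refl , b) k = sym (expo-∷ʳ-zero [] k)
  term-content i zero (k′ ∷ γ) w l js t k = trans (term-content 0 k′ γ w l js t k)
    (trans (cong (λ α → expo α k) (sym (List.unfold-reverse k′ γ))) (sym (expo-∷ʳ-zero (reverse (k′ ∷ γ)) k)))
  term-content i (suc e) γ w (a ∷ l) (j ∷ js) (_ , refl , w′ , r , t) k = trans (countℕ-++ (suc k) (j ∷ []) js)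
    (trans (cong₂ (λ m c → countℕ (suc k) (suc m ∷ []) ℕ.+ c) (sym (List.length-reverse γ)) (term-content (suc a) e γ w′ l js t k))
      (sym (expo-∷ʳ-suc (reverse γ) e k)))

  RC-tail : ∀ a l j js → CompatibleRev (a ∷ l) (j ∷ js) → CompatibleRev l js
  RC-tail a [] j [] rc = tt
  RC-tail a (a′ ∷ l) j (j′ ∷ js) (_ , _ , _ , rc) = rc

  RC-positive : ∀ a l j js → CompatibleRev (a ∷ l) (j ∷ js) → 1 ≤ j
  RC-positive a [] j [] rc = rc
  RC-positive a (a′ ∷ l) j (j′ ∷ js) (p , _) = p

  RC-absent : ∀ M l j js → CompatibleRev l (j ∷ js) → j < M → countℕ M (j ∷ js) ≡ 0
  RC-absent M (a ∷ []) j [] rc lt = countℕ-≢ j M [] (ℕ.<⇒≢ lt)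
  RC-absent M (a ∷ a′ ∷ l) j (j′ ∷ js) (_ , le , _ , rc) lt =
    trans (countℕ-≢ j M (j′ ∷ js) (ℕ.<⇒≢ lt)) (RC-absent M (a′ ∷ l) j′ js rc (ℕ.≤-<-trans le lt))

  make-term : ∀ i e γ w l js → Peel w l → CompatibleRev l js → HasContent js (reverse γ ∷ʳ e) → Head (suc (length γ)) i l js → Term i e γ w l js
  make-term i zero [] w [] [] p rc h _ = refl , refl , p
  make-term i zero [] w (a ∷ l) (j ∷ js) p rc h _ = ⊥-elim (ℕ.<-irrefl refl (ℕ.≤-trans (RC-positive a l j js rc)
    (content-bound (j ∷ js) [] (λ k → trans (h k) (expo-∷ʳ-zero [] k)) (here refl) (RC-positive a l j js rc))))
  make-term i zero [] w [] (_ ∷ _) p () h _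
  make-term i zero [] w (_ ∷ []) [] p () h _
  make-term i zero [] w (_ ∷ _ ∷ _) [] p () h _
  make-term i zero (k′ ∷ γ) w l js p rc h _ = make-term 0 k′ γ w l js p rc content (bound l js content rc)
    where
    content : HasContent js (reverse γ ∷ʳ k′)
    content k = trans (h k) (trans (expo-∷ʳ-zero (reverse (k′ ∷ γ)) k) (cong (λ α → expo α k) (List.unfold-reverse k′ γ)))
    bound : ∀ l js → HasContent js (reverse γ ∷ʳ k′) → CompatibleRev l js → Head (suc (length γ)) 0 l js
    bound [] js _ _ = tt
    bound (a ∷ l) [] _ _ = tt
    bound (a ∷ l) (j ∷ js) c rc = ℕ.≤-trans (content-bound (j ∷ js) (reverse γ ∷ʳ k′) c (here refl) (RC-positive a l j js rc))
      (ℕ.≤-reflexive (trans (List.length-++-comm (reverse γ) (k′ ∷ [])) (cong suc (List.length-reverse γ)))) , λ _ → z≤n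
  make-term i (suc e) γ w l [] p rc h _ with trans (h (length (reverse γ))) (expo-∷ʳ-last (reverse γ) (suc e))
  ... | ()
  make-term i (suc e) γ w [] (j ∷ js) p () h _
  make-term i (suc e) γ w (a ∷ l) (j ∷ js) (w′ , r , p) rc h (le , hd) =
    hd j≡M , j≡M , w′ , r , make-term (suc a) e γ w′ l js p (RC-tail a l j js rc) content (head l js rc p)
    where
    M : ℕ
    M = suc (length γ)
    j≡M : j ≡ M
    j≡M with j ℕ.≟ M
    ... | yes q = q
    ... | no n = ⊥-elim (absurd (trans (sym (RC-absent M (a ∷ l) j js rc (ℕ.≤∧≢⇒< le n)))
      (trans (cong (λ m → countℕ (suc m) (j ∷ js)) (sym (List.length-reverse γ)))
        (trans (h (length (reverse γ))) (expo-∷ʳ-last (reverse γ) (suc e))))))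
      where
      absurd : ¬ (0 ≡ suc e)
      absurd ()
    content : HasContent js (reverse γ ∷ʳ e)
    content k = ℕ.+-cancelˡ-≡ (countℕ (suc k) (suc (length (reverse γ)) ∷ [])) _ _
      (trans (cong (λ m → countℕ (suc k) (m ∷ []) ℕ.+ countℕ (suc k) js) (trans (cong suc (List.length-reverse γ)) (sym j≡M)))
        (trans (sym (countℕ-++ (suc k) (j ∷ []) js)) (trans (h k) (expo-∷ʳ-suc (reverse γ) e k))))
    head : ∀ l js → CompatibleRev (a ∷ l) (j ∷ js) → Peel w′ l → Head M (suc a) l js
    head [] js _ _ = tt
    head (a′ ∷ l) [] _ _ = tt
    -- Compatibility alone makes the letters under one label weakly increasing; equality would
    -- remove the same letter twice, against `rem-square`.
    head (a′ ∷ l) (j′ ∷ js) (_ , le′ , st , _) (w″ , r′ , _) = ℕ.≤-trans le′ (ℕ.≤-reflexive j≡M) ,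
      λ j′≡M → ℕ.≤∧≢⇒< (ℕ.≮⇒≥ (λ lt → ℕ.<-irrefl (trans j′≡M (sym j≡M)) (st lt)))
        λ { refl → absurd (trans (sym (rem-square 0 a w)) (trans (cong (_>>= rem 0 a) r) r′)) }
      where
      absurd : ∀ {v : List Sym} → ¬ (nothing ≡ just v)
      absurd ()

  countℕ-reverse : ∀ j xs → countℕ j (reverse xs) ≡ countℕ j xs
  countℕ-reverse j [] = refl
  countℕ-reverse j (x ∷ xs) = begin
    countℕ j (reverse (x ∷ xs)) ≡⟨ cong (countℕ j) (List.unfold-reverse x xs) ⟩
    countℕ j (reverse xs ∷ʳ x) ≡⟨ countℕ-++ j (reverse xs) (x ∷ []) ⟩
    countℕ j (reverse xs) ℕ.+ countℕ j (x ∷ []) ≡⟨ ℕ.+-comm (countℕ j (reverse xs)) _ ⟩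
    countℕ j (x ∷ []) ℕ.+ countℕ j (reverse xs) ≡⟨ cong (countℕ j (x ∷ []) ℕ.+_) (countℕ-reverse j xs) ⟩
    countℕ j (x ∷ []) ℕ.+ countℕ j xs ≡⟨ countℕ-++ j (x ∷ []) xs ⟨
    countℕ j (x ∷ xs) ∎
    where open ≡-Reasoning

  compatible-length : ∀ a is → Compatible a is → length a ≡ length is
  compatible-length [] [] c = refl
  compatible-length (a ∷ []) (i ∷ []) c = refl
  compatible-length (a ∷ a′ ∷ as) (i ∷ i′ ∷ is) (_ , _ , _ , c) = cong suc (compatible-length (a′ ∷ as) (i′ ∷ is) c)

  compatible-∷ʳ⁺ : ∀ as is {a b i j} → length as ≡ length is → Compatible (as ∷ʳ a) (is ∷ʳ i) → i ≤ j → (a ℤ.< b → i < j) →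
    Compatible (as ∷ʳ a ∷ʳ b) (is ∷ʳ i ∷ʳ j)
  compatible-∷ʳ⁺ [] [] e c le st = c , le , st , ℕ.≤-trans c le
  compatible-∷ʳ⁺ (x ∷ []) (x′ ∷ []) e (p , q , s , c) le st = p , q , s , compatible-∷ʳ⁺ [] [] refl c le st
  compatible-∷ʳ⁺ (x ∷ as@(_ ∷ _)) (x′ ∷ is@(_ ∷ _)) e (p , q , s , c) le st = p , q , s , compatible-∷ʳ⁺ as is (ℕ.suc-injective e) c le st

  compatible-∷ʳ⁻ : ∀ as is {a b i j} → length as ≡ length is → Compatible (as ∷ʳ a ∷ʳ b) (is ∷ʳ i ∷ʳ j) →
    Compatible (as ∷ʳ a) (is ∷ʳ i) × i ≤ j × (a ℤ.< b → i < j) × 1 ≤ j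
  compatible-∷ʳ⁻ [] [] e (p , le , st , q) = p , le , st , q
  compatible-∷ʳ⁻ (x ∷ []) (x′ ∷ []) e (p , q , s , c) =
    let c′ , rest = compatible-∷ʳ⁻ [] [] refl c in (p , q , s , c′) , rest
  compatible-∷ʳ⁻ (x ∷ as@(_ ∷ _)) (x′ ∷ is@(_ ∷ _)) e (p , q , s , c) =
    let c′ , rest = compatible-∷ʳ⁻ as is (ℕ.suc-injective e) c in (p , q , s , c′) , rest

  module _ (o : ℤ) where

    private
      reverse₂ : ∀ {A : Set} (x y : A) xs → reverse (x ∷ y ∷ xs) ≡ reverse xs ∷ʳ y ∷ʳ x
      reverse₂ x y xs = trans (List.unfold-reverse x (y ∷ xs)) (cong (_∷ʳ x) (List.unfold-reverse y xs))

      lengths : ∀ (l js : List ℕ) → length l ≡ length js → length (reverse (letters o l)) ≡ length (reverse js)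
      lengths l js e = trans (List.length-reverse (letters o l)) (trans (List.length-map _ l) (trans e (sym (List.length-reverse js))))

    RC-length : ∀ l js → CompatibleRev l js → length l ≡ length js
    RC-length [] [] rc = refl
    RC-length (a ∷ []) (j ∷ []) rc = refl
    RC-length (a ∷ a′ ∷ l) (j ∷ j′ ∷ js) (_ , _ , _ , rc) = cong suc (RC-length (a′ ∷ l) (j′ ∷ js) rc)

    RC⇒compatible : ∀ l js → CompatibleRev l js → Compatible (reverse (letters o l)) (reverse js)
    RC⇒compatible [] [] rc = tt
    RC⇒compatible (a ∷ []) (j ∷ []) rc = rc
    RC⇒compatible (a ∷ a′ ∷ l) (j ∷ j′ ∷ js) (p , le , st , rc) =
      subst₂ Compatible (sym (reverse₂ _ _ (letters o l))) (sym (reverse₂ j j′ js))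
        (compatible-∷ʳ⁺ (reverse (letters o l)) (reverse js) (lengths l js (ℕ.suc-injective (RC-length (a′ ∷ l) (j′ ∷ js) rc)))
          (subst₂ Compatible (List.unfold-reverse _ (letters o l)) (List.unfold-reverse j′ js) (RC⇒compatible (a′ ∷ l) (j′ ∷ js) rc))
          le (λ lt → st (ℕ.≰⇒> (λ le′ → ℤ.<⇒≱ lt (ℤ.+-monoʳ-≤ o (ℤ.+≤+ le′))))))

    compatible⇒RC : ∀ l js → length l ≡ length js → Compatible (reverse (letters o l)) (reverse js) → CompatibleRev l js
    compatible⇒RC [] [] e c = tt
    compatible⇒RC (a ∷ []) (j ∷ []) e c = c
    compatible⇒RC (a ∷ a′ ∷ l) (j ∷ j′ ∷ js) e c =
      let c′ , le , st , p = compatible-∷ʳ⁻ (reverse (letters o l)) (reverse js) (lengths l js (ℕ.suc-injective (ℕ.suc-injective e)))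
            (subst₂ Compatible (reverse₂ _ _ (letters o l)) (reverse₂ j j′ js) c)
      in p , le , (λ lt → st (ℤ.+-monoʳ-< o (ℤ.+<+ lt))) ,
        compatible⇒RC (a′ ∷ l) (j′ ∷ js) (ℕ.suc-injective e)
          (subst₂ Compatible (sym (List.unfold-reverse _ (letters o l))) (sym (List.unfold-reverse j′ js)) c′)

  AtomTerm-size : ∀ L {o w y} α → Represents o w y → length w ≤ suc L →
    HasSize (AtomTerm y α) (iterate-count (segment (rem 0) 0 L) blank (reverse α) w)
  AtomTerm-size L {o} {w} {y} α R lw = HasSize-image g complete sound injective
    -- The start is the end of a fictitious label beyond those of `α`: no letters with it remain,
    -- and its segment is exhausted.
    (term-size L (reverse α) 0 0 L w (ℕ.+-identityʳ L) lw)
    where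
    g : List ℕ × List ℕ → List ℤ × List ℕ
    g (l , js) = reverse (letters o l) , reverse js
    rev : reverse (reverse α) ≡ α
    rev = List.reverse-involutive α
    letters-injective : ∀ l l′ → letters o l ≡ letters o l′ → l ≡ l′
    letters-injective l l′ = List.map-injective (λ e → ℤ.+-injective (ℤ-cancel e))
      where
      ℤ-cancel : ∀ {i j} → o ℤ.+ + i ≡ o ℤ.+ + j → + i ≡ + j
      ℤ-cancel {i} {j} e = ∙-cancelˡ ℤ.+-0-abelianGroup o (+ i) (+ j) e
    injective : ∀ x x′ → Terms L 0 (reverse α) w x → Terms L 0 (reverse α) w x′ → g x ≡ g x′ → x ≡ x′
    injective (l , js) (l′ , js′) _ _ e = cong₂ _,_ (letters-injective l l′ (List.reverse-injective (cong proj₁ e))) (List.reverse-injective (cong proj₂ e))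
    sound : ∀ x → Terms L 0 (reverse α) w x → AtomTerm y α (g x)
    sound (l , js) t = peel⇒atom R l (term-peel L 0 (reverse α) w l js t) , RC⇒compatible o l js (term-RC L 0 (reverse α) w l js t) ,
      λ k → trans (countℕ-reverse (suc k) js) (trans (term-content L 0 (reverse α) w l js t k)
        (trans (expo-∷ʳ-zero (reverse (reverse α)) k) (cong (λ β → expo β k) rev)))
    complete : ∀ x → AtomTerm y α x → Σ (List ℕ × List ℕ) λ z → Terms L 0 (reverse α) w z × x ≡ g z
    complete (a , is) (atom , c , h) with atom⇒peel R a atom
    ... | l , refl , p = (l , reverse is) , term , cong₂ _,_ refl (sym (List.reverse-involutive is))
      where
      js : List ℕ
      js = reverse is
      e : length l ≡ length js
      e = trans (sym (trans (List.length-reverse (letters o l)) (List.length-map _ l)))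
        (trans (compatible-length _ is c) (sym (List.length-reverse is)))
      rc : CompatibleRev l js
      rc = compatible⇒RC o l js e (subst (Compatible (reverse (letters o l))) (sym (List.reverse-involutive is)) c)
      content : HasContent js α
      content k = trans (countℕ-reverse (suc k) is) (h k)
      bound : ∀ l js → CompatibleRev l js → HasContent js α → Head (suc (length (reverse α))) L l js
      bound [] js _ _ = tt
      bound (a ∷ l) [] _ _ = tt
      bound (a ∷ l) (j ∷ js) rc h = ℕ.m≤n⇒m≤1+n le , λ { refl → ⊥-elim (ℕ.<-irrefl refl le) }
        where
        le : j ≤ length (reverse α)
        le = ℕ.≤-trans (content-bound (j ∷ js) α h (here refl) (RC-positive a l j js rc)) (ℕ.≤-reflexive (sym (List.length-reverse α)))
      term : Term L 0 (reverse α) w l js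
      term = make-term L 0 (reverse α) w l js p rc
        (λ k → trans (content k) (trans (cong (λ β → expo β k) (sym rev)) (sym (expo-∷ʳ-zero (reverse (reverse α)) k)))) (bound l js rc content)

-- The arc word of an I-Grassmannian involution.

module Encodings where

  open import Data.Integer using (_+_; _≤_; _<_)
  open NilCoxeterMoves
  open ArcWords
  open HorizontalAndVertical
  open Evaluations
  open Coefficients
  open TableauCells
  open DemazureSteps
  open InvolutionWords
  open ArcRuns
  open AtomWords
  open AtomTerms

  transp-left : ∀ a b → transp a b a ≡ b
  transp-left a b = cong (λ t → if t then b else (if does (a ℤ.≟ b) then a else a)) (dec-true (a ℤ.≟ a) refl)

  transp-right : ∀ a b → b ≢ a → transp a b b ≡ a
  transp-right a b n rewrite dec-false (b ℤ.≟ a) n | dec-true (b ℤ.≟ b) refl = refl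

  transp-other : ∀ a b j → j ≢ a → j ≢ b → transp a b j ≡ j
  transp-other a b j n n′ rewrite dec-false (j ℤ.≟ a) n | dec-false (j ℤ.≟ b) n′ = refl

  Above : ℤ → List ℤ → Set
  Above p [] = ⊤
  Above p (f ∷ φ) = p ≤ f × Above (next f) φ

  above-weaken : ∀ {p p′} φ → p′ ≤ p → Above p φ → Above p′ φ
  above-weaken [] l a = tt
  above-weaken (f ∷ φ) l (m , a) = ℤ.≤-trans l m , a

  above-all : ∀ {p} φ → Above p φ → All (p ≤_) φ
  above-all [] a = []
  above-all {p} (f ∷ φ) (m , a) = m ∷ above-all φ (above-weaken φ (ℤ.≤-trans m (ℤ.<⇒≤ (i<next f))) a)

  above-distinct : ∀ {f} φ → Above (next f) φ → All (f ≢_) φ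
  above-distinct {f} φ a = All.map (λ l e → ℤ.<-irrefl e (ℤ.<-≤-trans (i<next f) l)) (above-all φ a)

  increasing-above : ∀ f φ → StrictlyIncreasing (f ∷ φ) → Above f (f ∷ φ)
  increasing-above f [] s = ℤ.≤-refl , tt
  increasing-above f (g ∷ φ) (l , s) = ℤ.≤-refl , <⇒next≤ l , proj₂ (increasing-above g φ s)

  prodTransp-low : ∀ n k φ j → j < n + + k → All (j ≢_) φ → prodTransp n k φ j ≡ j
  prodTransp-low n k [] j l a = refl
  prodTransp-low n k (f ∷ φ) j l (m ∷ a) = trans
    (cong (transp f (n + + k)) (prodTransp-low n (suc k) φ j (ℤ.<-≤-trans l (ℤ.+-monoʳ-≤ n (ℤ.+≤+ (ℕ.n≤1+n k)))) a))
    (transp-other f (n + + k) j m (ℤ.<⇒≢ l))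

  Matched : (ℤ → ℤ) → ℤ → List ℤ → Set
  Matched y q [] = ∀ j → q ≤ j → y j ≡ j
  Matched y q (f ∷ φ) = y q ≡ f × y f ≡ q × Matched y (next q) φ

  matched-transp : ∀ {f m y} q φ → f < m → m < q → All (λ g → f ≢ g × g < m) φ → Matched y q φ → Matched (λ j → transp f m (y j)) q φ
  matched-transp {f} {m} q [] l l′ a h j le = trans (cong (transp f m) (h j le))
    (transp-other f m j (λ e → ℤ.<-irrefl (sym e) (ℤ.<-trans l (ℤ.<-≤-trans l′ le))) (λ e → ℤ.<-irrefl (sym e) (ℤ.<-≤-trans l′ le)))
  matched-transp {f} {m} q (g ∷ φ) l l′ ((n , g<m) ∷ a) (e , e′ , h) =
    trans (cong (transp f m) e) (transp-other f m g (λ r → n (sym r)) (ℤ.<⇒≢ g<m)) ,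
    trans (cong (transp f m) e′) (transp-other f m q (λ r → ℤ.<-irrefl (sym r) (ℤ.<-trans l l′)) (λ r → ℤ.<-irrefl (sym r) l′)) ,
    matched-transp (next q) φ l (ℤ.<-trans l′ (i<next q)) a h

  +-next : ∀ n k → next (n + + k) ≡ n + + suc k
  +-next n k = trans (ℤ.+-assoc n (+ k) 1ℤ) (cong (λ m → n + + m) (ℕ.+-comm k 1))

  n<n+suc : ∀ n k → n < n + + suc k
  n<n+suc n k = subst (_< n + + suc k) (ℤ.+-identityʳ n) (ℤ.+-monoʳ-< n (ℤ.+<+ (s≤s z≤n)))

  -- The transpositions are disjoint, the openers being distinct and at most `n` and the closers
  -- beyond it, so each factor leaves the pairs of the others alone.
  matched-prodTransp : ∀ n k φ {p} → Above p φ → All (_≤ n) φ → Matched (prodTransp n (suc k) φ) (n + + suc k) φ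
  matched-prodTransp n k [] a le j l = refl
  matched-prodTransp n k (f ∷ φ) (_ , a) (f≤n ∷ le) =
    trans (cong (transp f m) (prodTransp-low n (suc (suc k)) φ m m<m′ (All.map (λ l e → ℤ.<-irrefl (sym e) (ℤ.≤-<-trans l n<m)) le)))
      (transp-right f m (λ e → ℤ.<-irrefl (sym e) f<m)) ,
    trans (cong (transp f m) (prodTransp-low n (suc (suc k)) φ f (ℤ.<-trans f<m m<m′) (above-distinct φ a))) (transp-left f m) ,
    subst (λ q → Matched (prodTransp n (suc k) (f ∷ φ)) q φ) (sym (+-next n (suc k))) (matched-transp (n + + suc (suc k)) φ f<m m<m′
      (All.zipWith (λ (d , l) → d , ℤ.≤-<-trans l n<m) (above-distinct φ a , le)) (matched-prodTransp n (suc k) φ a le))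
    where
    m : ℤ
    m = n + + suc k
    n<m : n < m
    n<m = n<n+suc n k
    f<m : f < m
    f<m = ℤ.≤-<-trans f≤n n<m
    m<m′ : m < n + + suc (suc k)
    m<m′ = ℤ.+-monoʳ-< n (ℤ.+<+ ℕ.≤-refl)

  matched-run : ∀ {y} q φ → Matched y q φ → Run y q φ (closes (length φ))
  matched-run q [] h = end h
  matched-run q (f ∷ φ) (e , e′ , h) = run-cl e e′ (matched-run (next q) φ h)

  data Places : ℤ → List ℤ → List Sym → Set where
    [] : ∀ {p} → Places p [] []
    op : ∀ {p φ u} → Places (next p) φ u → Places p (p ∷ φ) (op ∷ u)
    dot : ∀ {p φ u} → Places (next p) φ u → Places p φ (dot ∷ u)

  places-exist : ∀ n N p φ → p + + N ≡ next n → Above p φ → All (_≤ n) φ → Σ (List Sym) λ u → Places p φ u × length u ≡ N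
  places-exist n zero p [] e a le = [] , [] , refl
  places-exist n zero p (f ∷ φ) e (p≤f , _) (f≤n ∷ _) = ⊥-elim (ℤ.<-irrefl refl (ℤ.<-≤-trans (i<next n)
    (ℤ.≤-trans (ℤ.≤-reflexive (trans (sym e) (ℤ.+-identityʳ p))) (ℤ.≤-trans p≤f f≤n))))
  places-exist n (suc N) p [] e a le = let u , pl , l = places-exist n N (next p) [] (trans (sym (+-suc-next p N)) e) tt [] in
    dot ∷ u , dot pl , cong suc l
  places-exist n (suc N) p (f ∷ φ) e (p≤f , a) (f≤n ∷ le) with p ℤ.≟ f
  ... | yes refl = let u , pl , l = places-exist n N (next p) φ (trans (sym (+-suc-next p N)) e) a le in op ∷ u , op pl , cong suc l
  ... | no m = let u , pl , l = places-exist n N (next p) (f ∷ φ) (trans (sym (+-suc-next p N)) e) (<⇒next≤ (ℤ.≤∧≢⇒< p≤f m) , a) (f≤n ∷ le)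
    in dot ∷ u , dot pl , cong suc l

  places-noClose : ∀ {p φ u} → Places p φ u → NoClose u
  places-noClose [] = []
  places-noClose (op pl) = op (places-noClose pl)
  places-noClose (dot pl) = dot (places-noClose pl)

  places-opens : ∀ {p φ u} → Places p φ u → opens u ≡ length φ
  places-opens [] = refl
  places-opens (op pl) = cong suc (places-opens pl)
  places-opens (dot pl) = places-opens pl

  places-above : ∀ {p φ u} → Places p φ u → All (p ≤_) φ
  places-above [] = []
  places-above {p} (op pl) = ℤ.≤-refl ∷ All.map (ℤ.≤-trans (ℤ.<⇒≤ (i<next p))) (places-above pl)
  places-above {p} (dot pl) = All.map (ℤ.≤-trans (ℤ.<⇒≤ (i<next p))) (places-above pl)

  places-shape : ∀ n {p φ u} → Places p φ u → p + + length u ≡ next n → shape u ≡ List.map (λ f → ℤ.∣ n + 1ℤ ℤ.- f ∣) φ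
  places-shape n [] e = refl
  places-shape n {p} (op {φ = φ} {u} pl) e = cong₂ _∷_ (sym (trans (cong (λ m → ℤ.∣ m ℤ.- p ∣) (sym e)) (cong ℤ.∣_∣ (cancel p (+ suc (length u))))))
    (places-shape n pl (trans (sym (+-suc-next p (length u))) e))
    where
    cancel : ∀ p k → p + k ℤ.- p ≡ k
    cancel = solve-∀
  places-shape n {p} (dot {u = u} pl) e = places-shape n pl (trans (sym (+-suc-next p (length u))) e)

  places-run : ∀ {y p φ u} Q s → Places p φ u → (∀ q → p ≤ q → q < p + + length u → All (q ≢_) φ → y q ≡ q) →
    Run y (p + + length u) (Q ++ φ) s → Run y p Q (u ++ s)
  places-run {y} {p} Q s [] h r = subst₂ (λ q Q′ → Run y q Q′ s) (ℤ.+-identityʳ p) (List.++-identityʳ Q) r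
  places-run {y} {p} Q s (op {φ = φ} {u} pl) h r = run-op (places-run (Q ∷ʳ p) s pl
    (λ q l l′ a → h q (ℤ.≤-trans (ℤ.<⇒≤ (i<next p)) l) (subst (q <_) (sym (+-suc-next p (length u))) l′)
      ((λ e → ℤ.<-irrefl (sym e) (ℤ.<-≤-trans (i<next p) l)) ∷ a))
    (subst₂ (λ q Q′ → Run y q Q′ s) (+-suc-next p (length u)) (sym (List.++-assoc Q (p ∷ []) φ)) r))
  places-run {y} {p} {φ} Q s (dot {u = u} pl) h r = run-dot
    (h p ℤ.≤-refl (n<n+suc p (length u)) (All.map (λ l e → ℤ.<-irrefl e (ℤ.<-≤-trans (i<next p) l)) (places-above pl)))
    (places-run Q s pl
      (λ q l l′ a → h q (ℤ.≤-trans (ℤ.<⇒≤ (i<next p)) l) (subst (q <_) (sym (+-suc-next p (length u))) l′) a)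
      (subst (λ q → Run y q (Q ++ φ) s) (+-suc-next p (length u)) r))

  allLE : ∀ φ n → AllLE φ n → All (_≤ n) φ
  allLE [] n h = []
  allLE (f ∷ φ) n (l , h) = l ∷ allLE φ n h

  record Encoding (y : ℤ → ℤ) (μ : List ℕ) : Set where
    field
      size : ℕ
      word : List Sym
      isWord : Word size word
      origin : ℤ
      represents : Represents origin (ι word) y
      hasShape : shape word ≡ μ

  encode : ∀ y μ → Involutive y → ShapeOf y μ → Encoding y μ
  -- A `Word` has at least one site, so the identity is spelled by one dot, placed anywhere.
  encode y .[] inv (inj₁ (id , refl)) = record
    { size = 0 ; word = dot ∷ [] ; isWord = refl , dot [] ; origin = 0ℤ
    ; represents = record { involutive = inv ; before = λ j _ → id j ; run = run-dot (id 0ℤ) (end λ j _ → id j) }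
    ; hasShape = refl }
  encode y μ inv (inj₂ (n , [] , ne , _)) = ⊥-elim (ne refl)
  encode y .(List.map _ (f ∷ φ)) inv (inj₂ (n , f ∷ φ , _ , si , le , y≗ , refl)) = go (places-exist n N f (f ∷ φ) N-eq above bound)
    where
    above : Above f (f ∷ φ)
    above = increasing-above f φ si
    bound : All (_≤ n) (f ∷ φ)
    bound = allLE (f ∷ φ) n le
    -- The word starts at its first opener and extends to site `n`, so the number of sites is the
    -- first part of the shape.
    N : ℕ
    N = ℤ.∣ next n ℤ.- f ∣
    N-eq : f + + N ≡ next n
    N-eq = trans (cong (λ m → f + m) (ℤ.0≤i⇒+∣i∣≡i (ℤ.i≤j⇒0≤j-i (ℤ.≤-trans (All.head bound) (ℤ.<⇒≤ (i<next n)))))) (rng f (next n))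
      where
      rng : ∀ f m → f + (m ℤ.- f) ≡ m
      rng = solve-∀
    low : ∀ j → j < next n → All (j ≢_) (f ∷ φ) → y j ≡ j
    low j l a = trans (y≗ j) (prodTransp-low n 1 (f ∷ φ) j l a)
    go : (Σ (List Sym) λ u → Places f (f ∷ φ) u × length u ≡ N) → Encoding y (List.map (λ g → ℤ.∣ n + 1ℤ ℤ.- g ∣) (f ∷ φ))
    go ([] , () , _)
    go (u@(_ ∷ u′) , pl , lu) = record
      { size = length u′ ; word = u ; isWord = refl , places-noClose pl ; origin = f
      ; represents = record
        { involutive = inv
        ; before = λ j l → low j (ℤ.<-trans l (ℤ.≤-<-trans (All.head bound) (i<next n)))
            (All.map (λ l′ → ℤ.<⇒≢ (ℤ.<-≤-trans l l′)) (above-all (f ∷ φ) above))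
        ; run = places-run [] (closes (opens u)) pl
            (λ q _ l a → low q (subst (q <_) u-end l) a)
            (subst₂ (λ q r → Run y q (f ∷ φ) (closes r)) (sym u-end) (sym (places-opens pl))
              (run-cong (λ j → sym (y≗ j)) (matched-run (next n) (f ∷ φ) (matched-prodTransp n 0 (f ∷ φ) above bound)))) }
      ; hasShape = places-shape n pl u-end }
      where
      u-end : f + + length u ≡ next n
      u-end = trans (cong (λ m → f + + m) lu) N-eq

-- The two counts compared.

open NilCoxeterMoves
open ArcWords
open HorizontalAndVertical
open Evaluations
open Coefficients
open Cardinalities
open TableauCells
open AtomWords
open AtomTerms
open Encodings

theorem4p20 : (y : ℤ → ℤ) → IsFinInvolution y → IGrassmannian y →
    (μ : List ℕ) → ShapeOf y μ →
    (α : List ℕ) →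
    Σ ℕ λ N → HasSize (AtomTerm y α) N × HasSize (PTableau μ α) N
theorem4p20 y (inv , _) _ μ sh α =
  iterate-count (segment (rem 0) 0 (L size)) blank (reverse α) (ι word) ,
  AtomTerm-size (L size) α represents short ,
  HasSize-resize (sym (equinumerous size word isWord (reverse α))) (PTableau-size size word μ α isWord hasShape)
  where
  open Encoding (encode y μ inv sh)
  short : length (ι word) ℕ.≤ suc (L size)
  short = begin
    length (word ++ closes (opens word)) ≡⟨ List.length-++ word ⟩
    length word ℕ.+ length (closes (opens word)) ≡⟨ cong₂ ℕ._+_ (proj₁ isWord) (List.length-replicate (opens word)) ⟩
    suc size ℕ.+ opens word ≤⟨ ℕ.+-monoʳ-≤ (suc size) (ℕ.≤-trans (opens≤ word) (ℕ.≤-reflexive (proj₁ isWord))) ⟩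
    suc size ℕ.+ suc size ≤⟨ ℕ.+-monoʳ-≤ (suc size) (ℕ.n≤1+n (suc size)) ⟩
    suc (L size) ∎
    where open ℕ.≤-Reasoning
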